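{- Let $n$ be a positive integer and write $2n+5=3^{\beta}n_1$ with $n_1$ a positive integer and $3\nmid n_1$. Then $$t(1,3,4,12;n)=2\big(\sigma(n_1)-(-1)^na(2n+5)\big).$$
   Context: $\sigma(n)=\sum_{d\mid n,\,d\ge1}d$. The integers $a(n)$ ($n\ge1$) are defined by $q\prod_{k=1}^{\infty}(1-q^{2k})(1-q^{4k})(1-q^{6k})(1-q^{12k})=\sum_{n=1}^{\infty}a(n)q^n$ for $|q|<1$. For positive integers $a,b,c,d$ and a nonnegative integer $n$, $t(a,b,c,d;n)$ denotes the number of $(x,y,z,w)\in\mathbb Z^4$ with $n=a\frac{x(x-1)}2+b\frac{y(y-1)}2+c\frac{z(z-1)}2+d\frac{w(w-1)}2$. -}

module Defs where

open import Data.Nat as ℕ using (ℕ; zero; suc)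
open import Data.Nat.Divisibility using (_∣?_)
open import Data.Integer as ℤ using (ℤ; +_; -_)
open import Data.List using (List; []; _∷_; map; filter; length; upTo; concatMap; replicate; _++_)
open import Data.Nat.ListAction using (sum)
open import Data.Product using (_×_; _,_)
open import Relation.Binary.PropositionalEquality using (_≡_)

σ : ℕ → ℕ
σ n = sum (filter (_∣? n) (map suc (upTo n)))

-- Polynomials over ℤ as coefficient lists (constant term first)
infixl 6 _⊕_
_⊕_ : List ℤ → List ℤ → List ℤ
[] ⊕ q = q
(a ∷ p) ⊕ [] = a ∷ p
(a ∷ p) ⊕ (b ∷ q) = (a ℤ.+ b) ∷ (p ⊕ q)

infixl 7 _⊗_
_⊗_ : List ℤ → List ℤ → List ℤ
[] ⊗ q = []
(a ∷ p) ⊗ q = map (a ℤ.*_) q ⊕ (+ 0 ∷ (p ⊗ q))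

coeff : List ℤ → ℕ → ℤ
coeff [] _ = + 0
coeff (a ∷ p) zero = a
coeff (a ∷ p) (suc i) = coeff p i

oneMinusQ : ℕ → List ℤ
oneMinusQ j = (+ 1 ∷ []) ⊕ (replicate j (+ 0) ++ (- (+ 1) ∷ []))

factor : ℕ → List ℤ
factor k = oneMinusQ (2 ℕ.* k) ⊗ oneMinusQ (4 ℕ.* k) ⊗ oneMinusQ (6 ℕ.* k) ⊗ oneMinusQ (12 ℕ.* k)

prodUpTo : ℕ → List ℤ
prodUpTo zero = + 1 ∷ []
prodUpTo (suc m) = prodUpTo m ⊗ factor (suc m)

-- a(m) = coefficient of q^m in q ∏_{k≥1} (1-q^{2k})(1-q^{4k})(1-q^{6k})(1-q^{12k}),
-- i.e. the coefficient of q^{m-1} in the infinite product; factors with k ≥ m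
-- only affect degrees ≥ 2m > m-1, so truncating the product at k = m is exact.
a : ℕ → ℤ
a zero = + 0
a (suc m) = coeff (prodUpTo (suc m)) m

tri2 : ℤ → ℤ
tri2 x = x ℤ.* (x ℤ.- + 1)

-- A box of integers [-(n+1), n+1]; every solution of
-- n = a x(x-1)/2 + ... (a,b,c,d ≥ 1) has |x|,|y|,|z|,|w| ≤ n+1.
box : ℕ → List ℤ
box n = map (λ i → + i ℤ.- + (suc n)) (upTo (suc (2 ℕ.* suc n)))

quads : ℕ → List (ℤ × ℤ × ℤ × ℤ)
quads n = concatMap (λ x → concatMap (λ y → concatMap (λ z → map (λ w → (x , y , z , w)) (box n)) (box n)) (box n)) (box n)

-- t(a,b,c,d;n) = #{(x,y,z,w) ∈ ℤ⁴ : n = a x(x-1)/2 + b y(y-1)/2 + c z(z-1)/2 + d w(w-1)/2}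
-- (equation multiplied by 2, counted over the box that contains all solutions)
t : ℕ → ℕ → ℕ → ℕ → ℕ → ℕ
t a' b c d n = length (filter (λ { (x , y , z , w) →
    (+ a' ℤ.* tri2 x ℤ.+ + b ℤ.* tri2 y ℤ.+ + c ℤ.* tri2 z ℤ.+ + d ℤ.* tri2 w) ℤ.≟ + (2 ℕ.* n) })
  (quads n))

sgn : ℕ → ℤ
sgn zero = + 1
sgn (suc n) = - sgn n

{-# OPTIONS --safe #-}
module Submission where

-- Write χ = (·/3) and G(q) = ∑ q^m ∑_{d∣m} χ(d) over odd m. Multiplying q-expansions,
-- ∑ t(1,3,4,12;n) q^{2n+5} = 16 G(q) G(q⁴), because G(q) = q ψ(q²) ψ(q⁶), and the twisted cusp form
-- ∑ (-1)^n a(2n+5) q^{2n+5} equals G(q) Φ(q⁴) with Φ = 1 - 2 ∑_{a,b} (-1)^{a+b} χ(a) q^{ab}. Both product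
-- formulas follow by comparing logarithmic derivatives q f′/f, which for products are divisor sums and for
-- G and Φ are computed by convolution sums over ab + cd = n. Since 1 + 6 ∑_{a,b} χ(a) q^{4ab} = Φ(q⁴) + 8 G(q⁴),
-- a third convolution sum, G(q) (1 + 6 ∑ χ(a) q^{4ab}) = ∑ q^m ∑_{d∣m, 3∤d} d over odd m, gives the theorem.
-- All three convolution sums are instances of one elementary identity of Liouville type.
open import Defs
open import Data.Nat as ℕ using (ℕ; zero; suc; _^_)
import Data.Nat.Properties as ℕP
import Data.Nat.Tactic.RingSolver as ℕR
open import Data.Nat.Coprimality using (Coprime; coprime-divisor)
open import Data.Nat.Divisibility as ∣ using (_∣_; _∣?_; divides)
open import Data.Nat.ListAction using (sum)
open import Data.Nat.Primality using (prime?; prime⇒irreducible)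
open import Data.Integer as ℤ using (ℤ; +_; -_; _+_; _*_; _-_)
import Data.Integer.Properties as ℤP
import Data.Integer.Tactic.RingSolver as ℤR
open import Algebra.Bundles using (AbelianGroup)
import Algebra.Properties.Group (AbelianGroup.group ℤP.+-0-abelianGroup) as ℤG
open import Data.Empty using (⊥-elim)
open import Data.Fin as Fin using (Fin; #_)
open import Data.Fin.Properties using (all?)
open import Data.List using (List; []; _∷_; map; filter; length; upTo; applyUpTo; concatMap; replicate; _++_)
open import Data.Product using (_×_; _,_; proj₁; proj₂; ∃)
open import Data.Sum using (_⊎_; inj₁; inj₂)
open import Data.Vec using ([]; _∷_; lookup)
open import Relation.Nullary using (¬_; Dec; yes; no)
open import Relation.Nullary.Decidable using (True; toWitness; from-yes; _×-dec_; _⊎-dec_; _→-dec_)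
open import Relation.Binary.PropositionalEquality

-- Nothing here has to converge: a series is its coefficient function, double series are cut off to
-- 1..N, and coefficients up to K < N are exact. A logarithmic derivative is stated without
-- division, as n f(n) = (f l)(n). Since l has no constant term, this recursion determines f from
-- f(0), so two series are equal once their logarithmic derivatives and constant terms agree. The
-- Liouville-type identity rests on two ways to split a sum over ab + cd = n: at a = c and at b = d.
-- The off-diagonal pieces of four such sums coincide and cancel. What remains are diagonals, on
-- which n factors, so a convolution becomes a divisor sum. The test functions are linear with
-- coefficients of period 6, the least period that sees both parity and χ; their hypotheses are
-- therefore finite tables. Linear terms serve the two logarithmic derivatives, whose convolutions
-- carry a weight a; the third convolution has a purely periodic test function. The sign (-1)^n is
-- the substitution q² ↦ -q² in the product, after which its logarithmic derivative splits into
-- those of G/q and Φ(q⁴).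

infixr 0 _∙_
_∙_ : ∀ {ℓ} {A : Set ℓ} {x y z : A} → x ≡ y → y ≡ z → x ≡ z
_∙_ = trans

-- Finite sums

∑ : ℕ → (ℕ → ℤ) → ℤ
∑ zero f = + 0
∑ (suc n) f = f 0 + ∑ n (λ i → f (suc i))

∑-cong< : ∀ n {f g : ℕ → ℤ} → (∀ i → i ℕ.< n → f i ≡ g i) → ∑ n f ≡ ∑ n g
∑-cong< zero h = refl
∑-cong< (suc n) h = cong₂ _+_ (h 0 (ℕ.s≤s ℕ.z≤n)) (∑-cong< n (λ i p → h (suc i) (ℕ.s≤s p)))

∑-cong : ∀ n {f g : ℕ → ℤ} → (∀ i → f i ≡ g i) → ∑ n f ≡ ∑ n g
∑-cong n h = ∑-cong< n (λ i _ → h i)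

∑-zero : ∀ n {f : ℕ → ℤ} → (∀ i → i ℕ.< n → f i ≡ + 0) → ∑ n f ≡ + 0
∑-zero zero h = refl
∑-zero (suc n) h = cong₂ _+_ (h 0 (ℕ.s≤s ℕ.z≤n)) (∑-zero n (λ i p → h (suc i) (ℕ.s≤s p)))

∑-+ : ∀ n (f g : ℕ → ℤ) → ∑ n (λ i → f i + g i) ≡ ∑ n f + ∑ n g
∑-+ zero f g = refl
∑-+ (suc n) f g = cong (_+_ (f 0 + g 0)) (∑-+ n _ _) ∙ lem (f 0) (g 0) _ _
  where lem : ∀ a b c d → a + b + (c + d) ≡ a + c + (b + d)
        lem = ℤR.solve-∀

∑-*ˡ : ∀ n k (f : ℕ → ℤ) → ∑ n (λ i → k * f i) ≡ k * ∑ n f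
∑-*ˡ zero k f = sym (ℤP.*-zeroʳ k)
∑-*ˡ (suc n) k f = cong (_+_ (k * f 0)) (∑-*ˡ n k _) ∙ sym (ℤP.*-distribˡ-+ k _ _)

∑-*ʳ : ∀ n k (f : ℕ → ℤ) → ∑ n (λ i → f i * k) ≡ ∑ n f * k
∑-*ʳ n k f = ∑-cong n (λ i → ℤP.*-comm (f i) k) ∙ ∑-*ˡ n k f ∙ ℤP.*-comm k _

∑-swap : ∀ m n (f : ℕ → ℕ → ℤ) → ∑ m (λ i → ∑ n (f i)) ≡ ∑ n (λ j → ∑ m (λ i → f i j))
∑-swap zero n f = sym (∑-zero n (λ _ _ → refl))
∑-swap (suc m) n f = cong (_+_ (∑ n (f 0))) (∑-swap m n _) ∙ sym (∑-+ n _ _)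

∑-split : ∀ m n (f : ℕ → ℤ) → ∑ (m ℕ.+ n) f ≡ ∑ m f + ∑ n (λ i → f (m ℕ.+ i))
∑-split zero n f = sym (ℤP.+-identityˡ _)
∑-split (suc m) n f = cong (_+_ (f 0)) (∑-split m n _) ∙ sym (ℤP.+-assoc (f 0) _ _)

∑-last : ∀ n (f : ℕ → ℤ) → ∑ (suc n) f ≡ ∑ n f + f n
∑-last zero f = ℤP.+-comm (f 0) _
∑-last (suc n) f = cong (_+_ (f 0)) (∑-last n _) ∙ sym (ℤP.+-assoc (f 0) _ _)

-- The recursion is at the top index, so that raising the bound, as in `∑₁-extend`, adds terms by
-- definition.
∑₁ : ℕ → (ℕ → ℤ) → ℤ
∑₁ zero f = + 0
∑₁ (suc n) f = ∑₁ n f + f (suc n)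

∑₁≡∑ : ∀ n (f : ℕ → ℤ) → ∑₁ n f ≡ ∑ n (λ i → f (suc i))
∑₁≡∑ zero f = refl
∑₁≡∑ (suc n) f = cong (_+ f (suc n)) (∑₁≡∑ n f) ∙ sym (∑-last n (λ i → f (suc i)))

∑₁-cong : ∀ n {f g : ℕ → ℤ} → (∀ i → f (suc i) ≡ g (suc i)) → ∑₁ n f ≡ ∑₁ n g
∑₁-cong zero h = refl
∑₁-cong (suc n) h = cong₂ _+_ (∑₁-cong n h) (h n)

∑₁-zero : ∀ n {f : ℕ → ℤ} → (∀ i → f (suc i) ≡ + 0) → ∑₁ n f ≡ + 0
∑₁-zero zero h = refl
∑₁-zero (suc n) h = cong₂ _+_ (∑₁-zero n h) (h n)

∑₁-+ : ∀ n (f g : ℕ → ℤ) → ∑₁ n (λ i → f i + g i) ≡ ∑₁ n f + ∑₁ n g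
∑₁-+ n f g = ∑₁≡∑ n (λ i → f i + g i) ∙ ∑-+ n (λ i → f (suc i)) (λ i → g (suc i)) ∙ sym (cong₂ _+_ (∑₁≡∑ n f) (∑₁≡∑ n g))

∑₁-*ˡ : ∀ n k (f : ℕ → ℤ) → ∑₁ n (λ i → k * f i) ≡ k * ∑₁ n f
∑₁-*ˡ n k f = ∑₁≡∑ n (λ i → k * f i) ∙ ∑-*ˡ n k (λ i → f (suc i)) ∙ cong (k *_) (sym (∑₁≡∑ n f))

∑₁-swap : ∀ m n (f : ℕ → ℕ → ℤ) → ∑₁ m (λ i → ∑₁ n (f i)) ≡ ∑₁ n (λ j → ∑₁ m (λ i → f i j))
∑₁-swap zero n f = sym (∑₁-zero n (λ _ → refl))
∑₁-swap (suc m) n f = cong (_+ ∑₁ n (f (suc m))) (∑₁-swap m n f) ∙ sym (∑₁-+ n (λ j → ∑₁ m (λ i → f i j)) (f (suc m)))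

-- Induction peels off row 0, column 0 and their corner. Because H vanishes outside the box, the
-- difference k may run over the full range even where j + k + 1 leaves the box; `lower` discards
-- exactly such terms.
∑-trichotomy : ∀ n (H : ℕ → ℕ → ℤ) → (∀ i j → n ℕ.≤ i ⊎ n ℕ.≤ j → H i j ≡ + 0) →
  ∑ n (λ i → ∑ n (H i)) ≡ ∑ n (λ j → ∑ n (λ k → H (j ℕ.+ suc k) j)) +
    ∑ n (λ i → ∑ n (λ k → H i (i ℕ.+ suc k))) + ∑ n (λ i → H i i)
∑-trichotomy zero H v = refl
∑-trichotomy (suc n) H v =
  cong (_+_ (H 0 0 + ∑ n (λ j → H 0 (suc j)))) (∑-+ n (λ i → H (suc i) 0) _ ∙ cong (_+_ (∑ n (λ i → H (suc i) 0))) ih)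
  ∙ lem (H 0 0) (∑ n (λ j → H 0 (suc j))) (∑ n (λ i → H (suc i) 0)) _ _ (∑ n (λ i → H (suc i) (suc i)))
  ∙ cong (λ t → t + ∑ (suc n) (λ i → H i i)) (cong₂ _+_ (sym (lower (λ k → H (suc k) 0) (v (suc n) 0 (inj₁ ℕP.≤-refl)) (λ j k → H (suc j ℕ.+ suc k) (suc j)) (λ j → v _ _ (inj₁ (big j)))))
                         (sym (lower (λ k → H 0 (suc k)) (v 0 (suc n) (inj₂ ℕP.≤-refl)) (λ j k → H (suc j) (suc j ℕ.+ suc k)) (λ j → v _ _ (inj₂ (big j))))))
  where
    ih = ∑-trichotomy n (λ i j → H (suc i) (suc j)) (λ { i j (inj₁ p) → v _ _ (inj₁ (ℕ.s≤s p)) ; i j (inj₂ p) → v _ _ (inj₂ (ℕ.s≤s p)) })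
    lem : ∀ a b c x y z → a + b + (c + (x + y + z)) ≡ c + x + (b + y) + (a + z)
    lem = ℤR.solve-∀
    big : ∀ j → suc n ℕ.≤ suc j ℕ.+ suc n
    big j = ℕP.m≤n+m (suc n) (suc j)
    lower : (a : ℕ → ℤ) → a n ≡ + 0 → (h : ℕ → ℕ → ℤ) → (∀ j → h j n ≡ + 0) →
      ∑ (suc n) a + ∑ n (λ j → ∑ (suc n) (h j)) ≡ ∑ n a + ∑ n (λ j → ∑ n (h j))
    lower a p h q = cong₂ _+_ (drop a p) (∑-cong n (λ j → drop (h j) (q j)))
      where drop : (a : ℕ → ℤ) → a n ≡ + 0 → ∑ (suc n) a ≡ ∑ n a
            drop a p = ∑-last n a ∙ cong (_+_ (∑ n a)) p ∙ ℤP.+-identityʳ _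

δ : ℕ → ℕ → ℤ
δ zero zero = + 1
δ zero (suc n) = + 0
δ (suc m) zero = + 0
δ (suc m) (suc n) = δ m n

δ-refl : ∀ n → δ n n ≡ + 1
δ-refl zero = refl
δ-refl (suc n) = δ-refl n

δ-≢ : ∀ {m n} → ¬ (m ≡ n) → δ m n ≡ + 0
δ-≢ {zero} {zero} p = ⊥-elim (p refl)
δ-≢ {zero} {suc n} p = refl
δ-≢ {suc m} {zero} p = refl
δ-≢ {suc m} {suc n} p = δ-≢ (λ q → p (cong suc q))

δ-> : ∀ {m n} → n ℕ.< m → δ m n ≡ + 0
δ-> p = δ-≢ (λ q → ℕP.<⇒≢ p (sym q))

δ-guard : ∀ m n {x y : ℤ} → (m ≡ n → x ≡ y) → δ m n * x ≡ δ m n * y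
δ-guard zero zero h = cong (_*_ (+ 1)) (h refl)
δ-guard zero (suc n) h = refl
δ-guard (suc m) zero h = refl
δ-guard (suc m) (suc n) h = δ-guard m n (λ q → h (cong suc q))

δ-sym : ∀ m n → δ m n ≡ δ n m
δ-sym zero zero = refl
δ-sym zero (suc n) = refl
δ-sym (suc m) zero = refl
δ-sym (suc m) (suc n) = δ-sym m n

∑-δ : ∀ n m (f : ℕ → ℤ) → m ℕ.< n → ∑ n (λ i → δ i m * f i) ≡ f m
∑-δ (suc n) zero f p = cong₂ _+_ (ℤP.*-identityˡ (f 0)) (∑-zero n (λ i _ → refl)) ∙ ℤP.+-identityʳ _
∑-δ (suc n) (suc m) f (ℕ.s≤s p) = ℤP.+-identityˡ _ ∙ ∑-δ n m (λ i → f (suc i)) p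

-- Sums over quadruples of positive integers

Quad : Set
Quad = ℕ → ℕ → ℕ → ℕ → ℤ

-- The binders come in the order a, c, b, d, so that comparing a with c concerns the two outer sums.
-- For b against d the pairs are transposed first.
∑⁴ : ℕ → Quad → ℤ
∑⁴ N F = ∑₁ N λ a → ∑₁ N λ c → ∑₁ N λ b → ∑₁ N λ d → F a b c d

∑⁴-cong : ∀ N {F G : Quad} → (∀ a b c d → F (suc a) (suc b) (suc c) (suc d) ≡ G (suc a) (suc b) (suc c) (suc d)) → ∑⁴ N F ≡ ∑⁴ N G
∑⁴-cong N h = ∑₁-cong N λ a → ∑₁-cong N λ c → ∑₁-cong N λ b → ∑₁-cong N λ d → h a b c d

∑⁴-transpose : ∀ N (F : Quad) → ∑⁴ N F ≡ (∑₁ N λ b → ∑₁ N λ d → ∑₁ N λ a → ∑₁ N λ c → F a b c d)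
∑⁴-transpose N F =
    ∑₁-cong N (λ a → ∑₁-swap N N (λ c b → ∑₁ N (F (suc a) b c)))
  ∙ ∑₁-swap N N (λ a b → ∑₁ N λ c → ∑₁ N (F a b c))
  ∙ ∑₁-cong N (λ b → ∑₁-cong N (λ a → ∑₁-swap N N (F (suc a) (suc b))) ∙ ∑₁-swap N N (λ a d → ∑₁ N λ c → F a (suc b) c d))

∑⁴-exchange : ∀ N (F : Quad) → ∑⁴ N F ≡ ∑⁴ N (λ a b c d → F c d a b)
∑⁴-exchange N F = ∑₁-swap N N (λ a c → ∑₁ N λ b → ∑₁ N (F a b c)) ∙ ∑₁-cong N (λ c → ∑₁-cong N λ a → ∑₁-swap N N (λ b d → F (suc a) b (suc c) d))

∑³ : ℕ → (ℕ → ℕ → ℕ → ℤ) → ℤ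
∑³ N F = ∑₁ N λ a → ∑₁ N λ b → ∑₁ N λ c → F a b c

∑³-cong : ∀ N {F G : ℕ → ℕ → ℕ → ℤ} → (∀ a b c → F (suc a) (suc b) (suc c) ≡ G (suc a) (suc b) (suc c)) → ∑³ N F ≡ ∑³ N G
∑³-cong N h = ∑₁-cong N λ a → ∑₁-cong N λ b → ∑₁-cong N λ c → h a b c

∑₁-trichotomy : ∀ n (H : ℕ → ℕ → ℤ) → (∀ i j → n ℕ.< i ⊎ n ℕ.< j → H i j ≡ + 0) →
  ∑₁ n (λ i → ∑₁ n (H i)) ≡ ∑₁ n (λ i → ∑₁ n λ j → H (j ℕ.+ i) j) + ∑₁ n (λ i → ∑₁ n λ j → H i (i ℕ.+ j)) + ∑₁ n (λ i → H i i)
∑₁-trichotomy n H v =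
    double H
  ∙ ∑-trichotomy n (λ i j → H (suc i) (suc j)) (λ { i j (inj₁ p) → v _ _ (inj₁ (ℕ.s≤s p)) ; i j (inj₂ p) → v _ _ (inj₂ (ℕ.s≤s p)) })
  ∙ cong₂ _+_ (cong₂ _+_ (∑-swap n n (λ j k → H (suc j ℕ.+ suc k) (suc j)) ∙ sym (double (λ i j → H (j ℕ.+ i) j)))
                         (sym (double (λ i j → H i (i ℕ.+ j)))))
              (sym (∑₁≡∑ n (λ i → H i i)))
  where
    double : ∀ (F : ℕ → ℕ → ℤ) → ∑₁ n (λ i → ∑₁ n (F i)) ≡ ∑ n (λ i → ∑ n (λ j → F (suc i) (suc j)))
    double F = ∑₁≡∑ n (λ i → ∑₁ n (F i)) ∙ ∑-cong n (λ i → ∑₁≡∑ n (F (suc i)))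

∑⁴-trichotomy-ac : ∀ N (F : Quad) → (∀ a b c d → N ℕ.< a ⊎ N ℕ.< c → F a (suc b) c (suc d) ≡ + 0) →
  ∑⁴ N F ≡ ∑⁴ N (λ a b c d → F (c ℕ.+ a) b c d) + ∑⁴ N (λ a b c d → F a b (a ℕ.+ c) d) + ∑³ N (λ a b d → F a b a d)
∑⁴-trichotomy-ac N F v = ∑₁-trichotomy N (λ a c → ∑₁ N λ b → ∑₁ N λ d → F a b c d)
  (λ a c p → ∑₁-zero N (λ b → ∑₁-zero N (λ d → v a b c d p)))

∑⁴-trichotomy-bd : ∀ N (F : Quad) → (∀ a b c d → N ℕ.< b ⊎ N ℕ.< d → F (suc a) b (suc c) d ≡ + 0) →
  ∑⁴ N F ≡ ∑⁴ N (λ a b c d → F a (d ℕ.+ b) c d) + ∑⁴ N (λ a b c d → F a b c (b ℕ.+ d)) + ∑³ N (λ b a c → F a b c b)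
∑⁴-trichotomy-bd N F v = ∑⁴-transpose N F ∙ ∑₁-trichotomy N (λ b d → ∑₁ N λ a → ∑₁ N λ c → F a b c d)
  (λ b d p → ∑₁-zero N (λ a → ∑₁-zero N (λ c → v a b c d p)))
  ∙ cong₂ (λ x y → x + y + ∑³ N (λ b a c → F a b c b)) (sym (∑⁴-transpose N (λ a b c d → F a (d ℕ.+ b) c d))) (sym (∑⁴-transpose N (λ a b c d → F a b c (b ℕ.+ d))))

-- Residues modulo 6

-- Residues form a finite type and the functions on them are tables, so identities between such
-- functions are decided by exhaustion.
ℤ₆ : Set
ℤ₆ = Fin 6

next : ℤ₆ → ℤ₆
next = lookup (# 1 ∷ # 2 ∷ # 3 ∷ # 4 ∷ # 5 ∷ # 0 ∷ [])

times : ℕ → (ℤ₆ → ℤ₆) → ℤ₆ → ℤ₆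
times zero g r = r
times (suc n) g r = g (times n g r)

infixl 6 _⊞_
infixl 7 _⊠_
_⊞_ _⊠_ : ℤ₆ → ℤ₆ → ℤ₆
r ⊞ s = times (Fin.toℕ r) next s
r ⊠ s = times (Fin.toℕ r) (s ⊞_) (# 0)

⊟_ : ℤ₆ → ℤ₆
⊟_ = lookup (# 0 ∷ # 5 ∷ # 4 ∷ # 3 ∷ # 2 ∷ # 1 ∷ [])

res : ℕ → ℤ₆
res zero = # 0
res (suc n) = next (res n)

res-+ : ∀ m n → res (m ℕ.+ n) ≡ res m ⊞ res n
res-+ zero n = refl
res-+ (suc m) n = cong next (res-+ m n) ∙ sym (next-⊞ (res m) (res n))
  where next-⊞ : ∀ r s → next r ⊞ s ≡ next (r ⊞ s)
        next-⊞ = from-yes (all? λ r → all? λ s → next r ⊞ s Fin.≟ next (r ⊞ s))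

res-* : ∀ m n → res (m ℕ.* n) ≡ res m ⊠ res n
res-* zero n = refl
res-* (suc m) n = res-+ n (m ℕ.* n) ∙ cong (res n ⊞_) (res-* m n) ∙ sym (next-⊠ (res m) (res n))
  where next-⊠ : ∀ r s → next r ⊠ s ≡ s ⊞ (r ⊠ s)
        next-⊠ = from-yes (all? λ r → all? λ s → next r ⊠ s Fin.≟ s ⊞ (r ⊠ s))

odd even χ 3∣ ε : ℤ₆ → ℤ
odd  = lookup (+ 0 ∷ + 1 ∷ + 0 ∷ + 1 ∷ + 0 ∷ + 1 ∷ [])
even = lookup (+ 1 ∷ + 0 ∷ + 1 ∷ + 0 ∷ + 1 ∷ + 0 ∷ [])
χ    = lookup (+ 0 ∷ + 1 ∷ - + 1 ∷ + 0 ∷ + 1 ∷ - + 1 ∷ [])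
3∣   = lookup (+ 1 ∷ + 0 ∷ + 0 ∷ + 1 ∷ + 0 ∷ + 0 ∷ [])
ε    = lookup (+ 1 ∷ - + 1 ∷ + 1 ∷ - + 1 ∷ + 1 ∷ - + 1 ∷ [])

-- An identity of Liouville type for sums over ab + cd = n

module Liouville (N n : ℕ) (n≤N : n ℕ.≤ N) (Q K q : ℕ → ℕ → ℤ)
  (Q-sym : ∀ a c → Q a c ≡ Q c a) (K-sym : ∀ a c → K a c ≡ K c a)
  -- These laws say what q becomes after the substitutions for a > c and for a < c: K in the first
  -- case, Q in the second. Symmetry of Q and K brings the two halves of a split into one normal
  -- form.
  (q-> : ∀ a c → q (c ℕ.+ a) c ≡ K (c ℕ.+ a) a) (q-< : ∀ a c → q a (a ℕ.+ c) ≡ Q c a) where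

  private
    o e : ℕ → ℤ
    o b = odd (res b)
    e b = even (res b)

    Δ : ℕ → ℕ → ℕ → ℕ → ℤ
    Δ a b c d = δ (a ℕ.* b ℕ.+ c ℕ.* d) n

    S : (ℕ → ℕ → ℤ) → (ℕ → ℕ → ℤ) → ℤ
    S u v = ∑⁴ N λ a b c d → Δ a b c d * (u b d * v a c)

    big : ∀ {a b} c d → N ℕ.< a → δ (a ℕ.* suc b ℕ.+ c ℕ.* d) n ≡ + 0
    big {a} {b} c d p = δ-> (ℕP.≤-<-trans n≤N (ℕP.<-≤-trans p (ℕP.≤-trans (ℕP.m≤m*n a (suc b)) (ℕP.m≤m+n _ _))))

    Δ-swap : ∀ a b c d → Δ a b c d ≡ Δ c d a b
    Δ-swap a b c d = cong (λ t → δ t n) (ℕP.+-comm (a ℕ.* b) _)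
    Δ-dual : ∀ a b c d → Δ a b c d ≡ Δ b a d c
    Δ-dual a b c d = cong₂ (λ t u → δ (t ℕ.+ u) n) (ℕP.*-comm a b) (ℕP.*-comm c d)

    vanish-ac : ∀ (u v : ℕ → ℕ → ℤ) a b c d → N ℕ.< a ⊎ N ℕ.< c → Δ a (suc b) c (suc d) * (u (suc b) (suc d) * v a c) ≡ + 0
    vanish-ac u v a b c d (inj₁ p) rewrite big {a} {b} c (suc d) p = refl
    vanish-ac u v a b c d (inj₂ p) rewrite Δ-swap a (suc b) c (suc d) | big {c} {d} a (suc b) p = refl

    vanish-bd : ∀ (u v : ℕ → ℕ → ℤ) a b c d → N ℕ.< b ⊎ N ℕ.< d → Δ (suc a) b (suc c) d * (u b d * v (suc a) (suc c)) ≡ + 0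
    vanish-bd u v a b c d (inj₁ p) rewrite Δ-dual (suc a) b (suc c) d | big {b} {a} d (suc c) p = refl
    vanish-bd u v a b c d (inj₂ p) rewrite Δ-swap (suc a) b (suc c) d | Δ-dual (suc c) d (suc a) b | big {d} {c} b (suc a) p = refl

    split-ac : ∀ u v → S u v ≡
      ∑⁴ N (λ a b c d → Δ (c ℕ.+ a) b c d * (u b d * v (c ℕ.+ a) c)) +
      ∑⁴ N (λ a b c d → Δ a b (a ℕ.+ c) d * (u b d * v a (a ℕ.+ c))) +
      ∑³ N (λ a b d → Δ a b a d * (u b d * v a a))
    split-ac u v = ∑⁴-trichotomy-ac N (λ a b c d → Δ a b c d * (u b d * v a c)) (vanish-ac u v)

    split-bd : ∀ u v → S u v ≡
      ∑⁴ N (λ a b c d → Δ a (d ℕ.+ b) c d * (u (d ℕ.+ b) d * v a c)) +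
      ∑⁴ N (λ a b c d → Δ a b c (b ℕ.+ d) * (u b (b ℕ.+ d) * v a c)) +
      ∑³ N (λ b a c → Δ a b c b * (u b b * v a c))
    split-bd u v = ∑⁴-trichotomy-bd N (λ a b c d → Δ a b c d * (u b d * v a c)) (vanish-bd u v)

    -- the common normal form ab + ad + cd of both halves of a split
    T : (ℕ → ℕ → ℤ) → (ℕ → ℕ → ℤ) → ℤ
    T u v = ∑⁴ N λ a b c d → Δ a b (a ℕ.+ c) d * (u b d * v a c)

    eo oo : ℕ → ℕ → ℤ
    eo b d = e b * o d
    oo b d = o b * o d

    exch : (a b c d : ℕ) → (c ℕ.+ a) ℕ.* b ℕ.+ c ℕ.* d ≡ a ℕ.* b ℕ.+ c ℕ.* (b ℕ.+ d)
    exch = ℕR.solve-∀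
    exch′ : (a b c d : ℕ) → a ℕ.* (d ℕ.+ b) ℕ.+ c ℕ.* d ≡ a ℕ.* b ℕ.+ (a ℕ.+ c) ℕ.* d
    exch′ = ℕR.solve-∀

    term : ∀ {x y} {u u′ v v′ : ℤ} → x ≡ y → u ≡ u′ → v ≡ v′ → δ x n * (u * v) ≡ δ y n * (u′ * v′)
    term refl refl refl = refl

    -- Adding d to b exchanges the parity patterns (even, odd) and (odd, odd), while adding b to d
    -- keeps (even, odd). Splitting (odd, odd) at b = d thus gives the pattern (even, odd) from both
    -- halves, which accounts for the factor 2 in `liouville`.
    eo-shift : ∀ b d → eo b (b ℕ.+ d) ≡ eo b d
    eo-shift b d rewrite res-+ b d = from-yes (all? λ r → all? λ s → even r * odd (r ⊞ s) ℤ.≟ even r * odd s) (res b) (res d)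
    eo-flip : ∀ b d → eo (d ℕ.+ b) d ≡ oo b d
    eo-flip b d rewrite res-+ d b = from-yes (all? λ r → all? λ s → even (s ⊞ r) * odd s ℤ.≟ odd r * odd s) (res b) (res d)
    oo-flip : ∀ b d → oo (d ℕ.+ b) d ≡ eo b d
    oo-flip b d rewrite res-+ d b = from-yes (all? λ r → all? λ s → odd (s ⊞ r) * odd s ℤ.≟ even r * odd s) (res b) (res d)
    oo-flip′ : ∀ b d → oo b (b ℕ.+ d) ≡ eo d b
    oo-flip′ b d rewrite res-+ b d = from-yes (all? λ r → all? λ s → odd r * odd (r ⊞ s) ℤ.≟ even s * odd r) (res b) (res d)
    eo-diag : ∀ b → eo b b ≡ + 0
    eo-diag b = from-yes (all? λ r → even r * odd r ℤ.≟ + 0) (res b)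
    oo-diag : ∀ b → oo b b ≡ o b
    oo-diag b = from-yes (all? λ r → odd r * odd r ℤ.≟ odd r) (res b)

    D₁ D₂ D₃ : ℤ
    D₁ = ∑³ N λ a b d → Δ a b a d * (eo b d * q a a)
    D₂ = ∑³ N λ b a c → Δ a b c b * (o b * Q a c)
    D₃ = ∑³ N λ a b d → Δ a b a d * (oo b d * K a a)

    -- Arises from a > c in the sum with q and from b < d in the sum with K, so it drops out of the
    -- first difference.
    I : ℤ
    I = ∑⁴ N λ a b c d → Δ a b c (b ℕ.+ d) * (eo b d * K (a ℕ.+ c) a)

    S₁ : S eo q ≡ I + T eo Q + D₁
    S₁ = split-ac eo q ∙ cong (_+ D₁) (cong₂ _+_
      (∑⁴-cong N (λ a b c d → let a = suc a; b = suc b; c = suc c; d = suc d in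
         term (exch a b c d) (refl {x = eo b d}) (q-> a c ∙ cong (λ t → K t a) (ℕP.+-comm c a))))
      (∑⁴-cong N (λ a b c d → let a = suc a; b = suc b; c = suc c; d = suc d in
         term (refl {x = a ℕ.* b ℕ.+ (a ℕ.+ c) ℕ.* d}) (refl {x = eo b d}) (q-< a c ∙ Q-sym c a))))

    S₂ : S eo (λ a c → K (a ℕ.+ c) a) ≡ T oo (λ a c → K (a ℕ.+ c) a) + I + + 0
    S₂ = split-bd eo (λ a c → K (a ℕ.+ c) a) ∙ cong₂ _+_ (cong₂ _+_
      (∑⁴-cong N (λ a b c d → let a = suc a; b = suc b; c = suc c; d = suc d in
         term (exch′ a b c d) (eo-flip b d) (refl {x = K (a ℕ.+ c) a})))
      (∑⁴-cong N (λ a b c d → let a = suc a; b = suc b; c = suc c; d = suc d in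
         term (refl {x = a ℕ.* b ℕ.+ c ℕ.* (b ℕ.+ d)}) (eo-shift b d) (refl {x = K (a ℕ.+ c) a}))))
      -- On b = d one number would have to be both even and odd.
      (∑₁-zero N λ b → ∑₁-zero N λ a → ∑₁-zero N λ c →
         cong (λ t → Δ (suc a) (suc b) (suc c) (suc b) * (t * K (suc a ℕ.+ suc c) (suc a))) (eo-diag (suc b))
         ∙ ℤP.*-zeroʳ (Δ (suc a) (suc b) (suc c) (suc b)))

    S₃ : S oo Q ≡ T eo Q + T eo Q + D₂
    S₃ = split-bd oo Q ∙ cong₂ _+_ (cong₂ _+_
      (∑⁴-cong N (λ a b c d → let a = suc a; b = suc b; c = suc c; d = suc d in
         term (exch′ a b c d) (oo-flip b d) (refl {x = Q a c})))
      (∑⁴-exchange N (λ a b c d → Δ a b c (b ℕ.+ d) * (oo b (b ℕ.+ d) * Q a c)) ∙ ∑⁴-cong N (λ a b c d → let a = suc a; b = suc b; c = suc c; d = suc d in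
         term (ℕP.+-comm (c ℕ.* d) (a ℕ.* (d ℕ.+ b)) ∙ exch′ a b c d) (oo-flip′ d b) (Q-sym c a))))
      (∑³-cong N λ b a c → let a = suc a; b = suc b; c = suc c in
         term (refl {x = a ℕ.* b ℕ.+ c ℕ.* b}) (oo-diag b) (refl {x = Q a c}))

    S₄ : S oo K ≡ T oo (λ a c → K (a ℕ.+ c) a) + T oo (λ a c → K (a ℕ.+ c) a) + D₃
    S₄ = split-ac oo K ∙ cong (_+ D₃) (cong₂ _+_
      (∑⁴-exchange N (λ a b c d → Δ (c ℕ.+ a) b c d * (oo b d * K (c ℕ.+ a) c)) ∙ ∑⁴-cong N (λ a b c d → let a = suc a; b = suc b; c = suc c; d = suc d in
         term (ℕP.+-comm ((a ℕ.+ c) ℕ.* d) (a ℕ.* b)) (ℤP.*-comm (o d) (o b)) (refl {x = K (a ℕ.+ c) a})))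
      (∑⁴-cong N (λ a b c d → let a = suc a; b = suc b; c = suc c; d = suc d in
         term (refl {x = a ℕ.* b ℕ.+ (a ℕ.+ c) ℕ.* d}) (refl {x = oo b d}) (K-sym a (a ℕ.+ c)))))

  -- Both differences of split sums telescope to the sums over a = c or b = d.
  liouville : + 2 * (S eo q - S eo (λ a c → K (a ℕ.+ c) a)) - (S oo Q - S oo K) ≡ + 2 * D₁ - D₂ + D₃
  liouville rewrite S₁ | S₂ | S₃ | S₄ = lem I (T eo Q) D₁ (T oo (λ a c → K (a ℕ.+ c) a)) D₂ D₃
    where lem : ∀ i t d u d₂ d₃ → + 2 * (i + t + d - (u + i + + 0)) - (t + t + d₂ - (u + u + d₃)) ≡ + 2 * d - d₂ + d₃
          lem = ℤR.solve-∀

-- Sums over factorisations and over ordered partitions into two positive parts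

-- The box bound N is separate from n so that one box serves all coefficients; the sum over
-- factorisations is complete for 1 ≤ n ≤ N.
∑∣ : ℕ → ℕ → (ℕ → ℕ → ℤ) → ℤ
∑∣ N n F = ∑₁ N λ a → ∑₁ N λ b → δ (a ℕ.* b) n * F a b

compositions : (ℕ → ℕ → ℤ) → ℕ → ℤ
compositions u zero = + 0
compositions u (suc m) = ∑ m λ i → u (suc i) (m ℕ.∸ i)

∑-truncate : ∀ m N (f : ℕ → ℤ) → m ℕ.≤ N → (∀ i → m ℕ.≤ i → f i ≡ + 0) → ∑ N f ≡ ∑ m f
∑-truncate m N f p v = cong (λ t → ∑ t f) (sym (ℕP.m+[n∸m]≡n p)) ∙ ∑-split m (N ℕ.∸ m) f
  ∙ cong (_+_ (∑ m f)) (∑-zero (N ℕ.∸ m) (λ i _ → v (m ℕ.+ i) (ℕP.m≤m+n m i))) ∙ ℤP.+-identityʳ _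

compositions-cong : ∀ {u v : ℕ → ℕ → ℤ} → (∀ a c → u a c ≡ v a c) → ∀ m → compositions u m ≡ compositions v m
compositions-cong h zero = refl
compositions-cong h (suc m) = ∑-cong m (λ i → h (suc i) (m ℕ.∸ i))

compositions-*ˡ : ∀ k (u : ℕ → ℕ → ℤ) m → compositions (λ a c → k * u a c) m ≡ k * compositions u m
compositions-*ˡ k u zero = sym (ℤP.*-zeroʳ k)
compositions-*ˡ k u (suc m) = ∑-*ˡ m k (λ i → u (suc i) (m ℕ.∸ i))

compositions-+ : ∀ (u v : ℕ → ℕ → ℤ) m → compositions (λ a c → u a c + v a c) m ≡ compositions u m + compositions v m
compositions-+ u v zero = refl
compositions-+ u v (suc m) = ∑-+ m (λ i → u (suc i) (m ℕ.∸ i)) (λ i → v (suc i) (m ℕ.∸ i))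

compositions-∑₁ : ∀ N m (u : ℕ → ℕ → ℤ) → m ℕ.≤ N →
  (∑₁ N λ a → ∑₁ N λ c → δ (a ℕ.+ c) m * u a c) ≡ compositions u m
compositions-∑₁ N zero u p = ∑₁-zero N λ a → ∑₁-zero N λ c → refl
compositions-∑₁ N (suc m) u p =
    ∑₁≡∑ N (λ a → ∑₁ N λ c → δ (a ℕ.+ c) (suc m) * u a c)
  ∙ ∑-cong N (λ i → ∑₁≡∑ N (λ c → δ (i ℕ.+ c) m * u (suc i) c))
  ∙ ∑-truncate m N (λ i → ∑ N λ j → δ (i ℕ.+ suc j) m * u (suc i) (suc j)) (ℕP.<⇒≤ p)
      (λ i q → ∑-zero N λ j _ → cong (_* u (suc i) (suc j)) (δ-> (ℕP.<-≤-trans (ℕ.s≤s q) (ℕP.≤-trans (ℕP.m≤m+n (suc i) j) (ℕP.≤-reflexive (sym (ℕP.+-suc i j)))))))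
  ∙ ∑-cong< m (λ i q → ∑-cong N (λ j → cong (_* u (suc i) (suc j)) (δ-∸ i j m q))
      ∙ ∑-δ N (m ℕ.∸ suc i) (λ j → u (suc i) (suc j)) (ℕP.≤-<-trans (ℕP.m∸n≤m m (suc i)) p)
      ∙ cong (u (suc i)) (sym (ℕP.+-∸-assoc 1 q)))
  where
    δ-∸ : ∀ i j m → i ℕ.< m → δ (i ℕ.+ suc j) m ≡ δ j (m ℕ.∸ suc i)
    δ-∸ zero j (suc m) p = refl
    δ-∸ (suc i) j (suc m) (ℕ.s≤s p) = δ-∸ i j m p

compositions-flip : ∀ (u : ℕ → ℕ → ℤ) m → compositions (λ a c → u c a) m ≡ compositions u m
compositions-flip u m = sym (compositions-∑₁ m m (λ a c → u c a) ℕP.≤-refl)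
  ∙ ∑₁-swap m m (λ a c → δ (a ℕ.+ c) m * u c a)
  ∙ (∑₁-cong m λ c → ∑₁-cong m λ a → cong (λ t → δ t m * u (suc c) (suc a)) (ℕP.+-comm (suc a) (suc c)))
  ∙ compositions-∑₁ m m u ℕP.≤-refl

res-6+ : ∀ n → res (6 ℕ.+ n) ≡ res n
res-6+ n = from-yes (all? λ r → next (next (next (next (next (next r))))) Fin.≟ r) (res n)

-- Sums of a function of residues that is linear in the first part: passing from m to m + 6
-- adds six terms, so a closed form follows from finitely many checks.
module Linear (C D : ℤ₆ → ℤ) (α β : ℤ₆ → ℤ₆ → ℤ) where

  summand : ℕ → ℕ → ℤ
  summand a c = α (res a) (res c) * + a + β (res a) (res c)

  closed : ℕ → ℤ
  closed m = C (res m) * + m + D (res m)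

  -- Going from m to m + 6 adds six terms, with first parts m + j and second parts 6 - j. `Slope`
  -- removes their dependence on m, and `Offset` makes them add up to 6 C, the increment of the
  -- closed form.
  Slope Offset Base : Set
  Slope = ∀ r → ∑ 6 (λ j → α (r ⊞ res j) (res (6 ℕ.∸ j))) ≡ + 0
  Offset = ∀ r → ∑ 6 (λ j → α (r ⊞ res j) (res (6 ℕ.∸ j)) * + j + β (r ⊞ res j) (res (6 ℕ.∸ j))) ≡ + 6 * C r
  Base = ∀ (r : Fin 6) → compositions summand (suc (Fin.toℕ r)) ≡ closed (suc (Fin.toℕ r))

  slope? : Dec Slope
  slope? = all? λ r → _ ℤ.≟ _

  offset? : Dec Offset
  offset? = all? λ r → _ ℤ.≟ _

  base? : Dec Base
  base? = all? λ r → _ ℤ.≟ _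

  compositions-closed : Slope → Offset → Base → ∀ m → compositions summand (suc m) ≡ closed (suc m)
  compositions-closed sl of ba 0 = ba (# 0)
  compositions-closed sl of ba 1 = ba (# 1)
  compositions-closed sl of ba 2 = ba (# 2)
  compositions-closed sl of ba 3 = ba (# 3)
  compositions-closed sl of ba 4 = ba (# 4)
  compositions-closed sl of ba 5 = ba (# 5)
  compositions-closed sl of ba (suc (suc (suc (suc (suc (suc m)))))) =
      cong (λ t → ∑ t F) (ℕP.+-comm 6 m)
    ∙ ∑-split m 6 F
    ∙ cong₂ _+_ (∑-cong< m (λ i p → cong (λ s → α (res (suc i)) s * + suc i + β (res (suc i)) s)
                   (cong res (ℕP.+-∸-assoc 6 (ℕP.<⇒≤ p)) ∙ res-6+ (m ℕ.∸ i))) ∙ compositions-closed sl of ba m)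
                (∑-cong 6 six ∙ ∑-+ 6 (λ j → α (r ⊞ res j) (res (6 ℕ.∸ j)) * + suc m) (λ j → α (r ⊞ res j) (res (6 ℕ.∸ j)) * + j + β (r ⊞ res j) (res (6 ℕ.∸ j)))
                  ∙ cong₂ _+_ (∑-*ʳ 6 (+ suc m) (λ j → α (r ⊞ res j) (res (6 ℕ.∸ j))) ∙ cong (_* + suc m) (sl r)) (of r))
    ∙ lem (C r) (D r) (+ suc m)
    ∙ sym (cong (λ s → C s * + (6 ℕ.+ suc m) + D s) (res-6+ (suc m)))
    where
      r = res (suc m)
      F : ℕ → ℤ
      F i = summand (suc i) (6 ℕ.+ m ℕ.∸ i)
      lem : ∀ c d m → c * m + d + (+ 0 + + 6 * c) ≡ c * (+ 6 + m) + d
      lem = ℤR.solve-∀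
      lem′ : ∀ x y m j → x * (m + j) + y ≡ x * m + (x * j + y)
      lem′ = ℤR.solve-∀
      six : ∀ j → F (m ℕ.+ j) ≡ α (r ⊞ res j) (res (6 ℕ.∸ j)) * + suc m + (α (r ⊞ res j) (res (6 ℕ.∸ j)) * + j + β (r ⊞ res j) (res (6 ℕ.∸ j)))
      six j = cong₂ (λ s t → α s (res t) * + suc (m ℕ.+ j) + β s (res t)) (res-+ (suc m) j)
                (cong (ℕ._∸ (m ℕ.+ j)) (ℕP.+-comm 6 m) ∙ ℕP.[m+n]∸[m+o]≡n∸o m 6 j)
        ∙ lem′ (α (r ⊞ res j) (res (6 ℕ.∸ j))) (β (r ⊞ res j) (res (6 ℕ.∸ j))) (+ suc m) (+ j)

  compositions-linear : (u : ℕ → ℕ → ℤ) → (∀ a c → u a c ≡ summand a c) → Slope → Offset → Base →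
    ∀ m → compositions u (suc m) ≡ closed (suc m)
  compositions-linear u h sl of ba m = compositions-cong h (suc m) ∙ compositions-closed sl of ba m

∑₁-δ : ∀ N k (f : ℕ → ℤ) → suc k ℕ.≤ N → ∑₁ N (λ m → δ (suc k) m * f m) ≡ f (suc k)
∑₁-δ N k f p = ∑₁≡∑ N (λ m → δ (suc k) m * f m) ∙ ∑-cong N (λ m → cong (_* f (suc m)) (δ-sym k m)) ∙ ∑-δ N k (λ m → f (suc m)) p

-- On the diagonal the constraint reads a (b + d) = n. Inserting a sum over m of `δ (b + d) m`,
-- which equals 1, turns it into a sum over factorisations n = a m with the compositions of m
-- inside.
regroup : ∀ N n (u : ℕ → ℕ → ℤ) (v : ℕ → ℤ) → n ℕ.≤ N →
  ∑³ N (λ a b d → δ (a ℕ.* b ℕ.+ a ℕ.* d) n * (u b d * v a)) ≡ ∑∣ N n (λ a m → v a * compositions u m)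
regroup N n u v n≤N = ∑₁-cong N λ a →
    (∑₁-cong N λ b → (∑₁-cong N λ d → expand a (suc b) d)
      ∙ ∑₁-swap N N (λ d m → δ (suc a ℕ.* m) n * (δ (suc b ℕ.+ d) m * (v (suc a) * u (suc b) d))))
  ∙ ∑₁-swap N N (λ b m → ∑₁ N λ d → δ (suc a ℕ.* m) n * (δ (b ℕ.+ d) m * (v (suc a) * u b d)))
  ∙ (∑₁-cong N λ m → collect a (suc m))
  where
    lem : ∀ x y z w → x * (y * (z * w)) ≡ x * y * z * w
    lem = ℤR.solve-∀
    expand : ∀ a b d → let a = suc a; d = suc d in
      δ (a ℕ.* b ℕ.+ a ℕ.* d) n * (u b d * v a) ≡ (∑₁ N λ m → δ (a ℕ.* m) n * (δ (b ℕ.+ d) m * (v a * u b d)))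
    expand a b d =
        δ-guard (suc a ℕ.* b ℕ.+ suc a ℕ.* suc d) n {y = (∑₁ N λ m → δ (b ℕ.+ suc d) m * (v (suc a) * u b (suc d)))}
          (λ q → ℤP.*-comm (u b (suc d)) (v (suc a)) ∙ sym (total q))
      ∙ sym (∑₁-*ˡ N (δ (suc a ℕ.* b ℕ.+ suc a ℕ.* suc d) n) (λ m → δ (b ℕ.+ suc d) m * (v (suc a) * u b (suc d))))
      ∙ ∑₁-cong N (λ m → lem₂ (δ (suc a ℕ.* b ℕ.+ suc a ℕ.* suc d) n) (δ (b ℕ.+ suc d) (suc m)) (v (suc a) * u b (suc d))
          ∙ δ-guard (b ℕ.+ suc d) (suc m) (λ q → cong (λ t → δ t n * (v (suc a) * u b (suc d))) (sym (ℕP.*-distribˡ-+ (suc a) b (suc d)) ∙ cong (suc a ℕ.*_) q))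
          ∙ lem₂ (δ (b ℕ.+ suc d) (suc m)) (δ (suc a ℕ.* suc m) n) (v (suc a) * u b (suc d)))
      where
        lem₂ : ∀ x y z → x * (y * z) ≡ y * (x * z)
        lem₂ = ℤR.solve-∀
        total : suc a ℕ.* b ℕ.+ suc a ℕ.* suc d ≡ n → (∑₁ N λ m → δ (b ℕ.+ suc d) m * (v (suc a) * u b (suc d))) ≡ v (suc a) * u b (suc d)
        total q rewrite ℕP.+-suc b d = ∑₁-δ N (b ℕ.+ d) (λ _ → v (suc a) * u b (suc d))
          (ℕP.≤-trans (ℕP.≤-trans (ℕP.m≤n*m (suc (b ℕ.+ d)) (suc a))
             (ℕP.≤-reflexive (cong (suc a ℕ.*_) (sym (ℕP.+-suc b d)) ∙ ℕP.*-distribˡ-+ (suc a) b (suc d) ∙ q))) n≤N)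
    collect : ∀ a m → (∑₁ N λ b → ∑₁ N λ d → δ (suc a ℕ.* m) n * (δ (b ℕ.+ d) m * (v (suc a) * u b d))) ≡ δ (suc a ℕ.* m) n * (v (suc a) * compositions u m)
    collect a m = (∑₁-cong N λ b → ∑₁-*ˡ N (δ (suc a ℕ.* m) n) (λ d → δ (suc b ℕ.+ d) m * (v (suc a) * u (suc b) d)))
      ∙ ∑₁-*ˡ N (δ (suc a ℕ.* m) n) (λ b → ∑₁ N λ d → δ (b ℕ.+ d) m * (v (suc a) * u b d))
      ∙ δ-guard (suc a ℕ.* m) n (λ q → compositions-∑₁ N m (λ b d → v (suc a) * u b d) (ℕP.≤-trans (ℕP.m≤n*m m (suc a)) (ℕP.≤-trans (ℕP.≤-reflexive q) n≤N))
          ∙ compositions-*ˡ (v (suc a)) u m)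

∑∣-cong : ∀ N n {F G : ℕ → ℕ → ℤ} → (∀ a b → suc a ℕ.* suc b ≡ n → F (suc a) (suc b) ≡ G (suc a) (suc b)) → ∑∣ N n F ≡ ∑∣ N n G
∑∣-cong N n h = ∑₁-cong N λ a → ∑₁-cong N λ b → δ-guard (suc a ℕ.* suc b) n (h a b)

∑∣-transpose : ∀ N n F → ∑∣ N n F ≡ ∑∣ N n (λ a b → F b a)
∑∣-transpose N n F = ∑₁-swap N N (λ a b → δ (a ℕ.* b) n * F a b)
  ∙ ∑₁-cong N λ b → ∑₁-cong N λ a → cong (λ t → δ t n * F (suc a) (suc b)) (ℕP.*-comm (suc a) (suc b))

∑∣-+ : ∀ N n F G → ∑∣ N n (λ a b → F a b + G a b) ≡ ∑∣ N n F + ∑∣ N n G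
∑∣-+ N n F G = (∑₁-cong N λ a → (∑₁-cong N λ b → ℤP.*-distribˡ-+ (δ (suc a ℕ.* suc b) n) (F (suc a) (suc b)) (G (suc a) (suc b)))
    ∙ ∑₁-+ N (λ b → δ (suc a ℕ.* b) n * F (suc a) b) (λ b → δ (suc a ℕ.* b) n * G (suc a) b))
  ∙ ∑₁-+ N (λ a → ∑₁ N λ b → δ (a ℕ.* b) n * F a b) (λ a → ∑₁ N λ b → δ (a ℕ.* b) n * G a b)

∑∣-*ˡ : ∀ N n k F → ∑∣ N n (λ a b → k * F a b) ≡ k * ∑∣ N n F
∑∣-*ˡ N n k F = (∑₁-cong N λ a → (∑₁-cong N λ b → lem (δ (suc a ℕ.* suc b) n) k (F (suc a) (suc b)))
    ∙ ∑₁-*ˡ N k (λ b → δ (suc a ℕ.* b) n * F (suc a) b))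
  ∙ ∑₁-*ˡ N k (λ a → ∑₁ N λ b → δ (a ℕ.* b) n * F a b)
  where lem : ∀ x y z → x * (y * z) ≡ y * (x * z)
        lem = ℤR.solve-∀

∑⁴-+ : ∀ N (F G : Quad) → ∑⁴ N (λ a b c d → F a b c d + G a b c d) ≡ ∑⁴ N F + ∑⁴ N G
∑⁴-+ N F G =
    (∑₁-cong N λ a → (∑₁-cong N λ c → (∑₁-cong N λ b → ∑₁-+ N (F (suc a) (suc b) (suc c)) (G (suc a) (suc b) (suc c)))
      ∙ ∑₁-+ N (λ b → ∑₁ N (F (suc a) b (suc c))) (λ b → ∑₁ N (G (suc a) b (suc c))))
      ∙ ∑₁-+ N (λ c → ∑₁ N λ b → ∑₁ N (F (suc a) b c)) (λ c → ∑₁ N λ b → ∑₁ N (G (suc a) b c)))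
  ∙ ∑₁-+ N (λ a → ∑₁ N λ c → ∑₁ N λ b → ∑₁ N (F a b c)) (λ a → ∑₁ N λ c → ∑₁ N λ b → ∑₁ N (G a b c))

∑⁴-*ˡ : ∀ N k (F : Quad) → ∑⁴ N (λ a b c d → k * F a b c d) ≡ k * ∑⁴ N F
∑⁴-*ˡ N k F =
    (∑₁-cong N λ a → (∑₁-cong N λ c → (∑₁-cong N λ b → ∑₁-*ˡ N k (F (suc a) (suc b) (suc c)))
      ∙ ∑₁-*ˡ N k (λ b → ∑₁ N (F (suc a) b (suc c))))
      ∙ ∑₁-*ˡ N k (λ c → ∑₁ N λ b → ∑₁ N (F (suc a) b c)))
  ∙ ∑₁-*ˡ N k (λ a → ∑₁ N λ c → ∑₁ N λ b → ∑₁ N (F a b c))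

-- The count itself is m/2 for even m; doubling it, here and in the next lemma, keeps the
-- coefficients of the linear closed form in ℤ.
compositions-odd-odd : ∀ m → + 2 * compositions (λ b d → odd (res b) * odd (res d)) (suc m) ≡ even (res (suc m)) * + suc m
compositions-odd-odd m = sym (compositions-*ˡ (+ 2) (λ b d → odd (res b) * odd (res d)) (suc m))
  ∙ compositions-linear (λ b d → + 2 * (odd (res b) * odd (res d))) (λ b d → sym (ℤP.+-identityˡ _))
      (from-yes slope?) (from-yes offset?) (from-yes base?) m
  ∙ ℤP.+-identityʳ _
  where open Linear even (λ _ → + 0) (λ _ _ → + 0) (λ r s → + 2 * (odd r * odd s))

compositions-even-odd : ∀ m → + 2 * compositions (λ b d → even (res b) * odd (res d)) (suc m) ≡ odd (res (suc m)) * (+ suc m - + 1)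
compositions-even-odd m = sym (compositions-*ˡ (+ 2) (λ b d → even (res b) * odd (res d)) (suc m))
  ∙ compositions-linear (λ b d → + 2 * (even (res b) * odd (res d))) (λ b d → sym (ℤP.+-identityˡ _))
      (from-yes slope?) (from-yes offset?) (from-yes base?) m
  ∙ lem (odd (res (suc m))) (+ suc m)
  where open Linear odd (λ r → - odd r) (λ _ _ → + 0) (λ r s → + 2 * (even r * odd s))
        lem : ∀ x y → x * y + - x ≡ x * (y - + 1)
        lem = ℤR.solve-∀

-- The case Q(x,y) = q(x,y), K(x,y) = q(-y,x), q₁(a,c) = q(c-a,a) of liouville for the function
-- q(x,y) = A(x,y) x + A(y,x) y + B(x,y) on ℤ², where A and B have period 6 in both arguments.
module Periodic (A B : ℤ₆ → ℤ₆ → ℤ)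
  (A-neg : ∀ r s → A r (⊟ s) ≡ - A (⊟ r) s)
  (B-sym : ∀ r s → B r s ≡ B s r) (B-neg : ∀ r s → B (⊟ s) r ≡ B (⊟ r) s)
  (HA HC HB DA DB : ℤ₆ → ℤ₆ → ℤ) (KA C D : ℤ₆ → ℤ)
  (HA-def : ∀ r s → A r (s ⊞ ⊟ r) - A (s ⊞ ⊟ r) r - (A (r ⊞ s) (⊟ r) - A (⊟ r) (r ⊞ s)) ≡ HA r s)
  (HC-def : ∀ r s → A (s ⊞ ⊟ r) r - A (r ⊞ s) (⊟ r) ≡ HC r s)
  (HB-def : ∀ r s → B (s ⊞ ⊟ r) r - B (⊟ r) (r ⊞ s) ≡ HB r s)
  (DA-def : ∀ r s → A r s - A r (⊟ s) ≡ DA r s)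
  (DB-def : ∀ r s → B r s - B (⊟ s) r ≡ DB r s)
  (KA-def : ∀ r → A r (⊟ r) - A (⊟ r) r ≡ + 2 * KA r)
  (KB-def : ∀ r → B (⊟ r) r ≡ + 0)
  where

  Q K q : ℕ → ℕ → ℤ
  Q x y = A (res x) (res y) * + x + A (res y) (res x) * + y + B (res x) (res y)
  K x y = A (res x) (⊟ res y) * + x - A (⊟ res y) (res x) * + y + B (⊟ res y) (res x)
  q a c = A (res c ⊞ ⊟ res a) (res a) * (+ c - + a) + A (res a) (res c ⊞ ⊟ res a) * + a + B (res c ⊞ ⊟ res a) (res a)

  private
    Q-sym : ∀ a c → Q a c ≡ Q c a
    Q-sym a c = cong₂ _+_ (ℤP.+-comm (A (res a) (res c) * + a) _) (B-sym (res a) (res c))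

    K-sym : ∀ a c → K a c ≡ K c a
    K-sym a c rewrite A-neg (res a) (res c) | A-neg (res c) (res a) | B-neg (res a) (res c) =
        cong (_+ B (⊟ res a) (res c)) (lem (A (⊟ res a) (res c)) (A (⊟ res c) (res a)) (+ a) (+ c))
      where lem : ∀ x y a c → - x * a - y * c ≡ - y * c - x * a
            lem = ℤR.solve-∀

    ⊞-cancel : ∀ r s → s ⊞ ⊟ (s ⊞ r) ≡ ⊟ r
    ⊞-cancel = from-yes (all? λ r → all? λ s → s ⊞ ⊟ (s ⊞ r) Fin.≟ ⊟ r)
    ⊞-cancel′ : ∀ r s → (r ⊞ s) ⊞ ⊟ r ≡ s
    ⊞-cancel′ = from-yes (all? λ r → all? λ s → (r ⊞ s) ⊞ ⊟ r Fin.≟ s)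
    ⊞-self : ∀ r → r ⊞ ⊟ r ≡ # 0
    ⊞-self = from-yes (all? λ r → r ⊞ ⊟ r Fin.≟ # 0)

    q-> : ∀ a c → q (c ℕ.+ a) c ≡ K (c ℕ.+ a) a
    q-> a c rewrite res-+ c a | ⊞-cancel (res a) (res c) =
        cong (_+ B (⊟ res a) (res c ⊞ res a)) (lem (A (⊟ res a) (res c ⊞ res a)) (A (res c ⊞ res a) (⊟ res a)) (+ a) (+ c))
      where lem : ∀ x y a c → x * (c - (c + a)) + y * (c + a) ≡ y * (c + a) - x * a
            lem = ℤR.solve-∀

    q-< : ∀ a c → q a (a ℕ.+ c) ≡ Q c a
    q-< a c rewrite res-+ a c | ⊞-cancel′ (res a) (res c) =
        cong (_+ B (res c) (res a)) (lem (A (res c) (res a)) (A (res a) (res c)) (+ a) (+ c))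
      where lem : ∀ x y a c → x * (a + c - a) + y * a ≡ x * c + y * a
            lem = ℤR.solve-∀

    q-K : ∀ a c → q a c - K (a ℕ.+ c) a ≡ HA (res a) (res c) * + a + HC (res a) (res c) * + c + HB (res a) (res c)
    q-K a c rewrite res-+ a c | sym (HA-def (res a) (res c)) | sym (HC-def (res a) (res c)) | sym (HB-def (res a) (res c)) =
      lem (A (res c ⊞ ⊟ res a) (res a)) (A (res a) (res c ⊞ ⊟ res a)) (A (res a ⊞ res c) (⊟ res a)) (A (⊟ res a) (res a ⊞ res c))
          (B (res c ⊞ ⊟ res a) (res a)) (B (⊟ res a) (res a ⊞ res c)) (+ a) (+ c)
      where lem : ∀ x y z w b b′ a c → x * (c - a) + y * a + b - (z * (a + c) - w * a + b′) ≡ (y - x - (z - w)) * a + (x - z) * c + (b - b′)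
            lem = ℤR.solve-∀

    Q-K : ∀ a c → Q a c - K a c ≡ DA (res a) (res c) * + a + DA (res c) (res a) * + c + DB (res a) (res c)
    Q-K a c rewrite sym (DA-def (res a) (res c)) | sym (DA-def (res c) (res a)) | sym (DB-def (res a) (res c)) | A-neg (res c) (res a) =
      lem (A (res a) (res c)) (A (res c) (res a)) (A (res a) (⊟ res c)) (A (⊟ res c) (res a)) (B (res a) (res c)) (B (⊟ res c) (res a)) (+ a) (+ c)
      where lem : ∀ x y z w b b′ a c → x * a + y * c + b - (z * a - w * c + b′) ≡ (x - z) * a + (y - - w) * c + (b - b′)
            lem = ℤR.solve-∀

    q-self : ∀ a → q a a ≡ A (res a) (# 0) * + a + B (# 0) (res a)
    q-self a rewrite ⊞-self (res a) = lem (A (# 0) (res a)) (A (res a) (# 0)) (+ a) (B (# 0) (res a))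
      where lem : ∀ x y a b → x * (a - a) + y * a + b ≡ y * a + b
            lem = ℤR.solve-∀

    K-self : ∀ a → K a a ≡ + 2 * KA (res a) * + a
    K-self a rewrite sym (KA-def (res a)) | KB-def (res a) = lem (A (res a) (⊟ res a)) (A (⊟ res a) (res a)) (+ a)
      where lem : ∀ x y a → x * a - y * a + + 0 ≡ (x - y) * a
            lem = ℤR.solve-∀

  -- The left-hand sums of `liouville` after the differences of test functions have been reduced to
  -- tables: α, γ and β are the coefficients of a, c and 1.
  Form : (N n : ℕ) → (ℤ₆ → ℤ₆ → ℤ) → (ℤ₆ → ℤ₆ → ℤ) → (ℤ₆ → ℤ₆ → ℤ) → (ℤ₆ → ℤ₆ → ℤ) → ℤ
  Form N n u α γ β = ∑⁴ N λ a b c d → δ (a ℕ.* b ℕ.+ c ℕ.* d) n *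
    (u (res b) (res d) * (α (res a) (res c) * + a + γ (res a) (res c) * + c + β (res a) (res c)))

  -- The three diagonals of `liouville`, as a summand over n = a m with the compositions of m
  -- evaluated. The first term uses the factor 2 of the diagonal for the doubled count, the last
  -- uses the 2 in `K-self`.
  boundary : ℕ → ℕ → ℤ
  boundary a m = (A (res a) (# 0) * + a + B (# 0) (res a)) * (odd (res m) * (+ m - + 1))
    - odd (res a) * (C (res m) * + m + D (res m)) + KA (res a) * + a * (even (res m) * + m)

  -- Reversing a composition turns A(y, x) y into A(x, y) x, so under such a sum Q may be replaced
  -- by 2 A(x, y) x + B(x, y).
  open Linear C D (λ r s → + 2 * A r s) B public using (Slope; Offset; Base; slope?; offset?; base?; compositions-linear)

  identity : Slope → Offset → Base → ∀ N n → n ℕ.≤ N →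
    + 2 * Form N n (λ r s → even r * odd s) HA HC HB - Form N n (λ r s → odd r * odd s) DA (λ r s → DA s r) DB
    ≡ ∑∣ N n boundary
  identity sl of ba N n n≤N =
      cong₂ (λ x y → + 2 * x - y) (sym (difference (λ b d → even (res b) * odd (res d)) q (λ a c → K (a ℕ.+ c) a) _ q-K))
                                  (sym (difference (λ b d → odd (res b) * odd (res d)) Q K _ Q-K))
    ∙ Liouville.liouville N n n≤N Q K q Q-sym K-sym q-> q-<
    ∙ cong₂ _+_ (cong₂ (λ x y → + 2 * x - y) (regroup N n (λ b d → even (res b) * odd (res d)) (λ a → q a a) n≤N)
                                              (D₂≡ ∙ regroup N n Q (λ b → odd (res b)) n≤N))
                (regroup N n (λ b d → odd (res b) * odd (res d)) (λ a → K a a) n≤N)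
    ∙ collect
    where
      S : (u v : ℕ → ℕ → ℤ) → ℤ
      S u v = ∑⁴ N λ a b c d → δ (a ℕ.* b ℕ.+ c ℕ.* d) n * (u b d * v a c)

      difference : ∀ u v w h → (∀ a c → v a c - w a c ≡ h a c) → S u v - S u w ≡ S u h
      difference u v w h eq =
          cong (_+_ (S u v)) (lem₀ (S u w) ∙ sym (∑⁴-*ˡ N (- + 1) (λ a b c d → δ (a ℕ.* b ℕ.+ c ℕ.* d) n * (u b d * w a c))))
        ∙ sym (∑⁴-+ N (λ a b c d → δ (a ℕ.* b ℕ.+ c ℕ.* d) n * (u b d * v a c)) (λ a b c d → - + 1 * (δ (a ℕ.* b ℕ.+ c ℕ.* d) n * (u b d * w a c))))
        ∙ ∑⁴-cong N (λ a b c d → lem (δ (suc a ℕ.* suc b ℕ.+ suc c ℕ.* suc d) n) (u (suc b) (suc d)) (v (suc a) (suc c)) (w (suc a) (suc c))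
            ∙ cong (λ t → δ (suc a ℕ.* suc b ℕ.+ suc c ℕ.* suc d) n * (u (suc b) (suc d) * t)) (eq (suc a) (suc c)))
        where lem₀ : ∀ x → - x ≡ - + 1 * x
              lem₀ = ℤR.solve-∀
              lem : ∀ x u v w → x * (u * v) + - + 1 * (x * (u * w)) ≡ x * (u * (v - w))
              lem = ℤR.solve-∀

      D₂≡ : ∑³ N (λ b a c → δ (a ℕ.* b ℕ.+ c ℕ.* b) n * (odd (res b) * Q a c)) ≡
            ∑³ N (λ b a c → δ (b ℕ.* a ℕ.+ b ℕ.* c) n * (Q a c * odd (res b)))
      D₂≡ = ∑³-cong N λ b a c → cong₂ (λ x y → δ x n * y)
        (cong₂ ℕ._+_ (ℕP.*-comm (suc a) (suc b)) (ℕP.*-comm (suc c) (suc b))) (ℤP.*-comm (odd (res (suc b))) (Q (suc a) (suc c)))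

      eo oo : ℕ → ℕ → ℤ
      eo b d = even (res b) * odd (res d)
      oo b d = odd (res b) * odd (res d)

      compositions-Q : ∀ m → compositions Q (suc m) ≡ C (res (suc m)) * + suc m + D (res (suc m))
      compositions-Q m =
          compositions-+ (λ a c → A (res a) (res c) * + a + A (res c) (res a) * + c) (λ a c → B (res a) (res c)) (suc m)
        ∙ cong (_+ compositions (λ a c → B (res a) (res c)) (suc m))
            (compositions-+ (λ a c → A (res a) (res c) * + a) (λ a c → A (res c) (res a) * + c) (suc m)
              ∙ cong (_+_ (compositions (λ a c → A (res a) (res c) * + a) (suc m))) (compositions-flip (λ a c → A (res a) (res c) * + a) (suc m))
              ∙ sym (compositions-+ (λ a c → A (res a) (res c) * + a) (λ a c → A (res a) (res c) * + a) (suc m)))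
        ∙ sym (compositions-+ (λ a c → A (res a) (res c) * + a + A (res a) (res c) * + a) (λ a c → B (res a) (res c)) (suc m))
        ∙ compositions-linear _ (λ a c → cong (_+ B (res a) (res c)) (lem (A (res a) (res c)) (+ a))) sl of ba m
        where lem : ∀ x a → x * a + x * a ≡ + 2 * x * a
              lem = ℤR.solve-∀

      collect : + 2 * ∑∣ N n (λ a m → q a a * compositions eo m) - ∑∣ N n (λ b m → odd (res b) * compositions Q m)
                  + ∑∣ N n (λ a m → K a a * compositions oo m) ≡ _
      collect =
          cong₂ (λ x y → x + y + ∑∣ N n (λ a m → K a a * compositions oo m))
            (sym (∑∣-*ˡ N n (+ 2) (λ a m → q a a * compositions eo m)))
            (lem₀ _ ∙ sym (∑∣-*ˡ N n (- + 1) (λ b m → odd (res b) * compositions Q m)))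
        ∙ cong (_+ ∑∣ N n (λ a m → K a a * compositions oo m)) (sym (∑∣-+ N n (λ a m → + 2 * (q a a * compositions eo m)) (λ b m → - + 1 * (odd (res b) * compositions Q m))))
        ∙ sym (∑∣-+ N n (λ a m → + 2 * (q a a * compositions eo m) + - + 1 * (odd (res a) * compositions Q m)) (λ a m → K a a * compositions oo m))
        ∙ ∑∣-cong N n (λ a m _ → cong₂ _+_ (cong₂ _+_
              (lem₁ (q (suc a) (suc a)) (compositions eo (suc m)) ∙ cong₂ _*_ (q-self (suc a)) (compositions-even-odd m))
              (sym (lem₀ _) ∙ cong (λ t → - (odd (res (suc a)) * t)) (compositions-Q m)))
              (cong (_* compositions oo (suc m)) (K-self (suc a)) ∙ lem₂ (KA (res (suc a))) (+ suc a) (compositions oo (suc m))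
                ∙ cong (λ t → KA (res (suc a)) * + suc a * t) (compositions-odd-odd m)))
        where lem₀ : ∀ x → - x ≡ - + 1 * x
              lem₀ = ℤR.solve-∀
              lem₁ : ∀ x y → + 2 * (x * y) ≡ x * (+ 2 * y)
              lem₁ = ℤR.solve-∀
              lem₂ : ∀ k a y → + 2 * k * a * y ≡ k * a * (+ 2 * y)
              lem₂ = ℤR.solve-∀

by-cases : ∀ {f g : ℤ₆ → ℤ} {_ : True (all? λ r → f r ℤ.≟ g r)} → ∀ r → f r ≡ g r
by-cases {_} {_} {p} = toWitness p

by-cases₂ : ∀ {f g : ℤ₆ → ℤ₆ → ℤ} {_ : True (all? λ r → all? λ s → f r s ℤ.≟ g r s)} → ∀ r s → f r s ≡ g r s
by-cases₂ {_} {_} {p} = toWitness p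

by-cases₄ : ∀ {f g : ℤ₆ → ℤ₆ → ℤ₆ → ℤ₆ → ℤ} {_ : True (all? λ r → all? λ s → all? λ t → all? λ u → f r s t u ℤ.≟ g r s t u)} →
  ∀ r s t u → f r s t u ≡ g r s t u
by-cases₄ {_} {_} {p} = toWitness p

-- Multiplying by the parity of rs + tu builds the oddness of n into the table, so the check may run
-- over all quadruples of residues, including those that cannot occur.
odd-form : ∀ {n} → odd (res n) ≡ + 1 → (f g : ℤ₆ → ℤ₆ → ℤ₆ → ℤ₆ → ℤ) →
  (∀ r s t u → odd ((r ⊠ s) ⊞ (t ⊠ u)) * f r s t u ≡ odd ((r ⊠ s) ⊞ (t ⊠ u)) * g r s t u) →
  ∀ a b c d → a ℕ.* b ℕ.+ c ℕ.* d ≡ n → f (res a) (res b) (res c) (res d) ≡ g (res a) (res b) (res c) (res d)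
odd-form o f g h a b c d refl = sym (ℤP.*-identityˡ _) ∙ cong (_* f (res a) (res b) (res c) (res d)) (sym o′)
    ∙ h (res a) (res b) (res c) (res d) ∙ cong (_* g (res a) (res b) (res c) (res d)) o′ ∙ ℤP.*-identityˡ _
  where o′ : odd ((res a ⊠ res b) ⊞ (res c ⊠ res d)) ≡ + 1
        o′ = cong odd (sym (res-+ (a ℕ.* b) (c ℕ.* d) ∙ cong₂ _⊞_ (res-* a b) (res-* c d))) ∙ o

odd-product : ∀ {n} → odd (res n) ≡ + 1 → ∀ a b → a ℕ.* b ≡ n → odd (res a) ≡ + 1 × odd (res b) ≡ + 1
odd-product o a b refl = odd-factors (res a) (res b) (cong odd (sym (res-* a b)) ∙ o)
  where odd-factors : ∀ r s → odd (r ⊠ s) ≡ + 1 → odd r ≡ + 1 × odd s ≡ + 1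
        odd-factors = from-yes (all? λ r → all? λ s → (odd (r ⊠ s) ℤ.≟ + 1) →-dec ((odd r ℤ.≟ + 1) ×-dec (odd s ℤ.≟ + 1)))

-- Test functions for the three convolution sums

module Convolution where
  -- Divisibility by 3 is tested on the odd argument of a pair of opposite parity. For even r and
  -- odd s the difference of test values is 3 ([3 divides s - r] - [3 divides s + r]) = 3 χ(r) χ(s),
  -- the product of characters to be convolved.
  B : ℤ₆ → ℤ₆ → ℤ
  B r s = + 3 * (even r * odd s * 3∣ s + odd r * even s * 3∣ r)

  open Periodic (λ _ _ → + 0) B by-cases₂ by-cases₂ by-cases₂
    (λ _ _ → + 0) (λ _ _ → + 0) (λ r s → + 3 * (odd s * even r * χ r * χ s)) (λ _ _ → + 0) (λ _ _ → + 0)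
    (λ _ → + 0) odd (λ r → - odd r * (χ r + + 3 * 3∣ r))
    by-cases₂ by-cases₂ by-cases₂ by-cases₂ by-cases₂ by-cases by-cases public

  checks : Slope × Offset × Base
  checks = from-yes slope? , from-yes offset? , from-yes base?

module Derivation where
  -- Even-type dependence on s gives Q = K, so the (odd, odd) form vanishes, and only the
  -- coefficient of a survives in the other. If n is odd and b even, then c is odd, and this
  -- coefficient becomes ε(a) (1 + [3 divides a]) χ(c), up to sign the weight of `w-even` times χ.
  A : ℤ₆ → ℤ₆ → ℤ
  A r s = ε r * χ r * 3∣ s

  open Periodic A (λ _ _ → + 0) by-cases₂ by-cases₂ by-cases₂
    (λ r s → ε r * χ s * (+ 1 - 3∣ r - + 2 * ε s * 3∣ r)) (λ _ _ → + 0) (λ _ _ → + 0) (λ _ _ → + 0) (λ _ _ → + 0)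
    (λ _ → + 0) (λ r → - ε r * χ r) (λ r → χ r * (+ 2 * even r - odd r))
    by-cases₂ by-cases₂ by-cases₂ by-cases₂ by-cases₂ by-cases by-cases public

  checks : Slope × Offset × Base
  checks = from-yes slope? , from-yes offset? , from-yes base?

module Derivation′ where
  -- The last summand is odd in s and produces DA. The bracket after χ(r) is even in s, so it leaves
  -- DA alone; it is there to make HA vanish. Here both forms survive, one for even d and one for
  -- odd d.
  A : ℤ₆ → ℤ₆ → ℤ
  A r s = χ r * (- ε s + + 2 * ε r * 3∣ s + ε s * 3∣ s) + (+ 1 + 3∣ r) * ε s * χ s

  open Periodic A (λ _ _ → + 0) by-cases₂ by-cases₂ by-cases₂
    (λ _ _ → + 0) (λ r s → + 2 * ((+ 1 + 3∣ s) * ε r * χ r)) (λ _ _ → + 0) (λ r s → + 2 * ((+ 1 + 3∣ r) * ε s * χ s)) (λ _ _ → + 0)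
    (λ r → - + 2 * ε r * χ r) (λ r → - + 2 * (+ 1 + 3∣ r + ε r * χ r)) (λ _ → + 0)
    by-cases₂ by-cases₂ by-cases₂ by-cases₂ by-cases₂ by-cases by-cases public

  checks : Slope × Offset × Base
  checks = from-yes slope? , from-yes offset? , from-yes base?

-- The three convolution sums as divisor sums

∑₁-extend : ∀ N k (f : ℕ → ℤ) → (∀ i → N ℕ.< i → f i ≡ + 0) → ∑₁ (k ℕ.+ N) f ≡ ∑₁ N f
∑₁-extend N zero f v = refl
∑₁-extend N (suc k) f v = cong₂ _+_ (∑₁-extend N k f v) (v _ (ℕ.s≤s (ℕP.m≤n+m N k))) ∙ ℤP.+-identityʳ _

drop-zero : ∀ {x y z : ℤ} → x ≡ y → z ≡ + 0 → x + z ≡ y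
drop-zero refl refl = ℤP.+-identityʳ _

-- Extending the left side to 1..2N adds only zeros, and then blocks of two consecutive indices
-- match the terms on the right. `∑₁-3∣` does the same with blocks of three.
∑₁-even : ∀ N (f : ℕ → ℤ) → (∀ i → N ℕ.< i → f i ≡ + 0) → ∑₁ N (λ a → even (res a) * f a) ≡ ∑₁ N (λ a → f (a ℕ.* 2))
∑₁-even N f v = sym (∑₁-extend N N (λ a → even (res a) * f a) (λ i p → cong (even (res i) *_) (v i p) ∙ ℤP.*-zeroʳ (even (res i))))
  ∙ cong (λ t → ∑₁ t (λ a → even (res a) * f a)) (lem N) ∙ chunks N
  where
    lem : ∀ N → N ℕ.+ N ≡ N ℕ.* 2
    lem = ℕR.solve-∀
    evenness : ∀ r → even (r ⊠ # 2) ≡ + 1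
    evenness = by-cases
    oddness : ∀ r → even (next (r ⊠ # 2)) ≡ + 0
    oddness = by-cases
    chunks : ∀ M → ∑₁ (M ℕ.* 2) (λ a → even (res a) * f a) ≡ ∑₁ M (λ a → f (a ℕ.* 2))
    chunks zero = refl
    chunks (suc M) = cong₂ _+_
      (drop-zero (chunks M) (cong (_* f (suc (M ℕ.* 2))) (cong (λ t → even (next t)) (res-* M 2) ∙ oddness (res M))))
      (cong (_* f (suc M ℕ.* 2)) (cong even (res-* (suc M) 2) ∙ evenness (res (suc M))) ∙ ℤP.*-identityˡ _)

∑₁-3∣ : ∀ N (f : ℕ → ℤ) → (∀ i → N ℕ.< i → f i ≡ + 0) → ∑₁ N (λ a → 3∣ (res a) * f a) ≡ ∑₁ N (λ a → f (a ℕ.* 3))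
∑₁-3∣ N f v = sym (∑₁-extend N (N ℕ.+ N) (λ a → 3∣ (res a) * f a) (λ i p → cong (3∣ (res i) *_) (v i p) ∙ ℤP.*-zeroʳ (3∣ (res i))))
  ∙ cong (λ t → ∑₁ t (λ a → 3∣ (res a) * f a)) (lem N) ∙ chunks N
  where
    lem : ∀ N → N ℕ.+ N ℕ.+ N ≡ N ℕ.* 3
    lem = ℕR.solve-∀
    res0 : ∀ r → 3∣ (r ⊠ # 3) ≡ + 1
    res0 = by-cases
    res1 : ∀ r → 3∣ (next (r ⊠ # 3)) ≡ + 0
    res1 = by-cases
    res2 : ∀ r → 3∣ (next (next (r ⊠ # 3))) ≡ + 0
    res2 = by-cases
    chunks : ∀ M → ∑₁ (M ℕ.* 3) (λ a → 3∣ (res a) * f a) ≡ ∑₁ M (λ a → f (a ℕ.* 3))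
    chunks zero = refl
    chunks (suc M) = cong₂ _+_
      (drop-zero
        (drop-zero (chunks M) (cong (_* f (suc (M ℕ.* 3))) (cong (λ t → 3∣ (next t)) (res-* M 3) ∙ res1 (res M))))
        (cong (_* f (suc (suc (M ℕ.* 3)))) (cong (λ t → 3∣ (next (next t))) (res-* M 3) ∙ res2 (res M))))
      (cong (_* f (suc M ℕ.* 3)) (cong 3∣ (res-* (suc M) 3) ∙ res0 (res (suc M))) ∙ ℤP.*-identityˡ _)

∑∣-3∣ : ∀ N n (F : ℕ → ℕ → ℤ) → n ℕ.≤ N → ∑∣ N n (λ a b → 3∣ (res a) * F a b) ≡ (∑₁ N λ a → ∑₁ N λ b → δ (a ℕ.* 3 ℕ.* b) n * F (a ℕ.* 3) b)
∑∣-3∣ N n F n≤N = (∑₁-cong N λ a → (∑₁-cong N λ b → lem (δ (suc a ℕ.* suc b) n) (3∣ (res (suc a))) (F (suc a) (suc b)))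
    ∙ ∑₁-*ˡ N (3∣ (res (suc a))) (λ b → δ (suc a ℕ.* b) n * F (suc a) b))
  ∙ ∑₁-3∣ N (λ a → ∑₁ N λ b → δ (a ℕ.* b) n * F a b) (λ i p → ∑₁-zero N λ b → cong (_* F i (suc b)) (δ-> (ℕP.≤-<-trans n≤N (ℕP.<-≤-trans p (ℕP.m≤m*n i (suc b))))))
  where lem : ∀ x y z → x * (y * z) ≡ y * (x * z)
        lem = ℤR.solve-∀

conv : ℕ → ℕ → (ℕ → ℕ → ℤ) → (ℕ → ℕ → ℤ) → ℤ
conv N n u v = ∑⁴ N λ a b c d → δ (a ℕ.* b ℕ.+ c ℕ.* d) n * (u a b * v c d)

-- Coefficients of double series in q^(ab): `χ-odd` belongs to G and `χ-sign` to Φ, `w-even` and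
-- `w-odd` to their logarithmic derivatives up to constants, and `tripled` sums the divisors prime
-- to 3.
χ-odd χ-even χ-sign w-even w-odd tripled : ℕ → ℕ → ℤ
χ-odd a b = odd (res a) * odd (res b) * χ (res a)
χ-even a b = even (res a) * even (res b) * χ (res a)
χ-sign a b = ε (res a) * ε (res b) * χ (res a)
w-even a b = even (res b) * (- ε (res a) * ((+ 1 + 3∣ (res a)) * + a))
w-odd a b = odd (res b) * ((+ 1 + 3∣ (res a)) * + a)
tripled a b = (+ 1 - 3∣ (res b)) * + b

-- Exchanging the two factors permutes the factorisations, so H(a, b) - H(b, a) sums to zero.
-- Summands therefore have to be matched only up to such a term.
∑∣-cong-sym : ∀ N n {F G : ℕ → ℕ → ℤ} (H : ℕ → ℕ → ℤ) →
  (∀ a b → suc a ℕ.* suc b ≡ n → F (suc a) (suc b) ≡ G (suc a) (suc b) + (H (suc a) (suc b) + - + 1 * H (suc b) (suc a))) → ∑∣ N n F ≡ ∑∣ N n G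
∑∣-cong-sym N n {F} {G} H h = ∑∣-cong N n h ∙ ∑∣-+ N n G (λ a b → H a b + - + 1 * H b a)
  ∙ drop-zero refl (∑∣-+ N n H (λ a b → - + 1 * H b a)
      ∙ cong (_+_ (∑∣ N n H)) (∑∣-*ˡ N n (- + 1) (λ a b → H b a) ∙ cong (- + 1 *_) (sym (∑∣-transpose N n H))) ∙ lem (∑∣ N n H))
  where lem : ∀ x → x + - + 1 * x ≡ + 0
        lem = ℤR.solve-∀

∑⁴-zero : ∀ N {F : Quad} → (∀ a b c d → F (suc a) (suc b) (suc c) (suc d) ≡ + 0) → ∑⁴ N F ≡ + 0
∑⁴-zero N h = ∑₁-zero N λ a → ∑₁-zero N λ c → ∑₁-zero N λ b → ∑₁-zero N λ d → h a b c d

-- The factor 3 moves across: n = (3a) b = a (3b).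
∑∣-3∣-balance : ∀ N n → n ℕ.≤ N → + 3 * ∑∣ N n (λ a b → 3∣ (res a) * + b) ≡ ∑∣ N n (λ a b → 3∣ (res b) * + b)
∑∣-3∣-balance N n n≤N =
    cong (+ 3 *_) (∑∣-3∣ N n (λ a b → + b) n≤N)
  ∙ sym (∑₁-*ˡ N (+ 3) (λ a → ∑₁ N λ b → δ (a ℕ.* 3 ℕ.* b) n * + b))
  ∙ (∑₁-cong N λ a → sym (∑₁-*ˡ N (+ 3) (λ b → δ (suc a ℕ.* 3 ℕ.* b) n * + b))
      ∙ ∑₁-cong N λ b → lem (δ (suc a ℕ.* 3 ℕ.* suc b) n) (+ suc b) ∙ cong₂ (λ x y → δ x n * y) (lem′ (suc a) (suc b)) (sym (ℤP.pos-* (suc b) 3)))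
  ∙ ∑₁-swap N N (λ a b → δ (b ℕ.* 3 ℕ.* a) n * + (b ℕ.* 3))
  ∙ sym (∑∣-3∣ N n (λ a b → + a) n≤N)
  ∙ ∑∣-transpose N n (λ a b → 3∣ (res a) * + a)
  where lem : ∀ x y → + 3 * (x * y) ≡ x * (y * + 3)
        lem = ℤR.solve-∀
        lem′ : ∀ a b → a ℕ.* 3 ℕ.* b ≡ b ℕ.* 3 ℕ.* a
        lem′ = ℕR.solve-∀

odd-values : ∀ r → odd r ≡ + 1 → ε r ≡ - + 1 × even r ≡ + 0
odd-values = from-yes (all? λ r → (odd r ℤ.≟ + 1) →-dec ((ε r ℤ.≟ - + 1) ×-dec (even r ℤ.≟ + 0)))

-- For odd n both factors of n are odd and the boundary simplifies. An antisymmetric term exchanges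
-- χ(m) for χ(a); then `∑∣-3∣-balance` merges the term over multiples of 3 with -m, leaving only the
-- m prime to 3.
convolution : ∀ N n → n ℕ.≤ N → odd (res n) ≡ + 1 →
  + 6 * conv N n χ-even χ-odd ≡ ∑∣ N n χ-odd - ∑∣ N n tripled
convolution N n n≤N o =
    sym (cong₂ (λ x y → + 2 * x - y) eo≡ oo≡ ∙ lem₀ (conv N n χ-even χ-odd))
  ∙ identity (proj₁ checks) (proj₁ (proj₂ checks)) (proj₂ (proj₂ checks)) N n n≤N
  ∙ ∑∣-cong-sym N n {G = λ a m → χ-odd a m + (+ 3 * (3∣ (res a) * + m) + - + 1 * + m)} (λ a m → - χ (res a) - + 3 * 3∣ (res a)) (λ a m → point (suc a) (suc m))
  ∙ ∑∣-+ N n χ-odd (λ a m → + 3 * (3∣ (res a) * + m) + - + 1 * + m)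
  ∙ cong (_+_ (∑∣ N n χ-odd)) (∑∣-+ N n (λ a m → + 3 * (3∣ (res a) * + m)) (λ a m → - + 1 * + m)
      ∙ cong (_+ ∑∣ N n (λ a m → - + 1 * + m)) (∑∣-*ˡ N n (+ 3) (λ a m → 3∣ (res a) * + m) ∙ ∑∣-3∣-balance N n n≤N)
      ∙ sym (∑∣-+ N n (λ a m → 3∣ (res m) * + m) (λ a m → - + 1 * + m))
      ∙ ∑∣-cong N n (λ a m _ → lem₁ (3∣ (res (suc m))) (+ suc m))
      ∙ ∑∣-*ˡ N n (- + 1) tripled
      ∙ lem₂ (∑∣ N n tripled))
  where
    open Convolution
    lem₀ : ∀ x → + 2 * (+ 3 * x) - + 0 ≡ + 6 * x
    lem₀ = ℤR.solve-∀
    lem₁ : ∀ x y → x * y + - + 1 * y ≡ - + 1 * ((+ 1 - x) * y)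
    lem₁ = ℤR.solve-∀
    lem₂ : ∀ x → - + 1 * x ≡ - x
    lem₂ = ℤR.solve-∀
    eo≡ : Form N n (λ r s → even r * odd s) (λ _ _ → + 0) (λ _ _ → + 0) (λ r s → + 3 * (odd s * even r * χ r * χ s)) ≡ + 3 * conv N n χ-even χ-odd
    eo≡ = ∑⁴-cong N (λ a b c d → lem (δ (suc a ℕ.* suc b ℕ.+ suc c ℕ.* suc d) n) (even (res (suc a))) (even (res (suc b))) (odd (res (suc c))) (odd (res (suc d)))
                                      (χ (res (suc a))) (χ (res (suc c))))
      ∙ ∑⁴-*ˡ N (+ 3) (λ a b c d → δ (a ℕ.* b ℕ.+ c ℕ.* d) n * (χ-even a b * χ-odd c d))
      where lem : ∀ x ea eb oc od u v → x * (eb * od * (+ 0 + + 0 + + 3 * (oc * ea * u * v))) ≡ + 3 * (x * (ea * eb * u * (oc * od * v)))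
            lem = ℤR.solve-∀
    oo≡ : Form N n (λ r s → odd r * odd s) (λ _ _ → + 0) (λ _ _ → + 0) (λ _ _ → + 0) ≡ + 0
    oo≡ = ∑⁴-zero N λ a b c d → lem (δ (suc a ℕ.* suc b ℕ.+ suc c ℕ.* suc d) n) (odd (res (suc b)) * odd (res (suc d)))
      where lem : ∀ x y → x * (y * + 0) ≡ + 0
            lem = ℤR.solve-∀
    B0 : ∀ r → B (# 0) r ≡ + 3 * (odd r * 3∣ r)
    B0 = by-cases
    point : ∀ a m → a ℕ.* m ≡ n →
      boundary a m ≡ χ-odd a m + (+ 3 * (3∣ (res a) * + m) + - + 1 * + m) + ((- χ (res a) - + 3 * 3∣ (res a)) + - + 1 * (- χ (res m) - + 3 * 3∣ (res m)))
    point a m q =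
        cong (λ t → (+ 0 + t) * (odd (res m) * (+ m - + 1)) - odd (res a) * (odd (res m) * + m + - odd (res m) * (χ (res m) + + 3 * 3∣ (res m))) + + 0) (B0 (res a))
      ∙ cong₂ (λ x y → (+ 0 + + 3 * (x * 3∣ (res a))) * (y * (+ m - + 1)) - x * (y * + m + - y * (χ (res m) + + 3 * 3∣ (res m))) + + 0) oa om
      ∙ lem (3∣ (res a)) (3∣ (res m)) (χ (res a)) (χ (res m)) (+ m)
      ∙ cong₂ (λ x y → x * y * χ (res a) + (+ 3 * (3∣ (res a) * + m) + - + 1 * + m) + ((- χ (res a) - + 3 * 3∣ (res a)) + - + 1 * (- χ (res m) - + 3 * 3∣ (res m)))) (sym oa) (sym om)
      where oa = proj₁ (odd-product o a m q)
            om = proj₂ (odd-product o a m q)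
            lem : ∀ fa fm xa xm m → (+ 0 + + 3 * (+ 1 * fa)) * (+ 1 * (m - + 1)) - + 1 * (+ 1 * m + - + 1 * (xm + + 3 * fm)) + + 0
                    ≡ + 1 * + 1 * xa + (+ 3 * (fa * m) + - + 1 * m) + ((- xa - + 3 * fa) + - + 1 * (- xm - + 3 * fm))
            lem = ℤR.solve-∀

-- Coefficientwise the logarithmic derivative of G/q; dividing by the leading q is what lowers n to
-- n - 1.
derivation : ∀ N n → n ℕ.≤ N → odd (res n) ≡ + 1 →
  (+ n - + 1) * ∑∣ N n χ-odd ≡ + 2 * conv N n w-even χ-odd
derivation N n n≤N o =
    sym (∑∣-*ˡ N n (+ n - + 1) χ-odd)
  ∙ sym (∑∣-cong-sym N n {G = λ a m → (+ n - + 1) * χ-odd a m} (λ a m → χ (res m) * + m - χ (res m)) (λ a m → point (suc a) (suc m)))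
  ∙ ∑∣-*ˡ N n (- + 1) boundary
  ∙ cong (- + 1 *_) (sym (identity (proj₁ checks) (proj₁ (proj₂ checks)) (proj₂ (proj₂ checks)) N n n≤N))
  ∙ cong₂ (λ x y → - + 1 * (+ 2 * x - y)) eo≡ oo≡
  ∙ lem₀ (conv N n w-even χ-odd)
  where
    open Derivation
    lem₀ : ∀ x → - + 1 * (+ 2 * (- + 1 * x) - + 0) ≡ + 2 * x
    lem₀ = ℤR.solve-∀
    eo≡ : Form N n (λ r s → even r * odd s) (λ r s → ε r * χ s * (+ 1 - 3∣ r - + 2 * ε s * 3∣ r)) (λ _ _ → + 0) (λ _ _ → + 0) ≡ - + 1 * conv N n w-even χ-odd
    eo≡ = ∑⁴-cong N (λ a b c d → cong (δ (suc a ℕ.* suc b ℕ.+ suc c ℕ.* suc d) n *_) (lem₁ (even (res (suc b)) * odd (res (suc d))) (ε (res (suc a)) * χ (res (suc c)) * (+ 1 - 3∣ (res (suc a)) - + 2 * ε (res (suc c)) * 3∣ (res (suc a)))) (+ suc a))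
          ∙ δ-guard (suc a ℕ.* suc b ℕ.+ suc c ℕ.* suc d) n (λ q → cong (_* + suc a)
              (odd-form o (λ r s t u → even s * odd u * (ε r * χ t * (+ 1 - 3∣ r - + 2 * ε t * 3∣ r)))
                          (λ r s t u → - + 1 * (even s * (- ε r * (+ 1 + 3∣ r)) * (odd t * odd u * χ t))) by-cases₄ (suc a) (suc b) (suc c) (suc d) q))
          ∙ lem₂ (δ (suc a ℕ.* suc b ℕ.+ suc c ℕ.* suc d) n) (even (res (suc b))) (- ε (res (suc a))) (+ 1 + 3∣ (res (suc a))) (χ-odd (suc c) (suc d)) (+ suc a))
      ∙ ∑⁴-*ˡ N (- + 1) (λ a b c d → δ (a ℕ.* b ℕ.+ c ℕ.* d) n * (w-even a b * χ-odd c d))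
      where lem₁ : ∀ x h a → x * (h * a + + 0 + + 0) ≡ x * h * a
            lem₁ = ℤR.solve-∀
            lem₂ : ∀ x e p q y a → x * (- + 1 * (e * (p * q) * y) * a) ≡ - + 1 * (x * (e * (p * (q * a)) * y))
            lem₂ = ℤR.solve-∀
    oo≡ : Form N n (λ r s → odd r * odd s) (λ _ _ → + 0) (λ _ _ → + 0) (λ _ _ → + 0) ≡ + 0
    oo≡ = ∑⁴-zero N λ a b c d → lem (δ (suc a ℕ.* suc b ℕ.+ suc c ℕ.* suc d) n) (odd (res (suc b)) * odd (res (suc d)))
      where lem : ∀ x y → x * (y * + 0) ≡ + 0
            lem = ℤR.solve-∀
    A0 : ∀ r → A r (# 0) ≡ ε r * χ r
    A0 = by-cases
    point : ∀ a m → a ℕ.* m ≡ n →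
      - + 1 * boundary a m ≡ (+ n - + 1) * χ-odd a m + ((χ (res m) * + m - χ (res m)) + - + 1 * (χ (res a) * + a - χ (res a)))
    point a m q =
        cong (λ t → - + 1 * ((t * + a + + 0) * (odd (res m) * (+ m - + 1)) - odd (res a) * (- ε (res m) * χ (res m) * + m + χ (res m) * (+ 2 * even (res m) - odd (res m))) + + 0)) (A0 (res a))
      ∙ cong₂ (λ x y → - + 1 * ((ε (res a) * χ (res a) * + a + + 0) * (y * (+ m - + 1)) - x * (- ε (res m) * χ (res m) * + m + χ (res m) * (+ 2 * even (res m) - y)) + + 0)) oa om
      ∙ cong₂ (λ x y → - + 1 * ((x * χ (res a) * + a + + 0) * (+ 1 * (+ m - + 1)) - + 1 * (- y * χ (res m) * + m + χ (res m) * (+ 2 * even (res m) - + 1)) + + 0)) (proj₁ (odd-values (res a) oa)) (proj₁ (odd-values (res m) om))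
      ∙ cong (λ x → - + 1 * ((- + 1 * χ (res a) * + a + + 0) * (+ 1 * (+ m - + 1)) - + 1 * (- - + 1 * χ (res m) * + m + χ (res m) * (+ 2 * x - + 1)) + + 0)) (proj₂ (odd-values (res m) om))
      ∙ lem (χ (res a)) (χ (res m)) (+ a) (+ m)
      ∙ cong₂ (λ x y → (x - + 1) * (y * χ (res a)) + ((χ (res m) * + m - χ (res m)) + - + 1 * (χ (res a) * + a - χ (res a))))
          (sym (ℤP.pos-* a m) ∙ cong +_ q) (sym (cong₂ _*_ oa om))
      where oa = proj₁ (odd-product o a m q)
            om = proj₂ (odd-product o a m q)
            lem : ∀ x y a m → - + 1 * ((- + 1 * x * a + + 0) * (+ 1 * (m - + 1)) - + 1 * (- - + 1 * y * m + y * (+ 2 * + 0 - + 1)) + + 0)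
                    ≡ (a * m - + 1) * (+ 1 * x) + ((y * m - y) + - + 1 * (x * a - x))
            lem = ℤR.solve-∀

-- Coefficientwise the equation q Φ′ = -2 W Φ, where W is the series of `w-odd`; the term without
-- convolution comes from the constant term 1 of Φ.
derivation′ : ∀ N n → n ℕ.≤ N →
  + 4 * conv N n w-odd χ-sign ≡ + 2 * ∑∣ N n w-odd - + 2 * + n * ∑∣ N n χ-sign
derivation′ N n n≤N =
    -- The two forms supply the parts with even d and with odd d, and ε(d) = even(d) - odd(d) joins
    -- them to `χ-sign`.
    lem₀ (conv N n w-odd χ-sign) E O E-O
  ∙ cong₂ (λ x y → + 2 * x - y) (sym eo≡) (sym oo≡)
  ∙ identity (proj₁ checks) (proj₁ (proj₂ checks)) (proj₂ (proj₂ checks)) N n n≤N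
  ∙ ∑∣-cong-sym N n {G = λ a m → + 2 * w-odd a m + - + 2 * + n * χ-sign a m}
      (λ a m → - + 2 * odd (res m) * (+ 1 + 3∣ (res a) + ε (res a) * χ (res a)) * + a) (λ a m → point (suc a) (suc m))
  ∙ ∑∣-+ N n (λ a m → + 2 * w-odd a m) (λ a m → - + 2 * + n * χ-sign a m)
  ∙ cong₂ _+_ (∑∣-*ˡ N n (+ 2) w-odd) (∑∣-*ˡ N n (- + 2 * + n) χ-sign ∙ lem₁ (+ n) (∑∣ N n χ-sign))
  where
    open Derivation′
    X : ℕ → ℤ
    X c = ε (res c) * χ (res c)
    term : (a b c d : ℕ) → ℤ
    term a b c d = odd (res b) * ((+ 1 + 3∣ (res a)) * + a) * X c
    E O : ℤ
    E = ∑⁴ N λ a b c d → δ (a ℕ.* b ℕ.+ c ℕ.* d) n * (term a b c d * even (res d))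
    O = ∑⁴ N λ a b c d → δ (a ℕ.* b ℕ.+ c ℕ.* d) n * (term a b c d * odd (res d))
    lem₀ : ∀ x e o → e + - + 1 * o ≡ x → + 4 * x ≡ + 2 * (+ 2 * e) - + 4 * o
    lem₀ _ e o refl = lem e o
      where lem : ∀ e o → + 4 * (e + - + 1 * o) ≡ + 2 * (+ 2 * e) - + 4 * o
            lem = ℤR.solve-∀
    lem₁ : ∀ n x → - + 2 * n * x ≡ - (+ 2 * n * x)
    lem₁ = ℤR.solve-∀
    E-O : E + - + 1 * O ≡ conv N n w-odd χ-sign
    E-O = cong (_+_ E) (sym (∑⁴-*ˡ N (- + 1) (λ a b c d → δ (a ℕ.* b ℕ.+ c ℕ.* d) n * (term a b c d * odd (res d)))))
      ∙ sym (∑⁴-+ N (λ a b c d → δ (a ℕ.* b ℕ.+ c ℕ.* d) n * (term a b c d * even (res d))) (λ a b c d → - + 1 * (δ (a ℕ.* b ℕ.+ c ℕ.* d) n * (term a b c d * odd (res d)))))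
      ∙ ∑⁴-cong N (λ a b c d → lem (δ (suc a ℕ.* suc b ℕ.+ suc c ℕ.* suc d) n) (w-odd (suc a) (suc b)) (ε (res (suc c))) (χ (res (suc c))) (even (res (suc d))) (odd (res (suc d)))
          ∙ cong (λ t → δ (suc a ℕ.* suc b ℕ.+ suc c ℕ.* suc d) n * (w-odd (suc a) (suc b) * (ε (res (suc c)) * t * χ (res (suc c))))) (sign (res (suc d))))
      where lem : ∀ x w e y p q → x * (w * (e * y) * p) + - + 1 * (x * (w * (e * y) * q)) ≡ x * (w * (e * (p - q) * y))
            lem = ℤR.solve-∀
            sign : ∀ r → even r - odd r ≡ ε r
            sign = by-cases
    eo≡ : Form N n (λ r s → even r * odd s) (λ _ _ → + 0) (λ r s → + 2 * ((+ 1 + 3∣ s) * ε r * χ r)) (λ _ _ → + 0) ≡ + 2 * E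
    eo≡ = ∑⁴-exchange N (λ a b c d → δ (a ℕ.* b ℕ.+ c ℕ.* d) n * (even (res b) * odd (res d) * (+ 0 + + 2 * ((+ 1 + 3∣ (res c)) * ε (res a) * χ (res a)) * + c + + 0)))
      ∙ ∑⁴-cong N (λ a b c d → cong (λ t → δ t n * (even (res (suc d)) * odd (res (suc b)) * (+ 0 + + 2 * ((+ 1 + 3∣ (res (suc a))) * ε (res (suc c)) * χ (res (suc c))) * + suc a + + 0))) (ℕP.+-comm (suc c ℕ.* suc d) (suc a ℕ.* suc b))
          ∙ lem (δ (suc a ℕ.* suc b ℕ.+ suc c ℕ.* suc d) n) (even (res (suc d))) (odd (res (suc b))) (+ 1 + 3∣ (res (suc a))) (ε (res (suc c))) (χ (res (suc c))) (+ suc a))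
      ∙ ∑⁴-*ˡ N (+ 2) (λ a b c d → δ (a ℕ.* b ℕ.+ c ℕ.* d) n * (term a b c d * even (res d)))
      where lem : ∀ x ed ob f e y a → x * (ed * ob * (+ 0 + + 2 * (f * e * y) * a + + 0)) ≡ + 2 * (x * (ob * (f * a) * (e * y) * ed))
            lem = ℤR.solve-∀
    oo≡ : Form N n (λ r s → odd r * odd s) (λ r s → + 2 * ((+ 1 + 3∣ r) * ε s * χ s)) (λ r s → + 2 * ((+ 1 + 3∣ s) * ε r * χ r)) (λ _ _ → + 0) ≡ + 4 * O
    oo≡ = ∑⁴-cong N (λ a b c d → lem (δ (suc a ℕ.* suc b ℕ.+ suc c ℕ.* suc d) n) (odd (res (suc b))) (odd (res (suc d))) (+ 1 + 3∣ (res (suc a))) (ε (res (suc a))) (χ (res (suc a)))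
             (+ 1 + 3∣ (res (suc c))) (ε (res (suc c))) (χ (res (suc c))) (+ suc a) (+ suc c))
      ∙ ∑⁴-+ N (λ a b c d → + 2 * (δ (a ℕ.* b ℕ.+ c ℕ.* d) n * (term a b c d * odd (res d)))) (λ a b c d → + 2 * (δ (a ℕ.* b ℕ.+ c ℕ.* d) n * (term c d a b * odd (res b))))
      ∙ cong₂ _+_ (∑⁴-*ˡ N (+ 2) (λ a b c d → δ (a ℕ.* b ℕ.+ c ℕ.* d) n * (term a b c d * odd (res d))))
          (∑⁴-*ˡ N (+ 2) (λ a b c d → δ (a ℕ.* b ℕ.+ c ℕ.* d) n * (term c d a b * odd (res b)))
            ∙ cong (+ 2 *_) (∑⁴-exchange N (λ a b c d → δ (a ℕ.* b ℕ.+ c ℕ.* d) n * (term c d a b * odd (res b)))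
                ∙ ∑⁴-cong N (λ a b c d → cong (λ t → δ t n * (term (suc a) (suc b) (suc c) (suc d) * odd (res (suc d)))) (ℕP.+-comm (suc c ℕ.* suc d) (suc a ℕ.* suc b)))))
      ∙ lem₄ O
      where lem : ∀ x ob od f e y f′ e′ y′ a c → x * (ob * od * (+ 2 * (f * e′ * y′) * a + + 2 * (f′ * e * y) * c + + 0))
                    ≡ + 2 * (x * (ob * (f * a) * (e′ * y′) * od)) + + 2 * (x * (od * (f′ * c) * (e * y) * ob))
            lem = ℤR.solve-∀
            lem₄ : ∀ x → + 2 * x + + 2 * x ≡ + 4 * x
            lem₄ = ℤR.solve-∀
    A0 : ∀ r → A r (# 0) ≡ + 2 * (ε r * χ r)
    A0 = by-cases
    point : ∀ a m → a ℕ.* m ≡ n →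
      boundary a m ≡ + 2 * w-odd a m + - + 2 * + n * χ-sign a m
        + (- + 2 * odd (res m) * (+ 1 + 3∣ (res a) + X a) * + a + - + 1 * (- + 2 * odd (res a) * (+ 1 + 3∣ (res m) + X m) * + m))
    point a m q =
        cong (λ t → (t * + a + + 0) * (odd (res m) * (+ m - + 1)) - odd (res a) * (- + 2 * (+ 1 + 3∣ (res m) + ε (res m) * χ (res m)) * + m + + 0) + - + 2 * ε (res a) * χ (res a) * + a * (even (res m) * + m)) (A0 (res a))
      ∙ cong (λ t → (+ 2 * (ε (res a) * χ (res a)) * + a + + 0) * (odd (res m) * (+ m - + 1)) - odd (res a) * (- + 2 * (+ 1 + 3∣ (res m) + ε (res m) * χ (res m)) * + m + + 0) + - + 2 * ε (res a) * χ (res a) * + a * (t * + m)) (even-ε (res m))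
      ∙ lem (ε (res a)) (χ (res a)) (ε (res m)) (χ (res m)) (odd (res a)) (odd (res m)) (3∣ (res a)) (3∣ (res m)) (+ a) (+ m)
      ∙ cong (λ t → + 2 * w-odd a m + - + 2 * t * χ-sign a m
        + (- + 2 * odd (res m) * (+ 1 + 3∣ (res a) + X a) * + a + - + 1 * (- + 2 * odd (res a) * (+ 1 + 3∣ (res m) + X m) * + m)))
          (sym (ℤP.pos-* a m) ∙ cong +_ q)
      where even-ε : ∀ r → even r ≡ ε r + odd r
            even-ε = by-cases
            lem : ∀ ea xa em xm oa om fa fm a m →
              (+ 2 * (ea * xa) * a + + 0) * (om * (m - + 1)) - oa * (- + 2 * (+ 1 + fm + em * xm) * m + + 0) + - + 2 * ea * xa * a * ((em + om) * m)
              ≡ + 2 * (om * ((+ 1 + fa) * a)) + - + 2 * (a * m) * (ea * em * xa)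
                + (- + 2 * om * (+ 1 + fa + ea * xa) * a + - + 1 * (- + 2 * oa * (+ 1 + fm + em * xm) * m))
            lem = ℤR.solve-∀

-- Formal power series

infixl 7 _★_
-- The Cauchy product, peeled at the constant term of f just as `_⊗_` peels its first list; this
-- makes `coeff-⊗` a direct induction.
_★_ : (ℕ → ℤ) → (ℕ → ℤ) → ℕ → ℤ
(f ★ g) zero = f 0 * g 0
(f ★ g) (suc n) = f 0 * g (suc n) + ((λ i → f (suc i)) ★ g) n

infixl 6 _⊕ₛ_
_⊕ₛ_ : (ℕ → ℤ) → (ℕ → ℤ) → ℕ → ℤ
(f ⊕ₛ g) n = f n + g n

infixl 7 _·_
_·_ : ℤ → (ℕ → ℤ) → ℕ → ℤ
(k · f) n = k * f n

★-cong≤ : ∀ n {f f′ g g′ : ℕ → ℤ} → (∀ i → i ℕ.≤ n → f i ≡ f′ i) → (∀ i → i ℕ.≤ n → g i ≡ g′ i) → (f ★ g) n ≡ (f′ ★ g′) n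
★-cong≤ zero p q = cong₂ _*_ (p 0 ℕ.z≤n) (q 0 ℕ.z≤n)
★-cong≤ (suc n) p q = cong₂ _+_ (cong₂ _*_ (p 0 ℕ.z≤n) (q (suc n) ℕP.≤-refl))
  (★-cong≤ n (λ i r → p (suc i) (ℕ.s≤s r)) (λ i r → q i (ℕP.m≤n⇒m≤1+n r)))

★-cong : ∀ n {f f′ g g′ : ℕ → ℤ} → (∀ i → f i ≡ f′ i) → (∀ i → g i ≡ g′ i) → (f ★ g) n ≡ (f′ ★ g′) n
★-cong n p q = ★-cong≤ n (λ i _ → p i) (λ i _ → q i)

★-distribʳ : ∀ n f g h → ((f ⊕ₛ g) ★ h) n ≡ (f ★ h) n + (g ★ h) n
★-distribʳ zero f g h = ℤP.*-distribʳ-+ (h 0) (f 0) (g 0)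
★-distribʳ (suc n) f g h = cong (_+_ ((f 0 + g 0) * h (suc n))) (★-distribʳ n (λ i → f (suc i)) (λ i → g (suc i)) h)
  ∙ lem (f 0) (g 0) (h (suc n)) _ _
  where lem : ∀ x y z u v → (x + y) * z + (u + v) ≡ x * z + u + (y * z + v)
        lem = ℤR.solve-∀

★-scaleˡ : ∀ n k f g → ((k · f) ★ g) n ≡ k * (f ★ g) n
★-scaleˡ zero k f g = ℤP.*-assoc k (f 0) (g 0)
★-scaleˡ (suc n) k f g = cong (_+_ (k * f 0 * g (suc n))) (★-scaleˡ n k (λ i → f (suc i)) g) ∙ lem k (f 0) (g (suc n)) _
  where lem : ∀ k x z u → k * x * z + k * u ≡ k * (x * z + u)
        lem = ℤR.solve-∀

★-unfoldʳ : ∀ n f g → (f ★ g) (suc n) ≡ (f ★ (λ i → g (suc i))) n + f (suc n) * g 0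
★-unfoldʳ zero f g = refl
★-unfoldʳ (suc n) f g = cong (_+_ (f 0 * g (suc (suc n)))) (★-unfoldʳ n (λ i → f (suc i)) g) ∙ sym (ℤP.+-assoc (f 0 * g (suc (suc n))) _ _)

★-comm : ∀ n f g → (f ★ g) n ≡ (g ★ f) n
★-comm zero f g = ℤP.*-comm (f 0) (g 0)
★-comm (suc n) f g = cong₂ _+_ (ℤP.*-comm (f 0) (g (suc n))) (★-comm n (λ i → f (suc i)) g)
  ∙ ℤP.+-comm (g (suc n) * f 0) _ ∙ sym (★-unfoldʳ n g f)

★-assoc : ∀ n f g h → ((f ★ g) ★ h) n ≡ (f ★ (g ★ h)) n
★-assoc zero f g h = ℤP.*-assoc (f 0) (g 0) (h 0)
★-assoc (suc n) f g h =
    cong (_+_ (f 0 * g 0 * h (suc n)))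
      (★-distribʳ n (f 0 · (λ i → g (suc i))) ((λ i → f (suc i)) ★ g) h
       ∙ cong₂ _+_ (★-scaleˡ n (f 0) (λ i → g (suc i)) h) (★-assoc n (λ i → f (suc i)) g h))
  ∙ lem (f 0) (g 0) (h (suc n)) _ _
  where lem : ∀ x y z u v → x * y * z + (x * u + v) ≡ x * (y * z + u) + v
        lem = ℤR.solve-∀

★-distribˡ : ∀ n f g h → (f ★ (g ⊕ₛ h)) n ≡ (f ★ g) n + (f ★ h) n
★-distribˡ n f g h = ★-comm n f (g ⊕ₛ h) ∙ ★-distribʳ n g h f ∙ cong₂ _+_ (★-comm n g f) (★-comm n h f)

★-scaleʳ : ∀ n k f g → (f ★ (k · g)) n ≡ k * (f ★ g) n
★-scaleʳ n k f g = ★-comm n f (k · g) ∙ ★-scaleˡ n k g f ∙ cong (k *_) (★-comm n g f)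

★-swap-middle : ∀ n f g h → ((f ★ g) ★ h) n ≡ ((f ★ h) ★ g) n
★-swap-middle n f g h = ★-assoc n f g h ∙ ★-cong n {f} (λ _ → refl) (λ i → ★-comm i g h) ∙ sym (★-assoc n f h g)

★-zeroˡ : ∀ n f → ((λ _ → + 0) ★ f) n ≡ + 0
★-zeroˡ zero f = refl
★-zeroˡ (suc n) f = ℤP.+-identityˡ _ ∙ ★-zeroˡ n f

★-∑₁ : ∀ N n (F : ℕ → ℕ → ℤ) g → ((λ m → ∑₁ N (λ x → F x m)) ★ g) n ≡ ∑₁ N (λ x → (F x ★ g) n)
★-∑₁ zero n F g = ★-zeroˡ n g
★-∑₁ (suc N) n F g = ★-distribʳ n (λ m → ∑₁ N (λ x → F x m)) (F (suc N)) g ∙ cong (_+ (F (suc N) ★ g) n) (★-∑₁ N n F g)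

-- δ m is the monomial q^m.

δ-★-0 : ∀ n f → (δ 0 ★ f) n ≡ f n
δ-★-0 zero f = ℤP.*-identityˡ (f 0)
δ-★-0 (suc n) f = drop-zero (ℤP.*-identityˡ (f (suc n))) (★-zeroˡ n f)

δ-★-δ : ∀ n l m → (δ l ★ δ m) n ≡ δ (l ℕ.+ m) n
δ-★-δ n zero m = δ-★-0 n (δ m)
δ-★-δ zero (suc l) m = refl
δ-★-δ (suc n) (suc l) m = ℤP.+-identityˡ _ ∙ δ-★-δ n l m

term : ℕ → ℤ → ℕ → ℤ
term m x n = δ m n * x

term-★-term : ∀ n l m x y → (term l x ★ term m y) n ≡ δ (l ℕ.+ m) n * (x * y)
term-★-term n l m x y = ★-cong n (λ i → ℤP.*-comm (δ l i) x) (λ i → ℤP.*-comm (δ m i) y)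
  ∙ ★-scaleˡ n x (δ l) (y · δ m) ∙ cong (x *_) (★-scaleʳ n y (δ l) (δ m) ∙ cong (y *_) (δ-★-δ n l m))
  ∙ lem x y (δ (l ℕ.+ m) n)
  where lem : ∀ x y z → x * (y * z) ≡ z * (x * y)
        lem = ℤR.solve-∀

-- The double series of u(a, b) q^(sab), cut off to the box; for positive s its coefficient at n is
-- exact when n ≤ N.
Ψ : ℕ → ℕ → (ℕ → ℕ → ℤ) → ℕ → ℤ
Ψ N s u n = ∑₁ N λ a → ∑₁ N λ b → δ (s ℕ.* (a ℕ.* b)) n * u a b

Ψ-★-Ψ : ∀ N n s t u v → (Ψ N s u ★ Ψ N t v) n ≡ ∑⁴ N (λ a b c d → δ (s ℕ.* (a ℕ.* b) ℕ.+ t ℕ.* (c ℕ.* d)) n * (u a b * v c d))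
Ψ-★-Ψ N n s t u v =
    ★-∑₁ N n (λ a m → ∑₁ N λ b → δ (s ℕ.* (a ℕ.* b)) m * u a b) (Ψ N t v)
  ∙ (∑₁-cong N λ a → ★-∑₁ N n (λ b m → δ (s ℕ.* (suc a ℕ.* b)) m * u (suc a) b) (Ψ N t v)
      ∙ (∑₁-cong N λ b → ★-comm n (term (s ℕ.* (suc a ℕ.* suc b)) (u (suc a) (suc b))) (Ψ N t v)
          ∙ ★-∑₁ N n (λ c m → ∑₁ N λ d → δ (t ℕ.* (c ℕ.* d)) m * v c d) (term (s ℕ.* (suc a ℕ.* suc b)) (u (suc a) (suc b)))
          ∙ (∑₁-cong N λ c → ★-∑₁ N n (λ d m → δ (t ℕ.* (suc c ℕ.* d)) m * v (suc c) d) (term (s ℕ.* (suc a ℕ.* suc b)) (u (suc a) (suc b)))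
              ∙ (∑₁-cong N λ d → term-★-term n (t ℕ.* (suc c ℕ.* suc d)) (s ℕ.* (suc a ℕ.* suc b)) (v (suc c) (suc d)) (u (suc a) (suc b))
                  ∙ cong₂ (λ x y → δ x n * y) (ℕP.+-comm (t ℕ.* (suc c ℕ.* suc d)) (s ℕ.* (suc a ℕ.* suc b))) (ℤP.*-comm (v (suc c) (suc d)) (u (suc a) (suc b))))))
      ∙ ∑₁-swap N N (λ b c → ∑₁ N λ d → δ (s ℕ.* (suc a ℕ.* b) ℕ.+ t ℕ.* (c ℕ.* d)) n * (u (suc a) b * v c d)))

-- Logarithmic derivatives q f′/f

D : (ℕ → ℤ) → ℕ → ℤ
D f n = + n * f n

D-★ : ∀ n f g → D (f ★ g) n ≡ (D f ★ g) n + (f ★ D g) n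
D-★ zero f g = sym (cong (_+_ (+ 0)) (ℤP.*-zeroʳ (f 0)))
D-★ (suc n) f g =
    lem (+ n) (f 0 * g (suc n)) ((f′ ★ g) n)
  ∙ cong (λ t → f 0 * g (suc n) + + n * (f 0 * g (suc n)) + ((f′ ★ g) n + t)) (D-★ n f′ g)
  ∙ lem₂ (f 0) (g (suc n)) (+ n) ((f′ ★ g) n) ((D f′ ★ g) n) ((f′ ★ D g) n)
  ∙ cong (λ t → + 0 + t + (f 0 * (+ suc n * g (suc n)) + (f′ ★ D g) n))
      (sym (★-distribʳ n f′ (D f′) g) ∙ ★-cong n (λ i → lem₃ (+ i) (f′ i)) (λ _ → refl))
  where
    f′ : ℕ → ℤ
    f′ i = f (suc i)
    lem : ∀ n x y → (+ 1 + n) * (x + y) ≡ x + n * x + (y + n * y)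
    lem = ℤR.solve-∀
    lem₂ : ∀ x y n a b c → x * y + n * (x * y) + (a + (b + c)) ≡ + 0 + (a + b) + (x * ((+ 1 + n) * y) + c)
    lem₂ = ℤR.solve-∀
    lem₃ : ∀ n x → x + n * x ≡ (+ 1 + n) * x
    lem₃ = ℤR.solve-∀

-- The form q f′ = f l avoids inverse series. The bound K is there because truncated products and
-- sums agree with the infinite ones only up to some degree.
Log : ℕ → (ℕ → ℤ) → (ℕ → ℤ) → Set
Log K f l = ∀ n → n ℕ.≤ K → D f n ≡ (f ★ l) n

Log-cong : ∀ {K f f′ l l′} → (∀ n → n ℕ.≤ K → f n ≡ f′ n) → (∀ n → n ℕ.≤ K → l n ≡ l′ n) → Log K f l → Log K f′ l′
Log-cong p q h n n≤K = cong (+ n *_) (sym (p n n≤K)) ∙ h n n≤K ∙ ★-cong≤ n (λ i r → p i (ℕP.≤-trans r n≤K)) (λ i r → q i (ℕP.≤-trans r n≤K))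

Log-★ : ∀ {K f g l m} → Log K f l → Log K g m → Log K (f ★ g) (l ⊕ₛ m)
Log-★ {K} {f} {g} {l} {m} p q n n≤K =
    D-★ n f g
  ∙ cong₂ _+_ (★-cong≤ n {g = g} (λ i r → p i (ℕP.≤-trans r n≤K)) (λ _ _ → refl) ∙ ★-swap-middle n f l g)
              (★-cong≤ n {f} (λ _ _ → refl) (λ i r → q i (ℕP.≤-trans r n≤K)) ∙ sym (★-assoc n f g m))
  ∙ sym (★-distribˡ n (f ★ g) l m)

-- As l(0) = 0, the equation in degree n + 1 expresses (n + 1) f(n + 1) through lower coefficients,
-- and n + 1 can be cancelled in ℤ.
Log-unique : ∀ {K f g l} → l 0 ≡ + 0 → Log K f l → Log K g l → f 0 ≡ g 0 → ∀ n → n ℕ.≤ K → f n ≡ g n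
Log-unique {K} {f} {g} {l} l0 p q base n n≤K = upto n n≤K n ℕP.≤-refl
  where
    lower : ∀ n h → (h ★ l) (suc n) ≡ (h ★ (λ i → l (suc i))) n
    lower n h = ★-unfoldʳ n h l ∙ drop-zero refl (cong (h (suc n) *_) l0 ∙ ℤP.*-zeroʳ (h (suc n)))
    upto : ∀ n → n ℕ.≤ K → ∀ i → i ℕ.≤ n → f i ≡ g i
    upto zero r .zero ℕ.z≤n = base
    upto (suc n) r i s with ℕP.m≤n⇒m<n∨m≡n s
    ... | inj₁ (ℕ.s≤s t) = upto n (ℕP.<⇒≤ r) i t
    ... | inj₂ refl = ℤP.*-cancelˡ-≡ (+ suc n) (f (suc n)) (g (suc n))
      (p (suc n) r ∙ lower n f ∙ ★-cong≤ n {g = λ i → l (suc i)} (upto n (ℕP.<⇒≤ r)) (λ _ _ → refl) ∙ sym (lower n g) ∙ sym (q (suc n) r))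

★-cancel : ∀ {K f g h} → f 0 ≡ + 1 → (∀ n → n ℕ.≤ K → (f ★ g) n ≡ (f ★ h) n) → ∀ n → n ℕ.≤ K → g n ≡ h n
★-cancel {K} {f} {g} {h} f0 p n n≤K = upto n n≤K n ℕP.≤-refl
  where
    head : ∀ x → f 0 * x ≡ x
    head x = cong (_* x) f0 ∙ ℤP.*-identityˡ x
    upto : ∀ n → n ℕ.≤ K → ∀ i → i ℕ.≤ n → g i ≡ h i
    upto zero r .zero ℕ.z≤n = sym (head (g 0)) ∙ p 0 r ∙ head (h 0)
    upto (suc n) r i s with ℕP.m≤n⇒m<n∨m≡n s
    ... | inj₁ (ℕ.s≤s t) = upto n (ℕP.<⇒≤ r) i t
    ... | inj₂ refl = sym (head (g (suc n)))
      ∙ ℤG.∙-cancelʳ (((λ i → f (suc i)) ★ g) n) (f 0 * g (suc n)) (f 0 * h (suc n))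
          (p (suc n) r ∙ cong (_+_ (f 0 * h (suc n))) (sym (★-cong≤ n {λ i → f (suc i)} (λ _ _ → refl) (upto n (ℕP.<⇒≤ r)))))
      ∙ head (h (suc n))

-- By the Leibniz rule the terms with D f cancel and f ★ D g = f ★ (g ★ m) remains; the constant
-- term 1 allows f to be cancelled.
Log-quotient : ∀ {K f g l m} → f 0 ≡ + 1 → Log K f l → Log K (f ★ g) (l ⊕ₛ m) → Log K g m
Log-quotient {K} {f} {g} {l} {m} f0 p q = ★-cancel {f = f} f0 λ n n≤K →
  ℤG.∙-cancelˡ ((D f ★ g) n) _ _
    (sym (D-★ n f g) ∙ q n n≤K ∙ ★-distribˡ n (f ★ g) l m
      ∙ cong₂ _+_ (★-swap-middle n f g l ∙ sym (★-cong≤ n {g = g} (λ i r → p i (ℕP.≤-trans r n≤K)) (λ _ _ → refl))) (★-assoc n f g m))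

1-q^ : ℕ → ℕ → ℤ
1-q^ k n = δ 0 n - δ k n

1-q^-★ : ∀ n f k m → ((f ★ 1-q^ k) ★ δ m) n ≡ (f ★ δ m) n - (f ★ δ (k ℕ.+ m)) n
1-q^-★ n f k m = ★-assoc n f (1-q^ k) (δ m)
  ∙ ★-cong n {f} (λ _ → refl) (λ i → ★-cong i {1-q^ k} (λ j → cong (_+_ (δ 0 j)) (lem (δ k j))) (λ _ → refl)
      ∙ ★-distribʳ i (δ 0) (- + 1 · δ k) (δ m) ∙ cong₂ _+_ (δ-★-0 i (δ m)) (★-scaleˡ i (- + 1) (δ k) (δ m) ∙ cong (- + 1 *_) (δ-★-δ i k m)))
  ∙ ★-distribˡ n f (δ m) (- + 1 · δ (k ℕ.+ m))
  ∙ cong (_+_ ((f ★ δ m) n)) (★-scaleʳ n (- + 1) f (δ (k ℕ.+ m)) ∙ sym (lem ((f ★ δ (k ℕ.+ m)) n)))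
  where lem : ∀ x → - x ≡ - + 1 * x
        lem = ℤR.solve-∀

★-δ-high : ∀ n f m → n ℕ.< m → (f ★ δ m) n ≡ + 0
★-δ-high zero f (suc m) p = ℤP.*-zeroʳ (f 0)
★-δ-high (suc n) f m p = cong₂ _+_ (cong (f 0 *_) (δ-> p) ∙ ℤP.*-zeroʳ (f 0)) (★-δ-high n (λ i → f (suc i)) m (ℕP.<⇒≤ p))

∑-telescope : ∀ n (c : ℕ → ℤ) → ∑ n (λ j → c (suc j) - c j) ≡ c n - c 0
∑-telescope zero c = sym (ℤP.+-inverseʳ (c 0))
∑-telescope (suc n) c = cong (_+_ (c 1 - c 0)) (∑-telescope n (λ j → c (suc j))) ∙ lem (c 0) (c 1) (c (suc n))
  where lem : ∀ x y z → y - x + (z - y) ≡ z - x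
        lem = ℤR.solve-∀

∑-★ : ∀ N n (F : ℕ → ℕ → ℤ) g → ((λ m → ∑ N (λ x → F x m)) ★ g) n ≡ ∑ N (λ x → (F x ★ g) n)
∑-★ zero n F g = ★-zeroˡ n g
∑-★ (suc N) n F g = ★-distribʳ n (F 0) (λ m → ∑ N (λ x → F (suc x) m)) g ∙ cong (_+_ ((F 0 ★ g) n)) (∑-★ N n (λ x → F (suc x)) g)

-- Gauss's product for ψ from a finite identity of D. Shanks, multiplied by the denominators:
-- with y = q^p, ∑_{j<m} y^{j(2m+1)} ∏_{i≤j} (1 - y^{2i-1}) ∏_{j<i≤m} (1 - y^{2i}) = ∏_{i≤m} (1 - y^{2i-1}) ∑_{i<2m} y^{i(i+1)/2}.
module Gauss (s : ℕ) where

  -- With p = 2s the exponent s i (i + 1) is p times the triangular number i (i + 1)/2, and no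
  -- halving occurs.
  p : ℕ
  p = s ℕ.* 2

  odds : ℕ → ℕ → ℤ
  odds zero = δ 0
  odds (suc j) = odds j ★ 1-q^ (p ℕ.* suc (j ℕ.* 2))

  evens : ℕ → ℕ → ℕ → ℤ
  evens j zero = δ 0
  evens j (suc d) = 1-q^ (p ℕ.* (suc j ℕ.* 2)) ★ evens (suc j) d

  evens-last : ∀ j d n → evens j (suc d) n ≡ (evens j d ★ 1-q^ (p ℕ.* (suc (j ℕ.+ d) ℕ.* 2))) n
  evens-last j zero n rewrite ℕP.+-identityʳ j = ★-comm n (1-q^ (p ℕ.* (suc j ℕ.* 2))) (δ 0)
  evens-last j (suc d) n rewrite ℕP.+-suc j d = ★-cong n {1-q^ (p ℕ.* (suc j ℕ.* 2))} (λ _ → refl) (evens-last (suc j) d)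
    ∙ sym (★-assoc n (1-q^ (p ℕ.* (suc j ℕ.* 2))) (evens (suc j) d) (1-q^ (p ℕ.* (suc (suc (j ℕ.+ d)) ℕ.* 2))))

  ψ-upto : ℕ → ℕ → ℤ
  ψ-upto m n = ∑ m (λ i → δ (s ℕ.* (i ℕ.* suc i)) n)

  product : ℕ → ℕ → ℕ → ℤ
  product m j = odds j ★ evens j (m ℕ.∸ j)

  shanks-sum : ℕ → ℕ → ℤ
  shanks-sum m n = ∑ m (λ j → (product m j ★ δ (p ℕ.* (j ℕ.* suc (m ℕ.* 2)))) n)

  shanks : ∀ m n → shanks-sum m n ≡ (odds m ★ ψ-upto (m ℕ.* 2)) n
  shanks zero n = sym (★-comm n (δ 0) (λ _ → + 0) ∙ ★-zeroˡ n (δ 0))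
  shanks (suc m) n =
      ∑-cong< (suc m) (λ j r → step j (ℕP.≤-pred r))
    ∙ ∑-+ (suc m) (λ j → ((K j ★ δ (p ℕ.* (j ℕ.* M))) ★ 1-q^ (p ℕ.* M)) n) (λ j → C (suc j) - C j)
    ∙ cong₂ _+_
        (sym (∑-★ (suc m) n (λ j → K j ★ δ (p ℕ.* (j ℕ.* M))) (1-q^ (p ℕ.* M)))
          ∙ ★-cong n {g = 1-q^ (p ℕ.* M)} (λ i → ∑-last m (λ j → (K j ★ δ (p ℕ.* (j ℕ.* M))) i)
              ∙ cong₂ _+_ (shanks m i) (★-cong i K-last (λ _ → refl)) ∙ sym (★-distribˡ i (odds m) (ψ-upto (m ℕ.* 2)) (δ (p ℕ.* (m ℕ.* M))))) (λ _ → refl)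
          ∙ ★-swap-middle n (odds m) (ψ-upto (m ℕ.* 2) ⊕ₛ δ (p ℕ.* (m ℕ.* M))) (1-q^ (p ℕ.* M)))
        (∑-telescope (suc m) C ∙ ℤP.+-identityʳ (C (suc m))
          ∙ ★-cong n (λ i → ★-cong i {odds (suc m)} (λ _ → refl) (λ l → cong (λ d → evens m d l) (ℕP.n∸n≡0 m)) ∙ ★-comm i (odds (suc m)) (δ 0) ∙ δ-★-0 i (odds (suc m))) (λ _ → refl))
    ∙ sym (★-distribˡ n (odds (suc m)) (ψ-upto (m ℕ.* 2) ⊕ₛ δ (p ℕ.* (m ℕ.* M))) (δ (p ℕ.* (suc m ℕ.* M))))
    -- The two new exponents of ψ come from the ends of the sum: i = 2m from the summand j = m, and
    -- i = 2m + 1 from the last value of the telescoping sequence.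
    ∙ ★-cong n {odds (suc m)} (λ _ → refl) (λ i → cong₂ (λ x y → ψ-upto (m ℕ.* 2) i + δ x i + δ y i) (exp₁ s m) (exp₂ s m)
        ∙ cong (_+ δ (s ℕ.* (suc (m ℕ.* 2) ℕ.* suc (suc (m ℕ.* 2)))) i) (sym (∑-last (m ℕ.* 2) (λ j → δ (s ℕ.* (j ℕ.* suc j)) i)))
        ∙ sym (∑-last (suc (m ℕ.* 2)) (λ j → δ (s ℕ.* (j ℕ.* suc j)) i)))
    where
      M = suc (m ℕ.* 2)
      K : ℕ → ℕ → ℤ
      K = product m
      -- Telescoping certificate: the new j-th summand is the old one times 1 - y^M, the new odd
      -- factor, plus C(j + 1) - C(j). The value 0 at j = 0 fits the general pattern because 1 - y^0
      -- = 0.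
      C : ℕ → ℤ
      C zero = + 0
      C (suc j) = ((odds (suc j) ★ evens j (m ℕ.∸ j)) ★ δ (p ℕ.* (suc j ℕ.* M))) n

      C-suc : ∀ j → C (suc j) ≡ (K j ★ δ (p ℕ.* (suc j ℕ.* M))) n - (K j ★ δ (p ℕ.* (suc (j ℕ.* 2) ℕ.+ suc j ℕ.* M))) n
      C-suc j = ★-cong n (λ i → ★-swap-middle i (odds j) (1-q^ (p ℕ.* suc (j ℕ.* 2))) (evens j (m ℕ.∸ j))) (λ _ → refl)
        ∙ 1-q^-★ n (K j) (p ℕ.* suc (j ℕ.* 2)) (p ℕ.* (suc j ℕ.* M))
        ∙ cong (λ t → (K j ★ δ (p ℕ.* (suc j ℕ.* M))) n - (K j ★ δ t) n) (sym (ℕP.*-distribˡ-+ p (suc (j ℕ.* 2)) (suc j ℕ.* M)))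

      C-self : ∀ j → j ℕ.≤ m → C j ≡ (K j ★ δ (p ℕ.* (j ℕ.* M))) n - (K j ★ δ (p ℕ.* (j ℕ.* 2 ℕ.+ j ℕ.* M))) n
      C-self zero r = sym (ℤP.+-inverseʳ ((K 0 ★ δ (p ℕ.* 0)) n))
      C-self (suc j) r = ★-cong n (λ i → ★-cong i {odds (suc j)} (λ _ → refl) (λ l → cong (λ d → evens j d l) (ℕP.+-∸-assoc 1 r)
            ∙ ★-comm l (1-q^ (p ℕ.* (suc j ℕ.* 2))) (evens (suc j) (m ℕ.∸ suc j)))
          ∙ sym (★-assoc i (odds (suc j)) (evens (suc j) (m ℕ.∸ suc j)) (1-q^ (p ℕ.* (suc j ℕ.* 2))))) (λ _ → refl)
        ∙ 1-q^-★ n (K (suc j)) (p ℕ.* (suc j ℕ.* 2)) (p ℕ.* (suc j ℕ.* M))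
        ∙ cong (λ t → (K (suc j) ★ δ (p ℕ.* (suc j ℕ.* M))) n - (K (suc j) ★ δ t) n) (sym (ℕP.*-distribˡ-+ p (suc j ℕ.* 2) (suc j ℕ.* M)))

      K-last : ∀ i → K m i ≡ odds m i
      K-last i = ★-cong i {odds m} (λ _ → refl) (λ l → cong (λ d → evens m d l) (ℕP.n∸n≡0 m)) ∙ ★-comm i (odds m) (δ 0) ∙ δ-★-0 i (odds m)

      exp₁ : ∀ s m → s ℕ.* 2 ℕ.* (m ℕ.* suc (m ℕ.* 2)) ≡ s ℕ.* (m ℕ.* 2 ℕ.* suc (m ℕ.* 2))
      exp₁ = ℕR.solve-∀
      exp₂ : ∀ s m → s ℕ.* 2 ℕ.* (suc m ℕ.* suc (m ℕ.* 2)) ≡ s ℕ.* (suc (m ℕ.* 2) ℕ.* suc (suc (m ℕ.* 2)))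
      exp₂ = ℕR.solve-∀
      exp₃ : ∀ j m → j ℕ.* suc (suc m ℕ.* 2) ≡ j ℕ.* 2 ℕ.+ j ℕ.* suc (m ℕ.* 2)
      exp₃ = ℕR.solve-∀
      exp₄ : ∀ j m → suc m ℕ.* 2 ℕ.+ j ℕ.* suc (suc m ℕ.* 2) ≡ suc (j ℕ.* 2) ℕ.+ suc j ℕ.* suc (m ℕ.* 2)
      exp₄ = ℕR.solve-∀

      step : ∀ j → j ℕ.≤ m → (product (suc m) j ★ δ (p ℕ.* (j ℕ.* suc (suc m ℕ.* 2)))) n ≡
        ((K j ★ δ (p ℕ.* (j ℕ.* M))) ★ 1-q^ (p ℕ.* M)) n + (C (suc j) - C j)
      step j r =
          ★-cong n (λ i → ★-cong i {odds j} (λ _ → refl) (λ l → cong (λ d → evens j d l) (ℕP.+-∸-assoc 1 r) ∙ evens-last j (m ℕ.∸ j) l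
              ∙ cong (λ t → (evens j (m ℕ.∸ j) ★ 1-q^ (p ℕ.* (suc t ℕ.* 2))) l) (ℕP.m+[n∸m]≡n r))
            ∙ sym (★-assoc i (odds j) (evens j (m ℕ.∸ j)) (1-q^ (p ℕ.* (suc m ℕ.* 2))))) (λ _ → refl)
        ∙ 1-q^-★ n (K j) (p ℕ.* (suc m ℕ.* 2)) (p ℕ.* (j ℕ.* suc (suc m ℕ.* 2)))
        ∙ cong₂ (λ x y → (K j ★ δ x) n - (K j ★ δ y) n) (cong (p ℕ.*_) (exp₃ j m))
            (sym (ℕP.*-distribˡ-+ p (suc m ℕ.* 2) (j ℕ.* suc (suc m ℕ.* 2))) ∙ cong (p ℕ.*_) (exp₄ j m))
        ∙ lem ((K j ★ δ (p ℕ.* (j ℕ.* M))) n) ((K j ★ δ (p ℕ.* (suc j ℕ.* M))) n) _ _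
        ∙ sym (cong₂ _+_
            (★-swap-middle n (K j) (δ (p ℕ.* (j ℕ.* M))) (1-q^ (p ℕ.* M)) ∙ 1-q^-★ n (K j) (p ℕ.* M) (p ℕ.* (j ℕ.* M))
              ∙ cong (λ t → (K j ★ δ (p ℕ.* (j ℕ.* M))) n - (K j ★ δ t) n) (sym (ℕP.*-distribˡ-+ p M (j ℕ.* M))))
            (cong₂ _-_ (C-suc j) (C-self j r)))
        where lem : ∀ x y z w → z - w ≡ x - y + ((y - w) - (x - z))
              lem = ℤR.solve-∀

  -- Below degree m only j = 0 survives in `shanks-sum`, since every other summand carries a factor
  -- y^(j(2m + 1)).
  gauss : ∀ m n → 1 ℕ.≤ s → n ℕ.< m → evens 0 m n ≡ (odds m ★ ψ-upto (m ℕ.* 2)) n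
  gauss (suc m) n 1≤s r = sym (cong₂ _+_ first (∑-zero m λ j _ → ★-δ-high n (product (suc m) (suc j)) _ (high j)) ∙ ℤP.+-identityʳ _) ∙ shanks (suc m) n
    where
      first : (product (suc m) 0 ★ δ (p ℕ.* 0)) n ≡ evens 0 (suc m) n
      first rewrite ℕP.*-zeroʳ p = ★-comm n (product (suc m) 0) (δ 0) ∙ δ-★-0 n (product (suc m) 0) ∙ δ-★-0 n (evens 0 (suc m))
      high : ∀ j → n ℕ.< p ℕ.* (suc j ℕ.* suc (suc m ℕ.* 2))
      high j = ℕP.<-≤-trans (ℕP.<-≤-trans r (ℕP.≤-trans (ℕP.m≤m*n (suc m) 2) (ℕP.≤-trans (ℕP.n≤1+n _) (ℕP.m≤n*m (suc (suc m ℕ.* 2)) (suc j)))))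
        (ℕP.m≤n*m (suc j ℕ.* suc (suc m ℕ.* 2)) p {{ℕ.>-nonZero (ℕP.≤-trans 1≤s (ℕP.m≤m*n s 2))}})

-- Dilations q ↦ q^s of double series

δ-scale : ∀ s x y → δ (suc s ℕ.* x) (suc s ℕ.* y) ≡ δ x y
δ-scale s x y with x ℕP.≟ y
... | yes refl = δ-refl (suc s ℕ.* x) ∙ sym (δ-refl x)
... | no p = δ-≢ (λ q → p (ℕP.*-cancelˡ-≡ x y (suc s) q)) ∙ sym (δ-≢ p)

-- Transfers identities from q to q^s: either m = s j and the identity at j applies, or no monomial
-- in q^s has degree m and all terms vanish.
multiple? : ∀ s m → (∃ λ j → m ≡ s ℕ.* j) ⊎ (∀ x → δ (s ℕ.* x) m ≡ + 0)
multiple? s m with s ∣? m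
... | yes (divides j p) = inj₁ (j , (p ∙ ℕP.*-comm j s))
... | no p = inj₂ (λ x → δ-≢ (λ q → p (divides x (sym q ∙ ℕP.*-comm s x))))

∑₁²-cong : ∀ N {F G : ℕ → ℕ → ℤ} → (∀ a b → F (suc a) (suc b) ≡ G (suc a) (suc b)) → (∑₁ N λ a → ∑₁ N (F a)) ≡ (∑₁ N λ a → ∑₁ N (G a))
∑₁²-cong N h = ∑₁-cong N λ a → ∑₁-cong N (h a)

Ψ-multiple : ∀ N s j u → Ψ N (suc s) u (suc s ℕ.* j) ≡ ∑∣ N j u
Ψ-multiple N s j u = ∑₁²-cong N λ a b → cong (_* u (suc a) (suc b)) (δ-scale s (suc a ℕ.* suc b) j)

Ψ-nonmultiple : ∀ N s m u → (∀ x → δ (s ℕ.* x) m ≡ + 0) → Ψ N s u m ≡ + 0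
Ψ-nonmultiple N s m u h = ∑₁-zero N λ a → ∑₁-zero N λ b → cong (_* u (suc a) (suc b)) (h _)

Ψ-★-multiple : ∀ N s j u v → (Ψ N (suc s) u ★ Ψ N (suc s) v) (suc s ℕ.* j) ≡ conv N j u v
Ψ-★-multiple N s j u v = Ψ-★-Ψ N (suc s ℕ.* j) (suc s) (suc s) u v
  ∙ ∑⁴-cong N λ a b c d → cong (_* (u (suc a) (suc b) * v (suc c) (suc d)))
      (cong (λ t → δ t (suc s ℕ.* j)) (sym (ℕP.*-distribˡ-+ (suc s) (suc a ℕ.* suc b) (suc c ℕ.* suc d))) ∙ δ-scale s (suc a ℕ.* suc b ℕ.+ suc c ℕ.* suc d) j)

Ψ-★-nonmultiple : ∀ N s m u v → (∀ x → δ (s ℕ.* x) m ≡ + 0) → (Ψ N s u ★ Ψ N s v) m ≡ + 0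
Ψ-★-nonmultiple N s m u v h = Ψ-★-Ψ N m s s u v
  ∙ ∑⁴-zero N λ a b c d → cong (_* (u (suc a) (suc b) * v (suc c) (suc d)))
      (cong (λ t → δ t m) (sym (ℕP.*-distribˡ-+ s (suc a ℕ.* suc b) (suc c ℕ.* suc d))) ∙ h _)

Ψ-low : ∀ N s n u → n ℕ.< s → Ψ N s u n ≡ + 0
Ψ-low N s n u p = ∑₁-zero N λ a → ∑₁-zero N λ b → cong (_* u (suc a) (suc b)) (δ-> (ℕP.<-≤-trans p (ℕP.m≤m*n s (suc a ℕ.* suc b))))

★-shift : ∀ s n X l → (∀ i → i ℕ.< s → X i ≡ + 0) → (X ★ l) (s ℕ.+ n) ≡ ((λ i → X (s ℕ.+ i)) ★ l) n
★-shift zero n X l h = refl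
★-shift (suc s) n X l h = cong₂ _+_ (cong (_* l (suc s ℕ.+ n)) (h 0 (ℕ.s≤s ℕ.z≤n))) (★-shift s n (λ i → X (suc i)) l (λ i p → h (suc i) (ℕ.s≤s p)))
  ∙ ℤP.+-identityˡ _

conv-exchange : ∀ N n u v → conv N n u v ≡ conv N n v u
conv-exchange N n u v = ∑⁴-exchange N (λ a b c d → δ (a ℕ.* b ℕ.+ c ℕ.* d) n * (u a b * v c d))
  ∙ ∑⁴-cong N λ a b c d → cong₂ (λ x y → δ x n * y) (ℕP.+-comm (suc c ℕ.* suc d) (suc a ℕ.* suc b)) (ℤP.*-comm (u (suc c) (suc d)) (v (suc a) (suc b)))

-- For even n both sides are zero: two odd numbers have an odd product, and ab + cd is odd when b is
-- even and c, d are odd.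
derivation-any : ∀ N n → n ℕ.≤ N → (+ n - + 1) * ∑∣ N n χ-odd ≡ + 2 * conv N n w-even χ-odd
derivation-any N n n≤N with parity (res n)
  where parity : ∀ r → (odd r ≡ + 1) ⊎ (odd r ≡ + 0)
        parity = from-yes (all? λ r → (odd r ℤ.≟ + 1) ⊎-dec (odd r ℤ.≟ + 0))
... | inj₁ o = derivation N n n≤N o
... | inj₂ o = cong ((+ n - + 1) *_) left ∙ ℤP.*-zeroʳ (+ n - + 1) ∙ sym (cong (+ 2 *_) right)
  where
    left : ∑∣ N n χ-odd ≡ + 0
    left = ∑₁-zero N λ a → ∑₁-zero N λ b → δ-guard (suc a ℕ.* suc b) n {y = + 0} (λ { refl →
        cong (_* χ (res (suc a))) (prod (res (suc a)) (res (suc b)) ∙ cong odd (sym (res-* (suc a) (suc b))) ∙ o) })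
      ∙ ℤP.*-zeroʳ (δ (suc a ℕ.* suc b) n)
      where prod : ∀ r s → odd r * odd s ≡ odd (r ⊠ s)
            prod = by-cases₂
    right : conv N n w-even χ-odd ≡ + 0
    right = ∑⁴-zero N λ a b c d → δ-guard (suc a ℕ.* suc b ℕ.+ suc c ℕ.* suc d) n {y = + 0} (λ { refl →
        lem (even (res (suc b))) (- ε (res (suc a)) * ((+ 1 + 3∣ (res (suc a))) * + suc a)) (odd (res (suc c))) (odd (res (suc d))) (χ (res (suc c)))
        ∙ cong (_* ((- ε (res (suc a)) * ((+ 1 + 3∣ (res (suc a))) * + suc a)) * χ (res (suc c))))
            (sums (res (suc a)) (res (suc b)) (res (suc c)) (res (suc d))
              ∙ cong (_* (even (res (suc b)) * (odd (res (suc c)) * odd (res (suc d)))))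
                  (cong odd (sym (res-+ (suc a ℕ.* suc b) (suc c ℕ.* suc d) ∙ cong₂ _⊞_ (res-* (suc a) (suc b)) (res-* (suc c) (suc d)))) ∙ o)) })
      ∙ ℤP.*-zeroʳ (δ (suc a ℕ.* suc b ℕ.+ suc c ℕ.* suc d) n)
      where lem : ∀ e w p q x → e * w * (p * q * x) ≡ e * (p * q) * (w * x)
            lem = ℤR.solve-∀
            sums : ∀ r s t u → even s * (odd t * odd u) ≡ odd ((r ⊠ s) ⊞ (t ⊠ u)) * (even s * (odd t * odd u))
            sums = by-cases₄

-- The logarithmic derivative of ψ from its product

module Logs (N K : ℕ) (K<N : K ℕ.< N) where

  private
    K≤N : K ℕ.≤ N
    K≤N = ℕP.<⇒≤ K<N

  -- The geometric series q^k/(1 - q^k); its tail starts at q^(k(N + 1)), which for positive k is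
  -- beyond K.
  geo : ℕ → ℕ → ℤ
  geo k n = ∑₁ N λ b → δ (k ℕ.* b) n

  Log-1 : Log K (δ 0) (λ _ → + 0)
  Log-1 zero p = refl
  Log-1 (suc n) p = ℤP.*-zeroʳ (+ suc n) ∙ sym (δ-★-0 (suc n) (λ _ → + 0))

  geo-★ : ∀ M k n → ((λ i → ∑₁ M λ b → δ (k ℕ.* b) i) ★ 1-q^ k) n ≡ δ k n - δ (k ℕ.* suc M) n
  geo-★ M k n = ★-∑₁ M n (λ b → δ (k ℕ.* b)) (1-q^ k) ∙ tele M
    where
      shift : ∀ b → (δ (k ℕ.* b) ★ 1-q^ k) n ≡ δ (k ℕ.* b) n - δ (k ℕ.* suc b) n
      shift b = ★-comm n (δ (k ℕ.* b)) (1-q^ k) ∙ ★-cong n {1-q^ k} (λ i → sym (δ-★-0 i (1-q^ k))) (λ _ → refl)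
        ∙ 1-q^-★ n (δ 0) k (k ℕ.* b) ∙ cong₂ _-_ (δ-★-0 n (δ (k ℕ.* b))) (δ-★-0 n (δ (k ℕ.+ k ℕ.* b)) ∙ cong (λ t → δ t n) (sym (ℕP.*-suc k b)))
      tele : ∀ M → ∑₁ M (λ b → (δ (k ℕ.* b) ★ 1-q^ k) n) ≡ δ k n - δ (k ℕ.* suc M) n
      tele zero = sym (cong (λ t → δ k n - δ t n) (ℕP.*-identityʳ k) ∙ ℤP.+-inverseʳ (δ k n))
      tele (suc M) = cong₂ _+_ (tele M) (shift (suc M)) ∙ lem (δ k n) _ _
        where lem : ∀ x y z → x - y + (y - z) ≡ x - z
              lem = ℤR.solve-∀

  Log-1-q^ : ∀ k → 1 ℕ.≤ k → Log K (1-q^ k) ((- + k) · geo k)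
  Log-1-q^ (suc k) _ n n≤K =
      lem (+ n) (δ 0 n) (δ (suc k) n)
    ∙ cong₂ _-_ (ℤP.*-comm (+ n) (δ 0 n) ∙ δ-guard 0 n {x = + n} {y = + 0} (λ { refl → refl }) ∙ ℤP.*-zeroʳ (δ 0 n))
                (ℤP.*-comm (+ n) (δ (suc k) n) ∙ δ-guard (suc k) n {x = + n} {y = + suc k} (λ { refl → refl }))
    ∙ lem₂ (δ (suc k) n) (+ suc k)
    ∙ cong (λ t → - + suc k * (δ (suc k) n - t)) (sym (δ-> (ℕP.≤-<-trans n≤K (ℕP.<-≤-trans K<N (ℕP.≤-trans (ℕP.n≤1+n N) (ℕP.m≤n*m (suc N) (suc k)))))))
    ∙ sym (★-scaleʳ n (- + suc k) (1-q^ (suc k)) (geo (suc k)) ∙ cong (- + suc k *_) (★-comm n (1-q^ (suc k)) (geo (suc k)) ∙ geo-★ N (suc k) n))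
    where lem : ∀ n x y → n * (x - y) ≡ n * x - n * y
          lem = ℤR.solve-∀
          lem₂ : ∀ x k → + 0 - x * k ≡ - k * (x - + 0)
          lem₂ = ℤR.solve-∀

  module _ (s′ : ℕ) where
    private s = suc s′
    open Gauss s

    Log-odds : ∀ m → Log K (odds m) (λ n → ∑ m (λ i → - + (p ℕ.* suc (i ℕ.* 2)) * geo (p ℕ.* suc (i ℕ.* 2)) n))
    Log-odds zero = Log-1
    Log-odds (suc m) = Log-cong (λ _ _ → refl) (λ n _ → sym (∑-last m (λ i → - + (p ℕ.* suc (i ℕ.* 2)) * geo (p ℕ.* suc (i ℕ.* 2)) n)))
      (Log-★ (Log-odds m) (Log-1-q^ (p ℕ.* suc (m ℕ.* 2)) (ℕ.s≤s ℕ.z≤n)))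

    Log-evens : ∀ j d → Log K (evens j d) (λ n → ∑ d (λ i → - + (p ℕ.* (suc (j ℕ.+ i) ℕ.* 2)) * geo (p ℕ.* (suc (j ℕ.+ i) ℕ.* 2)) n))
    Log-evens j zero = Log-1
    Log-evens j (suc d) = Log-cong (λ _ _ → refl)
      (λ n _ → cong₂ _+_ (cong (λ t → - + (p ℕ.* (suc t ℕ.* 2)) * geo (p ℕ.* (suc t ℕ.* 2)) n) (sym (ℕP.+-identityʳ j)))
                         (∑-cong d λ i → cong (λ t → - + (p ℕ.* (suc t ℕ.* 2)) * geo (p ℕ.* (suc t ℕ.* 2)) n) (sym (ℕP.+-suc j i))))
      (Log-★ (Log-1-q^ (p ℕ.* (suc j ℕ.* 2)) (ℕ.s≤s ℕ.z≤n)) (Log-evens (suc j) d))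

    ψ : ℕ → ℤ
    ψ = ψ-upto (N ℕ.* 2)

    -- By `gauss`, ψ times the odd factors equals the even factors up to K, so logarithmic
    -- derivatives subtract. A factor 1 - q^(pk) contributes -pk, counted positively for even k and
    -- negatively for odd k, hence -ε(k) pk.
    Log-ψ : Log K ψ (Ψ N p (λ k b → - ε (res k) * + (p ℕ.* k)))
    Log-ψ = Log-cong (λ _ _ → refl) collect
        (Log-quotient {f = odds N} {g = ψ} (odds-0 N) (Log-odds N)
          (Log-cong (λ n r → gauss N n (ℕ.s≤s ℕ.z≤n) (ℕP.≤-<-trans r K<N)) (λ n _ → lem₀ (lE n) (lO n)) (Log-evens 0 N)))
      where
        lE lO : ℕ → ℤ
        lE n = ∑ N (λ i → - + (p ℕ.* (suc i ℕ.* 2)) * geo (p ℕ.* (suc i ℕ.* 2)) n)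
        lO n = ∑ N (λ i → - + (p ℕ.* suc (i ℕ.* 2)) * geo (p ℕ.* suc (i ℕ.* 2)) n)
        lem₀ : ∀ x y → x ≡ y + (x - y)
        lem₀ = ℤR.solve-∀
        odds-0 : ∀ m → odds m 0 ≡ + 1
        odds-0 zero = refl
        odds-0 (suc m) = cong (_* + 1) (odds-0 m)
        summand : ℕ → ℕ → ℤ
        summand n k = - ε (res k) * + (p ℕ.* k) * geo (p ℕ.* k) n
        ε-even : ∀ r → ε (r ⊠ # 2) ≡ + 1
        ε-even = by-cases
        ε-odd : ∀ r → ε (next (r ⊠ # 2)) ≡ - + 1
        ε-odd = by-cases
        interleave : ∀ n M → ∑ M (λ i → - + (p ℕ.* (suc i ℕ.* 2)) * geo (p ℕ.* (suc i ℕ.* 2)) n)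
            - ∑ M (λ i → - + (p ℕ.* suc (i ℕ.* 2)) * geo (p ℕ.* suc (i ℕ.* 2)) n) ≡ ∑₁ (M ℕ.* 2) (summand n)
        interleave n zero = refl
        interleave n (suc M) =
            cong₂ _-_ (∑-last M (λ i → - + (p ℕ.* (suc i ℕ.* 2)) * geo (p ℕ.* (suc i ℕ.* 2)) n)) (∑-last M (λ i → - + (p ℕ.* suc (i ℕ.* 2)) * geo (p ℕ.* suc (i ℕ.* 2)) n))
          ∙ lem (∑ M (λ i → - + (p ℕ.* (suc i ℕ.* 2)) * geo (p ℕ.* (suc i ℕ.* 2)) n)) (∑ M (λ i → - + (p ℕ.* suc (i ℕ.* 2)) * geo (p ℕ.* suc (i ℕ.* 2)) n))
              (+ (p ℕ.* (suc M ℕ.* 2))) (geo (p ℕ.* (suc M ℕ.* 2)) n) (+ (p ℕ.* suc (M ℕ.* 2))) (geo (p ℕ.* suc (M ℕ.* 2)) n)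
          ∙ cong₂ _+_ (cong₂ _+_ (interleave n M) (cong (λ t → - t * + (p ℕ.* suc (M ℕ.* 2)) * geo (p ℕ.* suc (M ℕ.* 2)) n) (sym (cong (λ t → ε (next t)) (res-* M 2) ∙ ε-odd (res M)))))
                      (cong (λ t → - t * + (p ℕ.* (suc M ℕ.* 2)) * geo (p ℕ.* (suc M ℕ.* 2)) n) (sym (cong ε (res-* (suc M) 2) ∙ ε-even (res (suc M)))))
          where lem : ∀ x y p g q h → x + - p * g - (y + - q * h) ≡ x - y + - - + 1 * q * h + - + 1 * p * g
                lem = ℤR.solve-∀
        collect : ∀ n → n ℕ.≤ K → lE n - lO n ≡ Ψ N p (λ k b → - ε (res k) * + (p ℕ.* k)) n
        collect n n≤K = interleave n N ∙ cong (λ t → ∑₁ t (summand n)) (double N)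
          ∙ ∑₁-extend N N (summand n) (λ k r → cong (- ε (res k) * + (p ℕ.* k) *_) (∑₁-zero N λ b → δ-> (ℕP.<-≤-trans (ℕP.≤-<-trans (ℕP.≤-trans n≤K K≤N) r)
              (ℕP.≤-trans (ℕP.m≤n*m k p) (ℕP.m≤m*n (p ℕ.* k) (suc b))))) ∙ ℤP.*-zeroʳ (- ε (res k) * + (p ℕ.* k)))
          ∙ (∑₁-cong N λ k → sym (∑₁-*ˡ N (- ε (res (suc k)) * + (p ℕ.* suc k)) (λ b → δ (p ℕ.* suc k ℕ.* b) n))
              ∙ ∑₁-cong N λ b → ℤP.*-comm (- ε (res (suc k)) * + (p ℕ.* suc k)) (δ (p ℕ.* suc k ℕ.* suc b) n)
                  ∙ cong (λ t → δ t n * (- ε (res (suc k)) * + (p ℕ.* suc k))) (ℕP.*-assoc p (suc k) (suc b)))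
          where double : ∀ N → N ℕ.* 2 ≡ N ℕ.+ N
                double = ℕR.solve-∀

Ψ-cong : ∀ N s n {u v : ℕ → ℕ → ℤ} → (∀ a b → u (suc a) (suc b) ≡ v (suc a) (suc b)) → Ψ N s u n ≡ Ψ N s v n
Ψ-cong N s n h = ∑₁²-cong N λ a b → cong (δ (s ℕ.* (suc a ℕ.* suc b)) n *_) (h a b)

Ψ-+ : ∀ N s n u v → Ψ N s (λ a b → u a b + v a b) n ≡ Ψ N s u n + Ψ N s v n
Ψ-+ N s n u v = (∑₁-cong N λ a → (∑₁-cong N λ b → ℤP.*-distribˡ-+ (δ (s ℕ.* (suc a ℕ.* suc b)) n) (u (suc a) (suc b)) (v (suc a) (suc b)))
    ∙ ∑₁-+ N (λ b → δ (s ℕ.* (suc a ℕ.* b)) n * u (suc a) b) (λ b → δ (s ℕ.* (suc a ℕ.* b)) n * v (suc a) b))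
  ∙ ∑₁-+ N (λ a → ∑₁ N λ b → δ (s ℕ.* (a ℕ.* b)) n * u a b) (λ a → ∑₁ N λ b → δ (s ℕ.* (a ℕ.* b)) n * v a b)

Ψ-*ˡ : ∀ N s n k u → Ψ N s (λ a b → k * u a b) n ≡ k * Ψ N s u n
Ψ-*ˡ N s n k u = (∑₁-cong N λ a → (∑₁-cong N λ b → lem (δ (s ℕ.* (suc a ℕ.* suc b)) n) k (u (suc a) (suc b)))
    ∙ ∑₁-*ˡ N k (λ b → δ (s ℕ.* (suc a ℕ.* b)) n * u (suc a) b))
  ∙ ∑₁-*ˡ N k (λ a → ∑₁ N λ b → δ (s ℕ.* (a ℕ.* b)) n * u a b)
  where lem : ∀ x y z → x * (y * z) ≡ y * (x * z)
        lem = ℤR.solve-∀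

Ψ-transpose : ∀ N s n u → Ψ N s u n ≡ Ψ N s (λ a b → u b a) n
Ψ-transpose N s n u = ∑₁-swap N N (λ a b → δ (s ℕ.* (a ℕ.* b)) n * u a b)
  ∙ ∑₁²-cong N λ b a → cong (λ t → δ (s ℕ.* t) n * u (suc a) (suc b)) (ℕP.*-comm (suc a) (suc b))

module _ (N s n : ℕ) (n≤N : n ℕ.≤ N) (u : ℕ → ℕ → ℤ) where

  private
    row : ℕ → ℤ
    row a = ∑₁ N λ b → δ (suc s ℕ.* (a ℕ.* b)) n * u a b

    row-high : ∀ i → N ℕ.< i → row i ≡ + 0
    row-high i p = ∑₁-zero N λ b → cong (_* u i (suc b))
      (δ-> (ℕP.≤-<-trans n≤N (ℕP.<-≤-trans p (ℕP.≤-trans (ℕP.m≤m*n i (suc b)) (ℕP.m≤n*m (i ℕ.* suc b) (suc s))))))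

    pull : (h : ℤ₆ → ℤ) → Ψ N (suc s) (λ a b → h (res a) * u a b) n ≡ ∑₁ N (λ a → h (res a) * row a)
    pull h = ∑₁-cong N λ a → (∑₁-cong N λ b → lem (δ (suc s ℕ.* (suc a ℕ.* suc b)) n) (h (res (suc a))) (u (suc a) (suc b)))
        ∙ ∑₁-*ˡ N (h (res (suc a))) (λ b → δ (suc s ℕ.* (suc a ℕ.* b)) n * u (suc a) b)
      where lem : ∀ x y z → x * (y * z) ≡ y * (x * z)
            lem = ℤR.solve-∀

    rescale : ∀ s a b k → s ℕ.* (a ℕ.* k ℕ.* b) ≡ s ℕ.* k ℕ.* (a ℕ.* b)
    rescale = ℕR.solve-∀

  Ψ-even : Ψ N (suc s) (λ a b → even (res a) * u a b) n ≡ Ψ N (suc s ℕ.* 2) (λ a b → u (a ℕ.* 2) b) n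
  Ψ-even = pull even ∙ ∑₁-even N row row-high
    ∙ ∑₁²-cong N λ a b → cong (λ t → δ t n * u (suc a ℕ.* 2) (suc b)) (rescale (suc s) (suc a) (suc b) 2)

  Ψ-3∣ : Ψ N (suc s) (λ a b → 3∣ (res a) * u a b) n ≡ Ψ N (suc s ℕ.* 3) (λ a b → u (a ℕ.* 3) b) n
  Ψ-3∣ = pull 3∣ ∙ ∑₁-3∣ N row row-high
    ∙ ∑₁²-cong N λ a b → cong (λ t → δ t n * u (suc a ℕ.* 3) (suc b)) (rescale (suc s) (suc a) (suc b) 3)

∑∣-1 : ∀ N u → ∑∣ (suc N) 1 u ≡ u 1 1
∑∣-1 N u = (∑₁-cong (suc N) λ a → (∑₁-cong (suc N) λ b → split a b (u (suc a) (suc b)))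
      ∙ ∑₁-*ˡ (suc N) (δ 1 (suc a)) (λ b → δ 1 b * u (suc a) b))
  ∙ ∑₁-δ (suc N) 0 (λ a → ∑₁ (suc N) λ b → δ 1 b * u a b) (ℕ.s≤s ℕ.z≤n)
  ∙ ∑₁-δ (suc N) 0 (u 1) (ℕ.s≤s ℕ.z≤n)
  where
    split : ∀ a b x → δ (suc a ℕ.* suc b) 1 * x ≡ δ 1 (suc a) * (δ 1 (suc b) * x)
    split zero zero x = lem x
      where lem : ∀ x → + 1 * x ≡ + 1 * (+ 1 * x)
            lem = ℤR.solve-∀
    split zero (suc b) x = refl
    split (suc a) zero x = refl
    split (suc a) (suc b) x = refl

-- G as a product of theta series, and the series Φ

module Theta (N K : ℕ) (K<N : K ℕ.< N) where
  open Logs N K K<N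

  private
    K≤N : K ℕ.≤ N
    K≤N = ℕP.<⇒≤ K<N

  -- G(q^s) divided by its leading monomial q^s; the constant term is then 1.
  Γ : ℕ → ℕ → ℤ
  Γ s n = Ψ N s χ-odd (s ℕ.+ n)

  Γ-★ : ∀ s n l → (Ψ N s χ-odd ★ l) (s ℕ.+ n) ≡ (Γ s ★ l) n
  Γ-★ s n l = ★-shift s n (Ψ N s χ-odd) l (λ i p → Ψ-low N s i χ-odd p)

  -- In degree s + n = s (i + 1) this is s times `derivation-any` at i + 1, where s ((i + 1) - 1) =
  -- n. In all other degrees both sides vanish.
  Log-Γ : ∀ s → Log K (Γ (suc s)) ((+ 2 * + suc s) · Ψ N (suc s) w-even)
  Log-Γ s n n≤K = core (multiple? (suc s) (suc s ℕ.+ n))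
      ∙ cong (+ 2 * + suc s *_) (Γ-★ (suc s) n (Ψ N (suc s) w-even))
      ∙ sym (★-scaleʳ n (+ 2 * + suc s) (Γ (suc s)) (Ψ N (suc s) w-even))
    where
      core : ((∃ λ j → suc s ℕ.+ n ≡ suc s ℕ.* j) ⊎ (∀ x → δ (suc s ℕ.* x) (suc s ℕ.+ n) ≡ + 0)) →
        + n * Γ (suc s) n ≡ + 2 * + suc s * (Ψ N (suc s) χ-odd ★ Ψ N (suc s) w-even) (suc s ℕ.+ n)
      core (inj₂ h) = cong (+ n *_) (Ψ-nonmultiple N (suc s) (suc s ℕ.+ n) χ-odd h) ∙ ℤP.*-zeroʳ (+ n)
        ∙ sym (cong (+ 2 * + suc s *_) (Ψ-★-nonmultiple N (suc s) (suc s ℕ.+ n) χ-odd w-even h) ∙ ℤP.*-zeroʳ (+ 2 * + suc s))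
      core (inj₁ (zero , eq)) = ⊥-elim (ℕP.1+n≢0 (eq ∙ ℕP.*-zeroʳ (suc s)))
      core (inj₁ (suc i , eq)) =
          cong₂ _*_ (cong +_ n≡ ∙ ℤP.pos-* (suc s) i) (cong (Ψ N (suc s) χ-odd) eq ∙ Ψ-multiple N s (suc i) χ-odd)
        ∙ lem (+ suc s) (+ i) (∑∣ N (suc i) χ-odd)
        ∙ cong (+ suc s *_) (derivation-any N (suc i) (ℕP.≤-<-trans (ℕP.≤-trans (ℕP.m≤n*m i (suc s)) (ℕP.≤-trans (ℕP.≤-reflexive (sym n≡)) n≤K)) K<N))
        ∙ lem₂ (+ suc s) (conv N (suc i) w-even χ-odd)
        ∙ cong (+ 2 * + suc s *_) (conv-exchange N (suc i) w-even χ-odd ∙ sym (Ψ-★-multiple N s (suc i) χ-odd w-even)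
            ∙ cong (Ψ N (suc s) χ-odd ★ Ψ N (suc s) w-even) (sym eq))
        where n≡ : n ≡ suc s ℕ.* i
              n≡ = ℕP.+-cancelˡ-≡ (suc s) n (suc s ℕ.* i) (eq ∙ ℕP.*-suc (suc s) i)
              lem : ∀ s i x → s * i * x ≡ s * ((+ 1 + i - + 1) * x)
              lem = ℤR.solve-∀
              lem₂ : ∀ s x → s * (+ 2 * x) ≡ + 2 * s * x
              lem₂ = ℤR.solve-∀

  -- The weight 1 + [3 divides k] reflects the two theta factors: the multiples k = 3k′ form the
  -- logarithmic derivative at three times the scale, and the sign (-1)^k agrees with (-1)^k′.
  w-even-split : ∀ s n → n ℕ.≤ N →
    Ψ N (suc s ℕ.* 2) (λ k b → - ε (res k) * + (suc s ℕ.* 2 ℕ.* k)) n + Ψ N (suc s ℕ.* 3 ℕ.* 2) (λ k b → - ε (res k) * + (suc s ℕ.* 3 ℕ.* 2 ℕ.* k)) n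
    ≡ + 2 * + suc s * Ψ N (suc s) w-even n
  w-even-split s n n≤N = sym (
      cong (+ 2 * + suc s *_) (Ψ-transpose N (suc s) n w-even ∙ Ψ-even N s n n≤N (λ b a → - ε (res a) * ((+ 1 + 3∣ (res a)) * + a)) ∙ Ψ-transpose N (suc s ℕ.* 2) n (λ b a → - ε (res a) * ((+ 1 + 3∣ (res a)) * + a)))
    ∙ sym (Ψ-*ˡ N (suc s ℕ.* 2) n (+ 2 * + suc s) (λ a b → - ε (res a) * ((+ 1 + 3∣ (res a)) * + a)))
    ∙ Ψ-cong N (suc s ℕ.* 2) n (λ a b → lem (+ suc s) (- ε (res (suc a))) (3∣ (res (suc a))) (+ suc a) ∙ cong (λ t → - ε (res (suc a)) * t + 3∣ (res (suc a)) * (- ε (res (suc a)) * t)) (scale (suc a)))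
    ∙ Ψ-+ N (suc s ℕ.* 2) n (λ k b → - ε (res k) * + (suc s ℕ.* 2 ℕ.* k)) (λ k b → 3∣ (res k) * (- ε (res k) * + (suc s ℕ.* 2 ℕ.* k)))
    ∙ cong (_+_ (Ψ N (suc s ℕ.* 2) (λ k b → - ε (res k) * + (suc s ℕ.* 2 ℕ.* k)) n))
        (Ψ-3∣ N (suc (s ℕ.* 2)) n n≤N (λ k b → - ε (res k) * + (suc s ℕ.* 2 ℕ.* k))
          ∙ Ψ-cong N (suc s ℕ.* 2 ℕ.* 3) n (λ k b → cong₂ (λ x y → - x * + y) (cong ε (res-* (suc k) 3) ∙ triple (res (suc k))) (lem₃ (suc s) (suc k)))
          ∙ cong (λ t → Ψ N t (λ k b → - ε (res k) * + (suc s ℕ.* 3 ℕ.* 2 ℕ.* k)) n) (lem₄ (suc s))))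
    where
      lem : ∀ s e f a → + 2 * s * (e * ((+ 1 + f) * a)) ≡ e * (s * + 2 * a) + f * (e * (s * + 2 * a))
      lem = ℤR.solve-∀
      scale : ∀ a → + suc s * + 2 * + a ≡ + (suc s ℕ.* 2 ℕ.* a)
      scale a = cong (_* + a) (sym (ℤP.pos-* (suc s) 2)) ∙ sym (ℤP.pos-* (suc s ℕ.* 2) a)
      triple : ∀ r → ε (r ⊠ # 3) ≡ ε r
      triple = by-cases
      lem₃ : ∀ s k → s ℕ.* 2 ℕ.* (k ℕ.* 3) ≡ s ℕ.* 3 ℕ.* 2 ℕ.* k
      lem₃ = ℕR.solve-∀
      lem₄ : ∀ s → s ℕ.* 2 ℕ.* 3 ≡ s ℕ.* 3 ℕ.* 2
      lem₄ = ℕR.solve-∀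

  Γ-0 : ∀ s → Γ (suc s) 0 ≡ + 1
  Γ-0 s = cong (Ψ N (suc s) χ-odd) (ℕP.+-identityʳ (suc s) ∙ sym (ℕP.*-identityʳ (suc s))) ∙ Ψ-multiple N s 1 χ-odd ∙ one N K<N
    where
      one : ∀ N → K ℕ.< N → ∑∣ N 1 χ-odd ≡ + 1
      one (suc N) _ = ∑∣-1 N χ-odd

  -- Both sides have the same logarithmic derivative and constant term. Since `ψ` takes the
  -- predecessor of a scale, 2 + 3s stands for the scale 3 (s + 1).
  Γ-ψ : ∀ s n → n ℕ.≤ K → Γ (suc s) n ≡ (ψ s ★ ψ (2 ℕ.+ s ℕ.* 3)) n
  Γ-ψ s = Log-unique {f = Γ (suc s)} {g = ψ s ★ ψ (2 ℕ.+ s ℕ.* 3)}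
      (cong (+ 2 * + suc s *_) (Ψ-low N (suc s) 0 w-even (ℕ.s≤s ℕ.z≤n)) ∙ ℤP.*-zeroʳ (+ 2 * + suc s))
      (Log-Γ s)
      (Log-cong (λ _ _ → refl) (λ n r → w-even-split s n (ℕP.≤-trans r K≤N)) (Log-★ (Log-ψ s) (Log-ψ (2 ℕ.+ s ℕ.* 3))))
      (Γ-0 s ∙ sym (cong₂ _*_ (ψ-0 N s K<N) (ψ-0 N (2 ℕ.+ s ℕ.* 3) K<N)))
    where
      ψ-0 : ∀ N s → K ℕ.< N → Gauss.ψ-upto (suc s) (N ℕ.* 2) 0 ≡ + 1
      ψ-0 (suc N) s _ rewrite ℕP.*-zeroʳ s = cong (_+_ (+ 1)) (∑-zero (suc (N ℕ.* 2)) (λ i _ → refl))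

  Φ : ℕ → ℕ → ℤ
  Φ s = δ 0 ⊕ₛ (- + 2 · Ψ N s χ-sign)

  Log-Φ : ∀ s → Log K (Φ (suc s)) ((- + 2 * + suc s) · Ψ N (suc s) w-odd)
  Log-Φ s n n≤K =
      ℤP.*-distribˡ-+ (+ n) (δ 0 n) (- + 2 * X) ∙ cong (_+ + n * (- + 2 * X))
        (ℤP.*-comm (+ n) (δ 0 n) ∙ δ-guard 0 n {x = + n} {y = + 0} (λ { refl → refl }) ∙ ℤP.*-zeroʳ (δ 0 n))
    ∙ lem₀ (+ n) X
    ∙ core (multiple? (suc s) n)
    ∙ lem₁ (+ suc s) W C
    ∙ cong (- + 2 * + suc s *_) (sym (★-distribʳ n (δ 0) (- + 2 · Ψ N (suc s) χ-sign) (Ψ N (suc s) w-odd)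
        ∙ cong₂ _+_ (δ-★-0 n (Ψ N (suc s) w-odd)) (★-scaleˡ n (- + 2) (Ψ N (suc s) χ-sign) (Ψ N (suc s) w-odd))))
    ∙ sym (★-scaleʳ n (- + 2 * + suc s) (Φ (suc s)) (Ψ N (suc s) w-odd))
    where
      X W C : ℤ
      X = Ψ N (suc s) χ-sign n
      W = Ψ N (suc s) w-odd n
      C = (Ψ N (suc s) χ-sign ★ Ψ N (suc s) w-odd) n
      lem₀ : ∀ n x → + 0 + n * (- + 2 * x) ≡ - (+ 2 * n * x)
      lem₀ = ℤR.solve-∀
      lem₁ : ∀ s w c → s * (+ 4 * c - + 2 * w) ≡ - + 2 * s * (w + - + 2 * c)
      lem₁ = ℤR.solve-∀
      core : ((∃ λ j → n ≡ suc s ℕ.* j) ⊎ (∀ x → δ (suc s ℕ.* x) n ≡ + 0)) → - (+ 2 * + n * X) ≡ + suc s * (+ 4 * C - + 2 * W)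
      core (inj₂ h) = cong (λ t → - (+ 2 * + n * t)) (Ψ-nonmultiple N (suc s) n χ-sign h)
        ∙ lem (+ n) (+ suc s)
        ∙ sym (cong₂ (λ x y → + suc s * (+ 4 * x - + 2 * y)) (Ψ-★-nonmultiple N (suc s) n χ-sign w-odd h) (Ψ-nonmultiple N (suc s) n w-odd h))
        where lem : ∀ n s → - (+ 2 * n * + 0) ≡ s * (+ 4 * + 0 - + 2 * + 0)
              lem = ℤR.solve-∀
      core (inj₁ (j , eq)) =
          cong₂ (λ x y → - (+ 2 * x * y)) (cong +_ eq ∙ ℤP.pos-* (suc s) j) (cong (Ψ N (suc s) χ-sign) eq ∙ Ψ-multiple N s j χ-sign)
        ∙ lem (+ suc s) (+ j) (∑∣ N j χ-sign) (∑∣ N j w-odd)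
        ∙ cong (λ t → + suc s * (t - + 2 * ∑∣ N j w-odd))
            (sym (derivation′ N j (ℕP.≤-trans (ℕP.m≤n*m j (suc s)) (ℕP.≤-trans (ℕP.≤-reflexive (sym eq)) (ℕP.≤-trans n≤K K≤N)))))
        ∙ cong₂ (λ x y → + suc s * (+ 4 * x - + 2 * y))
            (conv-exchange N j w-odd χ-sign ∙ sym (Ψ-★-multiple N s j χ-sign w-odd) ∙ cong (Ψ N (suc s) χ-sign ★ Ψ N (suc s) w-odd) (sym eq))
            (sym (cong (Ψ N (suc s) w-odd) eq ∙ Ψ-multiple N s j w-odd))
        where lem : ∀ s j x w → - (+ 2 * (s * j) * x) ≡ s * (+ 2 * w - + 2 * j * x - + 2 * w)
              lem = ℤR.solve-∀

  -- Halving both even factors gives -∑ χ(a) q^(4ab), because χ(2) = -1. The parts of that series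
  -- with even a and with even b are negatives of each other for the same reason, so of the table
  -- `signs` only the Φ and G terms remain.
  χ-even-Φ : ∀ n → n ℕ.≤ N → (δ 0 ⊕ₛ (- + 6 · Ψ N 1 χ-even)) n ≡ Φ 4 n + + 8 * Ψ N 4 χ-odd n
  χ-even-Φ n n≤N =
      cong (λ t → δ 0 n + - + 6 * t) quarter
    ∙ lem (δ 0 n) (Ψ N 4 χ₁ n) (Ψ N 4 χ-sign n) (Ψ N 4 χ-odd n) balance
    where
      χ₁ : ℕ → ℕ → ℤ
      χ₁ a b = χ (res a)
      double : ∀ r → χ (r ⊠ # 2) ≡ - χ r
      double = by-cases
      quarter : Ψ N 1 χ-even n ≡ - + 1 * Ψ N 4 χ₁ n
      quarter = Ψ-cong N 1 n (λ a b → ℤP.*-assoc (even (res (suc a))) (even (res (suc b))) (χ (res (suc a))))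
        ∙ Ψ-even N 0 n n≤N (λ a b → even (res b) * χ (res a))
        ∙ Ψ-transpose N 2 n (λ a b → even (res b) * χ (res (a ℕ.* 2)))
        ∙ Ψ-even N 1 n n≤N (λ b a → χ (res (a ℕ.* 2)))
        ∙ Ψ-transpose N 4 n (λ b a → χ (res (a ℕ.* 2)))
        ∙ Ψ-cong N 4 n (λ a b → cong χ (res-* (suc a) 2) ∙ double (res (suc a)) ∙ lem₁ (χ (res (suc a))))
        ∙ Ψ-*ˡ N 4 n (- + 1) χ₁
        where lem₁ : ∀ x → - x ≡ - + 1 * x
              lem₁ = ℤR.solve-∀
      evens-cancel : Ψ N 4 (λ a b → even (res a) * χ (res a)) n + Ψ N 4 (λ a b → even (res b) * χ (res a)) n ≡ + 0
      evens-cancel = cong₂ _+_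
          (Ψ-even N 3 n n≤N χ₁ ∙ Ψ-cong N 8 n (λ a b → cong χ (res-* (suc a) 2) ∙ double (res (suc a)) ∙ lem₁ (χ (res (suc a)))) ∙ Ψ-*ˡ N 8 n (- + 1) χ₁)
          (Ψ-transpose N 4 n (λ a b → even (res b) * χ (res a)) ∙ Ψ-even N 3 n n≤N (λ b a → χ (res a)) ∙ Ψ-transpose N 8 n (λ b a → χ (res a)))
        ∙ lem₂ (Ψ N 8 χ₁ n)
        where lem₁ : ∀ x → - x ≡ - + 1 * x
              lem₁ = ℤR.solve-∀
              lem₂ : ∀ x → - + 1 * x + x ≡ + 0
              lem₂ = ℤR.solve-∀
      signs : ∀ r s → + 6 * χ r ≡ + 4 * (even r * χ r + even s * χ r) + - + 2 * (ε r * ε s * χ r) + + 8 * (odd r * odd s * χ r)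
      signs = by-cases₂
      balance : + 6 * Ψ N 4 χ₁ n ≡ - + 2 * Ψ N 4 χ-sign n + + 8 * Ψ N 4 χ-odd n
      balance = sym (Ψ-*ˡ N 4 n (+ 6) χ₁)
        ∙ Ψ-cong N 4 n (λ a b → signs (res (suc a)) (res (suc b)))
        ∙ Ψ-+ N 4 n (λ a b → + 4 * (even (res a) * χ (res a) + even (res b) * χ (res a)) + - + 2 * χ-sign a b) (λ a b → + 8 * χ-odd a b)
        ∙ cong₂ _+_ (Ψ-+ N 4 n (λ a b → + 4 * (even (res a) * χ (res a) + even (res b) * χ (res a))) (λ a b → - + 2 * χ-sign a b)
            ∙ cong₂ _+_ (Ψ-*ˡ N 4 n (+ 4) (λ a b → even (res a) * χ (res a) + even (res b) * χ (res a))
                ∙ cong (+ 4 *_) (Ψ-+ N 4 n (λ a b → even (res a) * χ (res a)) (λ a b → even (res b) * χ (res a)) ∙ evens-cancel)) (Ψ-*ˡ N 4 n (- + 2) χ-sign))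
            (Ψ-*ˡ N 4 n (+ 8) χ-odd)
        ∙ cong (_+ + 8 * Ψ N 4 χ-odd n) (ℤP.+-identityˡ (- + 2 * Ψ N 4 χ-sign n))
      lem : ∀ d x y z → + 6 * x ≡ - + 2 * y + + 8 * z → d + - + 6 * (- + 1 * x) ≡ d + - + 2 * y + + 8 * z
      lem d x y z h = l₁ d x ∙ cong (_+_ d) h ∙ l₂ d y z
        where l₁ : ∀ d x → d + - + 6 * (- + 1 * x) ≡ d + + 6 * x
              l₁ = ℤR.solve-∀
              l₂ : ∀ d y z → d + (- + 2 * y + + 8 * z) ≡ d + - + 2 * y + + 8 * z
              l₂ = ℤR.solve-∀

-- The truncated product of polynomials and its twist

coeff-⊕ : ∀ p q n → coeff (p ⊕ q) n ≡ coeff p n + coeff q n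
coeff-⊕ [] q n = sym (ℤP.+-identityˡ _)
coeff-⊕ (x ∷ p) [] n = sym (ℤP.+-identityʳ _)
coeff-⊕ (x ∷ p) (y ∷ q) zero = refl
coeff-⊕ (x ∷ p) (y ∷ q) (suc n) = coeff-⊕ p q n

coeff-map : ∀ k p n → coeff (map (k *_) p) n ≡ k * coeff p n
coeff-map k [] n = sym (ℤP.*-zeroʳ k)
coeff-map k (x ∷ p) zero = refl
coeff-map k (x ∷ p) (suc n) = coeff-map k p n

coeff-⊗ : ∀ p q n → coeff (p ⊗ q) n ≡ (coeff p ★ coeff q) n
coeff-⊗ [] q n = sym (★-cong n (λ _ → refl) (λ _ → refl) ∙ ★-zeroˡ n (coeff q))
coeff-⊗ (x ∷ p) q zero = coeff-⊕ (map (x *_) q) (+ 0 ∷ (p ⊗ q)) 0 ∙ drop-zero (coeff-map x q 0) refl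
coeff-⊗ (x ∷ p) q (suc n) = coeff-⊕ (map (x *_) q) (+ 0 ∷ (p ⊗ q)) (suc n) ∙ cong₂ _+_ (coeff-map x q (suc n)) (coeff-⊗ p q n)

coeff-oneMinusQ : ∀ j n → coeff (oneMinusQ j) n ≡ 1-q^ j n
coeff-oneMinusQ j n = coeff-⊕ (+ 1 ∷ []) (replicate j (+ 0) ++ (- + 1 ∷ [])) n ∙ cong₂ _+_ (one n) (monomial j n)
  where
    one : ∀ n → coeff (+ 1 ∷ []) n ≡ δ 0 n
    one zero = refl
    one (suc n) = refl
    monomial : ∀ j n → coeff (replicate j (+ 0) ++ (- + 1 ∷ [])) n ≡ - δ j n
    monomial zero zero = refl
    monomial zero (suc n) = refl
    monomial (suc j) zero = refl
    monomial (suc j) (suc n) = monomial j n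

-- On a series f(q²), multiplication by sg is the substitution q² ↦ -q².
sg : ℕ → ℤ
sg zero = + 1
sg (suc zero) = + 0
sg (suc (suc n)) = - sg n

twist : (ℕ → ℤ) → ℕ → ℤ
twist f n = sg n * f n

half : ∀ n → ∃ λ k → n ≡ k ℕ.* 2 ⊎ n ≡ suc (k ℕ.* 2)
half zero = 0 , inj₁ refl
half (suc n) with half n
... | k , inj₁ p = k , inj₂ (cong suc p)
... | k , inj₂ p = suc k , inj₁ (cong suc p)

sg-+-even : ∀ m k → sg (m ℕ.+ k ℕ.* 2) ≡ sg m * sg (k ℕ.* 2)
sg-+-even m zero = cong sg (ℕP.+-identityʳ m) ∙ sym (ℤP.*-identityʳ (sg m))
sg-+-even m (suc k) = cong sg (ℕP.+-suc m (suc (k ℕ.* 2)) ∙ cong suc (ℕP.+-suc m (k ℕ.* 2))) ∙ cong -_ (sg-+-even m k)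
  ∙ ℤP.neg-distribʳ-* (sg m) (sg (k ℕ.* 2))

sg-ε : ∀ k → sg (k ℕ.* 2) ≡ ε (res k)
sg-ε zero = refl
sg-ε (suc k) = cong -_ (sg-ε k) ∙ sym (flip (res k))
  where flip : ∀ r → ε (next r) ≡ - ε r
        flip = by-cases

-- As l lives in even degrees, sg(i + 2k) = sg(i) sg(2k) pulls the sign out of the product for every
-- i. The offset m records the coefficients of f already peeled off.
twist-★ : ∀ m n f l → (∀ k → l (suc (k ℕ.* 2)) ≡ + 0) → ((λ i → sg (m ℕ.+ i) * f i) ★ twist l) n ≡ sg (m ℕ.+ n) * (f ★ l) n
twist-★ m zero f l h = lem (sg (m ℕ.+ 0)) (f 0) (l 0)
  where lem : ∀ s x y → s * x * (+ 1 * y) ≡ s * (x * y)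
        lem = ℤR.solve-∀
twist-★ m (suc n) f l h = cong₂ _+_ (head (half (suc n)))
      (★-cong n (λ i → cong (λ t → sg t * f (suc i)) (ℕP.+-suc m i)) (λ _ → refl) ∙ twist-★ (suc m) n (λ i → f (suc i)) l h
        ∙ cong (λ t → sg t * ((λ i → f (suc i)) ★ l) n) (sym (ℕP.+-suc m n)))
  ∙ sym (ℤP.*-distribˡ-+ (sg (m ℕ.+ suc n)) (f 0 * l (suc n)) (((λ i → f (suc i)) ★ l) n))
  where
    head : (∃ λ k → suc n ≡ k ℕ.* 2 ⊎ suc n ≡ suc (k ℕ.* 2)) → sg (m ℕ.+ 0) * f 0 * (sg (suc n) * l (suc n)) ≡ sg (m ℕ.+ suc n) * (f 0 * l (suc n))
    head (k , inj₂ p) = cong (λ t → sg (m ℕ.+ 0) * f 0 * (sg (suc n) * t)) (cong l p ∙ h k) ∙ lem (sg (m ℕ.+ 0)) (f 0) (sg (suc n)) (sg (m ℕ.+ suc n))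
        ∙ sym (cong (λ t → sg (m ℕ.+ suc n) * (f 0 * t)) (cong l p ∙ h k))
      where lem : ∀ s x y z → s * x * (y * + 0) ≡ z * (x * + 0)
            lem = ℤR.solve-∀
    head (k , inj₁ p) = cong (λ t → sg t * f 0 * (sg (suc n) * l (suc n))) (ℕP.+-identityʳ m) ∙ lem (sg m) (f 0) (sg (suc n)) (l (suc n))
        ∙ cong (_* (f 0 * l (suc n))) (cong (sg m *_) (cong sg p) ∙ sym (sg-+-even m k) ∙ cong (λ t → sg (m ℕ.+ t)) (sym p))
      where lem : ∀ s x y z → s * x * (y * z) ≡ s * y * (x * z)
            lem = ℤR.solve-∀

Log-twist : ∀ {K f l} → (∀ k → l (suc (k ℕ.* 2)) ≡ + 0) → Log K f l → Log K (twist f) (twist l)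
Log-twist {K} {f} {l} h p n n≤K = lem (+ n) (sg n) (f n) ∙ cong (sg n *_) (p n n≤K) ∙ sym (twist-★ 0 n f l h)
  where lem : ∀ n s x → n * (s * x) ≡ s * (n * x)
        lem = ℤR.solve-∀

weight : ℕ → ℕ → ℤ
weight a b = (+ 1 + 3∣ (res a)) * + a

Ψ-combination : ∀ N s n α β γ u v w →
  α * Ψ N s u n + β * Ψ N s v n + γ * Ψ N s w n ≡ Ψ N s (λ a b → α * u a b + β * v a b + γ * w a b) n
Ψ-combination N s n α β γ u v w = sym (Ψ-+ N s n (λ a b → α * u a b + β * v a b) (λ a b → γ * w a b)
  ∙ cong₂ _+_ (Ψ-+ N s n (λ a b → α * u a b) (λ a b → β * v a b) ∙ cong₂ _+_ (Ψ-*ˡ N s n α u) (Ψ-*ˡ N s n β v)) (Ψ-*ˡ N s n γ w))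

module Product (N K : ℕ) (K<N : K ℕ.< N) where
  open Logs N K K<N
  open Theta N K K<N

  private
    K≤N : K ℕ.≤ N
    K≤N = ℕP.<⇒≤ K<N

  factor-log : ℕ → ℕ → ℤ
  factor-log k = (- + (2 ℕ.* k)) · geo (2 ℕ.* k) ⊕ₛ (- + (4 ℕ.* k)) · geo (4 ℕ.* k) ⊕ₛ (- + (6 ℕ.* k)) · geo (6 ℕ.* k) ⊕ₛ (- + (12 ℕ.* k)) · geo (12 ℕ.* k)

  Log-oneMinusQ : ∀ j → 1 ℕ.≤ j → Log K (coeff (oneMinusQ j)) ((- + j) · geo j)
  Log-oneMinusQ j r = Log-cong (λ n _ → sym (coeff-oneMinusQ j n)) (λ _ _ → refl) (Log-1-q^ j r)

  Log-⊗ : ∀ p q {l m} → Log K (coeff p) l → Log K (coeff q) m → Log K (coeff (p ⊗ q)) (l ⊕ₛ m)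
  Log-⊗ p q x y = Log-cong (λ n _ → sym (coeff-⊗ p q n)) (λ _ _ → refl) (Log-★ x y)

  Log-prodUpTo : ∀ m → Log K (coeff (prodUpTo m)) (λ n → ∑₁ m (λ k → factor-log k n))
  Log-prodUpTo zero = Log-cong (λ { zero _ → refl ; (suc n) _ → refl }) (λ _ _ → refl) Log-1
  Log-prodUpTo (suc m) = Log-⊗ (prodUpTo m) (factor (suc m)) (Log-prodUpTo m)
    (Log-⊗ (o 2 ⊗ o 4 ⊗ o 6) (o 12) (Log-⊗ (o 2 ⊗ o 4) (o 6) (Log-⊗ (o 2) (o 4) (L 2 (ℕ.s≤s ℕ.z≤n)) (L 4 (ℕ.s≤s ℕ.z≤n))) (L 6 (ℕ.s≤s ℕ.z≤n))) (L 12 (ℕ.s≤s ℕ.z≤n)))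
    where
      o : ℕ → List ℤ
      o r = oneMinusQ (r ℕ.* suc m)
      L : ∀ r → 1 ℕ.≤ r → Log K (coeff (o r)) ((- + (r ℕ.* suc m)) · geo (r ℕ.* suc m))
      L r 1≤r = Log-oneMinusQ (r ℕ.* suc m) (ℕP.≤-trans 1≤r (ℕP.m≤m*n r (suc m)))

  -- Factors at scales 6 and 12 are the multiples of 3 at scales 2 and 4; together they produce the
  -- weight 1 + [3 divides a].
  product-log : ℕ → ℤ
  product-log n = - + 2 * Ψ N 2 weight n + - + 4 * Ψ N 4 weight n

  product-log≡ : ∀ n → n ℕ.≤ N → ∑₁ N (λ k → factor-log k n) ≡ product-log n
  product-log≡ n n≤N =
      ∑₁-+ N (λ k → - + (2 ℕ.* k) * geo (2 ℕ.* k) n + - + (4 ℕ.* k) * geo (4 ℕ.* k) n + - + (6 ℕ.* k) * geo (6 ℕ.* k) n) (λ k → - + (12 ℕ.* k) * geo (12 ℕ.* k) n)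
    ∙ cong₂ _+_ (∑₁-+ N (λ k → - + (2 ℕ.* k) * geo (2 ℕ.* k) n + - + (4 ℕ.* k) * geo (4 ℕ.* k) n) (λ k → - + (6 ℕ.* k) * geo (6 ℕ.* k) n)
        ∙ cong₂ _+_ (∑₁-+ N (λ k → - + (2 ℕ.* k) * geo (2 ℕ.* k) n) (λ k → - + (4 ℕ.* k) * geo (4 ℕ.* k) n) ∙ cong₂ _+_ (one 2) (one 4)) (three 1)) (three 3)
    ∙ lem (Ψ N 2 ι n) (Ψ N 4 ι n) (Ψ N 2 ι₃ n) (Ψ N 4 ι₃ n)
    ∙ sym (cong₂ (λ x y → - + 2 * x + - + 4 * y) (pieces 2) (pieces 4))
    where
      ι ι₃ : ℕ → ℕ → ℤ
      ι a b = + a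
      ι₃ a b = 3∣ (res a) * + a
      lem : ∀ x y z w → - + 2 * x + - + 4 * y + - + 2 * z + - + 4 * w ≡ - + 2 * (x + z) + - + 4 * (y + w)
      lem = ℤR.solve-∀
      pieces : ∀ s → Ψ N s weight n ≡ Ψ N s ι n + Ψ N s ι₃ n
      pieces s = Ψ-cong N s n (λ a b → lem₁ (3∣ (res (suc a))) (+ suc a)) ∙ Ψ-+ N s n ι ι₃
        where lem₁ : ∀ f a → (+ 1 + f) * a ≡ a + f * a
              lem₁ = ℤR.solve-∀
      one : ∀ s → ∑₁ N (λ k → - + (s ℕ.* k) * geo (s ℕ.* k) n) ≡ - + s * Ψ N s ι n
      one s = (∑₁-cong N λ k → sym (∑₁-*ˡ N (- + (s ℕ.* suc k)) (λ b → δ (s ℕ.* suc k ℕ.* b) n))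
            ∙ ∑₁-cong N λ b → cong₂ (λ x y → - x * δ y n) (ℤP.pos-* s (suc k)) (ℕP.*-assoc s (suc k) (suc b)) ∙ lem₁ (+ s) (+ suc k) (δ (s ℕ.* (suc k ℕ.* suc b)) n))
        ∙ Ψ-*ˡ N s n (- + s) ι
        where lem₁ : ∀ s k x → - (s * k) * x ≡ x * (- s * k)
              lem₁ = ℤR.solve-∀
      three : ∀ s → ∑₁ N (λ k → - + (suc s ℕ.* 3 ℕ.* k) * geo (suc s ℕ.* 3 ℕ.* k) n) ≡ - + suc s * Ψ N (suc s) ι₃ n
      three s = one (suc s ℕ.* 3) ∙ sym (cong (- + suc s *_) (Ψ-3∣ N s n n≤N ι ∙ Ψ-cong N (suc s ℕ.* 3) n (λ a b → ℤP.pos-* (suc a) 3 ∙ ℤP.*-comm (+ suc a) (+ 3)) ∙ Ψ-*ˡ N (suc s ℕ.* 3) n (+ 3) ι)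
        ∙ sym (ℤP.*-assoc (- + suc s) (+ 3) (Ψ N (suc s ℕ.* 3) ι n)) ∙ cong (_* Ψ N (suc s ℕ.* 3) ι n) (sym (ℤP.neg-distribˡ-* (+ suc s) (+ 3)) ∙ cong -_ (sym (ℤP.pos-* (suc s) 3))))

  -- In degree n = 2k the twist is (-1)^k. On k = ab it is a table in the residues of a and b, and
  -- on k = 2ab it is 1. Bringing all terms to one scale leaves the table identity `signs`.
  twist-log : ∀ n → n ℕ.≤ N → twist product-log n ≡ + 2 * + 1 * Ψ N 1 w-even n + - + 2 * + 4 * Ψ N 4 w-odd n
  twist-log n n≤N = by-half (half n)
      ∙ cong (λ t → + 2 * t + - + 8 * Ψ N 4 w-odd n) (sym (Ψ-transpose N 1 n w-even ∙ Ψ-even N 0 n n≤N (λ b a → signed a b) ∙ Ψ-transpose N 2 n (λ b a → signed a b)))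
    where
      signed : ℕ → ℕ → ℤ
      signed a b = - ε (res a) * weight a b
      by-half : (∃ λ k → n ≡ k ℕ.* 2 ⊎ n ≡ suc (k ℕ.* 2)) → sg n * product-log n ≡ + 2 * Ψ N 2 signed n + - + 8 * Ψ N 4 w-odd n
      by-half (k , inj₂ p) = cong (sg n *_) (cong₂ (λ x y → - + 2 * x + - + 4 * y) (none 2 weight two) (none 4 weight four)) ∙ ℤP.*-zeroʳ (sg n)
          ∙ sym (cong₂ (λ x y → + 2 * x + - + 8 * y) (none 2 signed two) (none 4 w-odd four))
        where
          two : ∀ x → δ (2 ℕ.* x) n ≡ + 0
          two x = δ-≢ (λ q → ℕP.even≢odd x k (q ∙ p ∙ cong suc (ℕP.*-comm k 2)))
          four : ∀ x → δ (4 ℕ.* x) n ≡ + 0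
          four x = cong (λ t → δ t n) (ℕP.*-assoc 2 2 x) ∙ two (2 ℕ.* x)
          none : ∀ s u → (∀ x → δ (s ℕ.* x) n ≡ + 0) → Ψ N s u n ≡ + 0
          none s u h = Ψ-nonmultiple N s n u h
      by-half (k , inj₁ p) =
          cong₂ _*_ (cong sg p ∙ sg-ε k) (cong₂ (λ x y → - + 2 * x + - + 4 * y) (halve₂ weight) (halve₄ weight))
        ∙ lem (ε (res k)) (Ψ N 1 weight k) (Ψ N 2 weight k)
        ∙ cong₂ (λ x y → - + 2 * x + - + 4 * y)
            (sym (Ψ-*ˡ N 1 k (ε (res k)) weight)
              ∙ ∑₁²-cong N λ a b → δ-guard (1 ℕ.* (suc a ℕ.* suc b)) k λ q →
                  cong (λ t → ε t * weight (suc a) (suc b)) (cong res (sym q ∙ ℕP.*-identityˡ (suc a ℕ.* suc b)) ∙ res-* (suc a) (suc b)))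
            (sym (Ψ-*ˡ N 2 k (ε (res k)) weight)
              ∙ ∑₁²-cong N λ a b → δ-guard (2 ℕ.* (suc a ℕ.* suc b)) k λ q →
                  cong (_* weight (suc a) (suc b)) (cong ε (cong res (sym q) ∙ res-* 2 (suc a ℕ.* suc b)) ∙ ε-even (res (suc a ℕ.* suc b))) ∙ ℤP.*-identityˡ (weight (suc a) (suc b)))
        -- The term -4T is written as -4(2T) + 4T because at scale 1 the part with even a is 2T and
        -- the part with even b is T.
        ∙ lem₄ X T
        ∙ cong₂ (λ x y → - + 2 * X + - + 4 * x + + 4 * y) (sym EA≡) (sym EB≡)
        ∙ Ψ-combination N 1 k (- + 2) (- + 4) (+ 4) (λ a b → ε (res a ⊠ res b) * weight a b) (λ a b → even (res a) * weight a b) (λ a b → even (res b) * weight a b)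
        ∙ Ψ-cong N 1 k (λ a b → lem₅ (ε (res (suc a) ⊠ res (suc b))) (even (res (suc a))) (even (res (suc b))) (weight (suc a) (suc b))
            ∙ cong (_* weight (suc a) (suc b)) (signs (res (suc a)) (res (suc b)))
            ∙ lem₆ (ε (res (suc a))) (even (res (suc a))) (odd (res (suc b))) (weight (suc a) (suc b)))
        ∙ sym (Ψ-combination N 1 k (+ 2) (- + 4) (+ 0) signed (λ a b → even (res a) * w-odd a b) weight)
        ∙ cong (λ t → + 2 * Ψ N 1 signed k + - + 4 * t + + 0 * Ψ N 1 weight k) EAO≡
        ∙ lem₇ (Ψ N 1 signed k) (Ψ N 2 w-odd k)
        ∙ sym (cong₂ (λ x y → + 2 * x + - + 8 * y) (halve₂ signed) (halve₄ w-odd))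
        where
          k≤N : k ℕ.≤ N
          k≤N = ℕP.≤-trans (ℕP.m≤m*n k 2) (ℕP.≤-trans (ℕP.≤-reflexive (sym p)) n≤N)
          halve₂ : ∀ u → Ψ N 2 u n ≡ Ψ N 1 u k
          halve₂ u = cong (Ψ N 2 u) (p ∙ ℕP.*-comm k 2) ∙ Ψ-multiple N 1 k u
            ∙ ∑₁²-cong N λ a b → cong (λ t → δ t k * u (suc a) (suc b)) (sym (ℕP.*-identityˡ (suc a ℕ.* suc b)))
          halve₄ : ∀ u → Ψ N 4 u n ≡ Ψ N 2 u k
          halve₄ u = cong (Ψ N 4 u) (p ∙ ℕP.*-comm k 2)
            ∙ ∑₁²-cong N λ a b → cong (_* u (suc a) (suc b)) (cong (λ t → δ t (2 ℕ.* k)) (ℕP.*-assoc 2 2 (suc a ℕ.* suc b)) ∙ δ-scale 1 (2 ℕ.* (suc a ℕ.* suc b)) k)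
          ε-even : ∀ r → ε (# 2 ⊠ r) ≡ + 1
          ε-even = by-cases
          weight-double : ∀ a b → weight (a ℕ.* 2) b ≡ + 2 * weight a b
          weight-double a b = cong₂ (λ x y → (+ 1 + x) * y) (cong 3∣ (res-* a 2) ∙ third (res a)) (ℤP.pos-* a 2) ∙ lem₂ (3∣ (res a)) (+ a)
            where third : ∀ r → 3∣ (r ⊠ # 2) ≡ 3∣ r
                  third = by-cases
                  lem₂ : ∀ f a → (+ 1 + f) * (a * + 2) ≡ + 2 * ((+ 1 + f) * a)
                  lem₂ = ℤR.solve-∀
          lem : ∀ e x y → e * (- + 2 * x + - + 4 * y) ≡ - + 2 * (e * x) + - + 4 * (e * y)
          lem = ℤR.solve-∀
          lem₃ : ∀ o w → o * (+ 2 * w) ≡ + 2 * (o * w)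
          lem₃ = ℤR.solve-∀
          signs : ∀ r s → - + 2 * ε (r ⊠ s) + - + 4 * even r + + 4 * even s ≡ + 2 * - ε r + - + 4 * (even r * odd s)
          signs = by-cases₂
          X T : ℤ
          X = Ψ N 1 (λ a b → ε (res a ⊠ res b) * weight a b) k
          T = Ψ N 2 weight k
          EA≡ : Ψ N 1 (λ a b → even (res a) * weight a b) k ≡ + 2 * T
          EA≡ = Ψ-even N 0 k k≤N weight ∙ Ψ-cong N 2 k (λ a b → weight-double (suc a) (suc b)) ∙ Ψ-*ˡ N 2 k (+ 2) weight
          EB≡ : Ψ N 1 (λ a b → even (res b) * weight a b) k ≡ T
          EB≡ = Ψ-transpose N 1 k (λ a b → even (res b) * weight a b) ∙ Ψ-even N 0 k k≤N (λ b a → weight a b) ∙ Ψ-transpose N 2 k (λ b a → weight a b)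
          EAO≡ : Ψ N 1 (λ a b → even (res a) * w-odd a b) k ≡ + 2 * Ψ N 2 w-odd k
          EAO≡ = Ψ-even N 0 k k≤N w-odd
            ∙ Ψ-cong N 2 k (λ a b → cong (odd (res (suc b)) *_) (weight-double (suc a) (suc b)) ∙ lem₃ (odd (res (suc b))) (weight (suc a) (suc b)))
            ∙ Ψ-*ˡ N 2 k (+ 2) w-odd
          lem₄ : ∀ x t → - + 2 * x + - + 4 * t ≡ - + 2 * x + - + 4 * (+ 2 * t) + + 4 * t
          lem₄ = ℤR.solve-∀
          lem₅ : ∀ x y z w → - + 2 * (x * w) + - + 4 * (y * w) + + 4 * (z * w) ≡ (- + 2 * x + - + 4 * y + + 4 * z) * w
          lem₅ = ℤR.solve-∀
          lem₆ : ∀ x y z w → (+ 2 * - x + - + 4 * (y * z)) * w ≡ + 2 * (- x * w) + - + 4 * (y * (z * w)) + + 0 * w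
          lem₆ = ℤR.solve-∀
          lem₇ : ∀ x z → + 2 * x + - + 4 * (+ 2 * z) + + 0 ≡ + 2 * x + - + 8 * z
          lem₇ = ℤR.solve-∀

  Γ★Φ-product : ∀ n → n ℕ.≤ K → twist (coeff (prodUpTo N)) n ≡ (Γ 1 ★ Φ 4) n
  Γ★Φ-product = Log-unique {f = twist (coeff (prodUpTo N))} {g = Γ 1 ★ Φ 4} log-0
      (Log-cong (λ _ _ → refl) (λ n r → cong (sg n *_) (product-log≡ n (ℕP.≤-trans r K≤N)) ∙ twist-log n (ℕP.≤-trans r K≤N))
        (Log-twist odd-0 (Log-prodUpTo N)))
      (Log-★ (Log-Γ 0) (Log-Φ 3))
      (cong (+ 1 *_) (constant N) ∙ sym (cong₂ _*_ (Γ-0 0) (cong (λ t → + 1 + - + 2 * t) (Ψ-low N 4 0 χ-sign (ℕ.s≤s ℕ.z≤n)))))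
    where
      log-0 : + 2 * + 1 * Ψ N 1 w-even 0 + - + 2 * + 4 * Ψ N 4 w-odd 0 ≡ + 0
      log-0 = cong₂ (λ x y → + 2 * + 1 * x + - + 2 * + 4 * y) (Ψ-low N 1 0 w-even (ℕ.s≤s ℕ.z≤n)) (Ψ-low N 4 0 w-odd (ℕ.s≤s ℕ.z≤n))
      odd-0 : ∀ k → ∑₁ N (λ j → factor-log j (suc (k ℕ.* 2))) ≡ + 0
      odd-0 k = ∑₁-zero N λ j → cong₂ _+_ (cong₂ _+_ (cong₂ _+_ (none 1 (suc j)) (none 2 (suc j))) (none 3 (suc j))) (none 6 (suc j))
        where none : ∀ s j → - + (2 ℕ.* s ℕ.* j) * geo (2 ℕ.* s ℕ.* j) (suc (k ℕ.* 2)) ≡ + 0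
              none s j = cong (- + (2 ℕ.* s ℕ.* j) *_) (∑₁-zero N λ b → δ-≢ (λ q → ℕP.even≢odd (s ℕ.* j ℕ.* suc b) k
                  (assoc s j (suc b) ∙ q ∙ cong suc (ℕP.*-comm k 2)))) ∙ ℤP.*-zeroʳ (- + (2 ℕ.* s ℕ.* j))
                where assoc : ∀ s j b → 2 ℕ.* (s ℕ.* j ℕ.* b) ≡ 2 ℕ.* s ℕ.* j ℕ.* b
                      assoc = ℕR.solve-∀
      constant : ∀ m → coeff (prodUpTo m) 0 ≡ + 1
      constant zero = refl
      constant (suc m) = coeff-⊗ (prodUpTo m) (factor (suc m)) 0 ∙ cong (_* coeff (factor (suc m)) 0) (constant m)

-- The representation count as a product of four theta series

indicator : ∀ {p} {P : Set p} → Dec P → ℤ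
indicator (yes _) = + 1
indicator (no _) = + 0

∑ˡ : ∀ {A : Set} → List A → (A → ℤ) → ℤ
∑ˡ [] g = + 0
∑ˡ (x ∷ xs) g = g x + ∑ˡ xs g

∑ˡ-cong : ∀ {A : Set} (xs : List A) {f g : A → ℤ} → (∀ x → f x ≡ g x) → ∑ˡ xs f ≡ ∑ˡ xs g
∑ˡ-cong [] h = refl
∑ˡ-cong (x ∷ xs) h = cong₂ _+_ (h x) (∑ˡ-cong xs h)

∑ˡ-++ : ∀ {A : Set} (xs ys : List A) g → ∑ˡ (xs ++ ys) g ≡ ∑ˡ xs g + ∑ˡ ys g
∑ˡ-++ [] ys g = sym (ℤP.+-identityˡ _)
∑ˡ-++ (x ∷ xs) ys g = cong (_+_ (g x)) (∑ˡ-++ xs ys g) ∙ sym (ℤP.+-assoc (g x) _ _)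

∑ˡ-map : ∀ {A B : Set} (f : A → B) xs g → ∑ˡ (map f xs) g ≡ ∑ˡ xs (λ x → g (f x))
∑ˡ-map f [] g = refl
∑ˡ-map f (x ∷ xs) g = cong (_+_ (g (f x))) (∑ˡ-map f xs g)

∑ˡ-concatMap : ∀ {A B : Set} (f : A → List B) xs g → ∑ˡ (concatMap f xs) g ≡ ∑ˡ xs (λ x → ∑ˡ (f x) g)
∑ˡ-concatMap f [] g = refl
∑ˡ-concatMap f (x ∷ xs) g = ∑ˡ-++ (f x) (concatMap f xs) g ∙ cong (_+_ (∑ˡ (f x) g)) (∑ˡ-concatMap f xs g)

∑ˡ-applyUpTo : ∀ {A : Set} (f : ℕ → A) m g → ∑ˡ (applyUpTo f m) g ≡ ∑ m (λ i → g (f i))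
∑ˡ-applyUpTo f zero g = refl
∑ˡ-applyUpTo f (suc m) g = cong (_+_ (g (f 0))) (∑ˡ-applyUpTo (λ i → f (suc i)) m g)

length-filter : ∀ {A : Set} {p} {P : A → Set p} (P? : ∀ x → Dec (P x)) xs → + length (filter P? xs) ≡ ∑ˡ xs (λ x → indicator (P? x))
length-filter P? [] = refl
length-filter P? (x ∷ xs) with P? x
... | yes _ = cong (_+_ (+ 1)) (length-filter P? xs)
... | no _ = length-filter P? xs ∙ sym (ℤP.+-identityˡ _)

∑-reverse : ∀ n (f : ℕ → ℤ) → ∑ (suc n) (λ i → f (n ℕ.∸ i)) ≡ ∑ (suc n) f
∑-reverse zero f = refl
∑-reverse (suc n) f = cong (_+_ (f (suc n))) (∑-reverse n f) ∙ ℤP.+-comm (f (suc n)) _ ∙ sym (∑-last (suc n) f)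

-- The value x(x - 1) as a natural number, arranged so that i(i + 1) appears at x = i + 1 and at x =
-- -i.
pronic : ℤ → ℕ
pronic (+ zero) = 0
pronic (+ suc i) = i ℕ.* suc i
pronic ℤ.-[1+ i ] = suc i ℕ.* suc (suc i)

tri2-pronic : ∀ x → tri2 x ≡ + pronic x
tri2-pronic (+ zero) = refl
tri2-pronic (+ suc i) = cong (+ suc i *_) (lem (+ i)) ∙ sym (ℤP.pos-* (suc i) i) ∙ cong +_ (ℕP.*-comm (suc i) i)
  where lem : ∀ x → (+ 1 + x) - + 1 ≡ x
        lem = ℤR.solve-∀
tri2-pronic ℤ.-[1+ i ] = cong (λ t → + (suc i ℕ.* suc t)) (cong suc (ℕP.+-identityʳ i))

indicator-δ : ∀ x m n → x ≡ + m → (d : Dec (x ≡ + n)) → indicator d ≡ δ m n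
indicator-δ x m n p (yes q) = sym (cong (λ t → δ t n) (ℤP.+-injective (sym p ∙ q)) ∙ δ-refl n)
indicator-δ x m n p (no q) = sym (δ-≢ (λ r → q (p ∙ cong +_ r)))

-- Pairing x = i + 1 with x = -i gives the factor 2. The unpaired end x = -(n + 1) and all terms
-- with i > n have values above 2n, where h vanishes.
∑ˡ-box : ∀ n m (h : ℕ → ℤ) → (∀ k → 2 ℕ.* n ℕ.< k → h k ≡ + 0) → n ℕ.< m →
  ∑ˡ (box n) (λ x → h (pronic x)) ≡ + 2 * ∑ m (λ i → h (i ℕ.* suc i))
∑ˡ-box n m h v n<m =
    ∑ˡ-map (λ i → + i - + suc n) (upTo (suc (2 ℕ.* suc n))) (λ x → h (pronic x))
  ∙ ∑ˡ-applyUpTo (λ i → i) (suc (2 ℕ.* suc n)) (λ i → h (pronic (+ i - + suc n)))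
  ∙ cong (λ t → ∑ t (λ i → h (pronic (+ i - + suc n)))) (lem n)
  ∙ ∑-split (suc n) (suc (suc n)) (λ i → h (pronic (+ i - + suc n)))
  ∙ cong₂ _+_
      (∑-cong< (suc n) (λ i p → cong (λ t → h (pronic t)) (negative i p)) ∙ ∑-reverse n (λ i → h (suc i ℕ.* suc (suc i))))
      (∑-cong (suc (suc n)) (λ i → cong (λ t → h (pronic t)) (lem₂ (+ suc n) (+ i))))
  ∙ cong (_+ (h 0 + T)) (∑-last n (λ i → h (suc i ℕ.* suc (suc i))) ∙ cong (_+_ U) (v (suc n ℕ.* suc (suc n)) top))
  ∙ lem₃ (h 0) U T
  ∙ lem₄ T
  ∙ cong (+ 2 *_) (sym (∑-truncate (suc n) m (λ i → h (i ℕ.* suc i)) n<m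
      (λ i p → v (i ℕ.* suc i) (ℕP.<-≤-trans (ℕP.≤-trans top′ (ℕP.≤-reflexive (ℕP.*-comm 2 (suc n)))) (ℕP.*-mono-≤ p (ℕ.s≤s (ℕP.≤-trans (ℕ.s≤s ℕ.z≤n) p)))))))
  where
    T U : ℤ
    T = ∑ (suc n) (λ i → h (i ℕ.* suc i))
    U = ∑ n (λ i → h (suc i ℕ.* suc (suc i)))
    lem : ∀ n → suc (2 ℕ.* suc n) ≡ suc n ℕ.+ suc (suc n)
    lem = ℕR.solve-∀
    lem₂ : ∀ x y → x + y - x ≡ y
    lem₂ = ℤR.solve-∀
    lem₃ : ∀ a u t → u + + 0 + (a + t) ≡ (a + u) + t
    lem₃ = ℤR.solve-∀
    lem₄ : ∀ t → t + t ≡ + 2 * t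
    lem₄ = ℤR.solve-∀
    top′ : suc (2 ℕ.* n) ℕ.≤ 2 ℕ.* suc n
    top′ = ℕP.*-monoʳ-< 2 (ℕP.n<1+n n)
    top : 2 ℕ.* n ℕ.< suc n ℕ.* suc (suc n)
    top = ℕP.≤-trans top′ (ℕP.≤-trans (ℕP.≤-reflexive (ℕP.*-comm 2 (suc n))) (ℕP.*-monoʳ-≤ (suc n) (ℕ.s≤s (ℕ.s≤s ℕ.z≤n))))
    negative : ∀ i → i ℕ.< suc n → + i - + suc n ≡ ℤ.-[1+ n ℕ.∸ i ]
    negative i (ℕ.s≤s p) = cong (λ t → + i - + suc t) (sym (ℕP.m+[n∸m]≡n p)) ∙ lem₅ (+ i) (+ (n ℕ.∸ i))
      where lem₅ : ∀ x y → x - (+ 1 + (x + y)) ≡ - (+ 1 + y)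
            lem₅ = ℤR.solve-∀

length-filter-quads : ∀ n {p} {P : ℤ × ℤ × ℤ × ℤ → Set p} (P? : ∀ q → Dec (P q)) (g : ℤ → ℤ → ℤ → ℤ → ℤ) →
  (∀ x y z w → indicator (P? (x , y , z , w)) ≡ g x y z w) →
  + length (filter P? (quads n)) ≡ ∑ˡ (box n) λ x → ∑ˡ (box n) λ y → ∑ˡ (box n) λ z → ∑ˡ (box n) λ w → g x y z w
length-filter-quads n P? g h =
    length-filter P? (quads n)
  ∙ ∑ˡ-concatMap (λ x → concatMap (λ y → concatMap (row x y) (box n)) (box n)) (box n) ι
  ∙ ∑ˡ-cong (box n) λ x → ∑ˡ-concatMap (λ y → concatMap (row x y) (box n)) (box n) ι
  ∙ ∑ˡ-cong (box n) λ y → ∑ˡ-concatMap (row x y) (box n) ι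
  ∙ ∑ˡ-cong (box n) λ z → ∑ˡ-map (λ w → (x , y , z , w)) (box n) ι
  ∙ ∑ˡ-cong (box n) λ w → h x y z w
  where
    ι : ℤ × ℤ × ℤ × ℤ → ℤ
    ι q = indicator (P? q)
    row : ℤ → ℤ → ℤ → List (ℤ × ℤ × ℤ × ℤ)
    row x y z = map (λ w → (x , y , z , w)) (box n)

module _ (n m : ℕ) (n<m : n ℕ.< m) where

  private
    E : ℕ → ℕ → ℕ → ℕ → ℕ
    E x y z w = 1 ℕ.* x ℕ.+ 3 ℕ.* y ℕ.+ 4 ℕ.* z ℕ.+ 12 ℕ.* w

    over : (ℕ → ℤ) → ℤ
    over h = ∑ m (λ i → h (i ℕ.* suc i))

    S₁ : ℕ → ℕ → ℕ → ℤ
    S₁ x y z = over (λ w → δ (E x y z w) (2 ℕ.* n))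
    S₂ : ℕ → ℕ → ℤ
    S₂ x y = over (S₁ x y)
    S₃ : ℕ → ℤ
    S₃ x = over (S₂ x)

    high : ∀ {k e} → k ℕ.≤ e → 2 ℕ.* n ℕ.< k → δ e (2 ℕ.* n) ≡ + 0
    high r p = δ-> (ℕP.<-≤-trans p r)

    over-zero : ∀ h → (∀ k → h k ≡ + 0) → over h ≡ + 0
    over-zero h v = ∑-zero m (λ i _ → v (i ℕ.* suc i))

    w≤ : ∀ x y z w → w ℕ.≤ E x y z w
    w≤ x y z w = ℕP.≤-trans (ℕP.m≤n*m w 12) (ℕP.m≤n+m (12 ℕ.* w) (1 ℕ.* x ℕ.+ 3 ℕ.* y ℕ.+ 4 ℕ.* z))
    z≤ : ∀ x y z w → z ℕ.≤ E x y z w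
    z≤ x y z w = ℕP.≤-trans (ℕP.≤-trans (ℕP.m≤n*m z 4) (ℕP.m≤n+m (4 ℕ.* z) (1 ℕ.* x ℕ.+ 3 ℕ.* y))) (ℕP.m≤m+n _ (12 ℕ.* w))
    y≤ : ∀ x y z w → y ℕ.≤ E x y z w
    y≤ x y z w = ℕP.≤-trans (ℕP.≤-trans (ℕP.≤-trans (ℕP.m≤n*m y 3) (ℕP.m≤n+m (3 ℕ.* y) (1 ℕ.* x))) (ℕP.m≤m+n _ (4 ℕ.* z))) (ℕP.m≤m+n _ (12 ℕ.* w))
    x≤ : ∀ x y z w → x ℕ.≤ E x y z w
    x≤ x y z w = ℕP.≤-trans (ℕP.≤-trans (ℕP.≤-trans (ℕP.m≤n*m x 1) (ℕP.m≤m+n _ (3 ℕ.* y))) (ℕP.m≤m+n _ (4 ℕ.* z))) (ℕP.m≤m+n _ (12 ℕ.* w))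

    value : ∀ x y z w → + 1 * tri2 x + + 3 * tri2 y + + 4 * tri2 z + + 12 * tri2 w ≡ + E (pronic x) (pronic y) (pronic z) (pronic w)
    value x y z w = cong₂ _+_ (cong₂ _+_ (cong₂ _+_ (part 1 x) (part 3 y)) (part 4 z)) (part 12 w)
      where part : ∀ k x → + k * tri2 x ≡ + (k ℕ.* pronic x)
            part k x = cong (+ k *_) (tri2-pronic x) ∙ sym (ℤP.pos-* k (pronic x))

    box-double : ∀ h → (∀ k → 2 ℕ.* n ℕ.< k → h k ≡ + 0) → ∀ c → ∑ˡ (box n) (λ x → c * h (pronic x)) ≡ c * + 2 * over h
    box-double h v c = ∑ˡ-box n m (λ k → c * h k) (λ k p → cong (c *_) (v k p) ∙ ℤP.*-zeroʳ c) n<m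
      ∙ cong (+ 2 *_) (∑-*ˡ m c (λ i → h (i ℕ.* suc i))) ∙ lem c (over h)
      where lem : ∀ c x → + 2 * (c * x) ≡ c * + 2 * x
            lem = ℤR.solve-∀

  t-theta : + t 1 3 4 12 n ≡ + 16 * over (λ x → over λ y → over λ z → over λ w → δ (E x y z w) (2 ℕ.* n))
  t-theta =
      length-filter-quads n (λ { (x , y , z , w) → (+ 1 * tri2 x + + 3 * tri2 y + + 4 * tri2 z + + 12 * tri2 w) ℤ.≟ + (2 ℕ.* n) }) (λ x y z w → + 1 * δ (E (pronic x) (pronic y) (pronic z) (pronic w)) (2 ℕ.* n))
        (λ x y z w → indicator-δ _ (E (pronic x) (pronic y) (pronic z) (pronic w)) (2 ℕ.* n) (value x y z w) _ ∙ sym (ℤP.*-identityˡ _))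
    -- Each of the four variables doubles the constant in front: 1, 2, 4, 8 and finally 16.
    ∙ (∑ˡ-cong (box n) λ x → (∑ˡ-cong (box n) λ y → (∑ˡ-cong (box n) λ z →
            box-double (λ w → δ (E (pronic x) (pronic y) (pronic z) w) (2 ℕ.* n)) (λ w → high (w≤ (pronic x) (pronic y) (pronic z) w)) (+ 1))
          ∙ box-double (S₁ (pronic x) (pronic y)) (λ z p → over-zero _ λ w → high (z≤ (pronic x) (pronic y) z w) p) (+ 2))
        ∙ box-double (S₂ (pronic x)) (λ y p → over-zero _ λ z → over-zero _ λ w → high (y≤ (pronic x) y z w) p) (+ 4))
    ∙ box-double S₃ (λ x p → over-zero _ λ y → over-zero _ λ z → over-zero _ λ w → high (x≤ x y z w) p) (+ 8)

  theta-product : ∀ (ψ : ℕ → ℕ → ℤ) → (∀ s k → ψ s k ≡ over (λ x → δ (s ℕ.* x) k)) →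
    ((ψ 1 ★ ψ 3) ★ (ψ 4 ★ ψ 12)) (2 ℕ.* n) ≡ over (λ x → over λ y → over λ z → over λ w → δ (E x y z w) (2 ℕ.* n))
  theta-product ψ h =
      ★-assoc k (ψ 1) (ψ 3) (ψ 4 ★ ψ 12)
    ∙ sym (δ-★-0 k (ψ 1 ★ (ψ 3 ★ (ψ 4 ★ ψ 12))))
    ∙ expand 0 1 (ψ 3 ★ (ψ 4 ★ ψ 12))
    ∙ ∑-cong m λ i → expand (1 ℕ.* T i) 3 (ψ 4 ★ ψ 12)
    ∙ ∑-cong m λ j → expand (1 ℕ.* T i ℕ.+ 3 ℕ.* T j) 4 (ψ 12)
    ∙ ∑-cong m λ l → ★-cong k {δ (1 ℕ.* T i ℕ.+ 3 ℕ.* T j ℕ.+ 4 ℕ.* T l)} (λ _ → refl) (λ r → sym (δ-★-0 r (ψ 12)) ∙ ★-comm r (δ 0) (ψ 12))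
      ∙ expand (1 ℕ.* T i ℕ.+ 3 ℕ.* T j ℕ.+ 4 ℕ.* T l) 12 (δ 0)
      ∙ ∑-cong m λ r → ★-comm k (δ (E (T i) (T j) (T l) (T r))) (δ 0) ∙ δ-★-0 k (δ (E (T i) (T j) (T l) (T r)))
    where
      k : ℕ
      k = 2 ℕ.* n
      T : ℕ → ℕ
      T i = i ℕ.* suc i
      expand : ∀ e s g → (δ e ★ (ψ s ★ g)) k ≡ over (λ x → (δ (e ℕ.+ s ℕ.* x) ★ g) k)
      expand e s g = sym (★-assoc k (δ e) (ψ s) g)
        ∙ ★-cong k (λ r → ★-comm r (δ e) (ψ s) ∙ ★-cong r (h s) (λ _ → refl) ∙ ∑-★ m r (λ i → δ (s ℕ.* T i)) (δ e)
            ∙ ∑-cong m (λ i → δ-★-δ r (s ℕ.* T i) e ∙ cong (λ u → δ u r) (ℕP.+-comm (s ℕ.* T i) e))) (λ _ → refl)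
        ∙ ∑-★ m k (λ i → δ (e ℕ.+ s ℕ.* T i)) g

-- Divisors prime to 3

3∣-correct : ∀ b → (3 ∣ b × 3∣ (res b) ≡ + 1) ⊎ (¬ (3 ∣ b) × 3∣ (res b) ≡ + 0)
3∣-correct 0 = inj₁ (divides 0 refl , refl)
3∣-correct 1 = inj₂ ((λ p → case-absurd (∣.∣⇒≤ p)) , refl)
  where case-absurd : ¬ (3 ℕ.≤ 1)
        case-absurd (ℕ.s≤s ())
3∣-correct 2 = inj₂ ((λ p → case-absurd (∣.∣⇒≤ p)) , refl)
  where case-absurd : ¬ (3 ℕ.≤ 2)
        case-absurd (ℕ.s≤s (ℕ.s≤s ()))
3∣-correct (suc (suc (suc b))) with 3∣-correct b
... | inj₁ (p , q) = inj₁ (∣.∣m∣n⇒∣m+n (∣.∣-refl {3}) p , (period (res b) ∙ q))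
  where period : ∀ r → 3∣ (next (next (next r))) ≡ 3∣ r
        period = by-cases
... | inj₂ (p , q) = inj₂ ((λ d → p (∣.∣m+n∣m⇒∣n d (∣.∣-refl {3}))) , (period (res b) ∙ q))
  where period : ∀ r → 3∣ (next (next (next r))) ≡ 3∣ r
        period = by-cases

coprime-3 : ∀ b → ¬ (3 ∣ b) → Coprime b 3
coprime-3 b p {d} (d∣b , d∣3) with prime⇒irreducible (from-yes (prime? 3)) d∣3
... | inj₁ d≡1 = d≡1
... | inj₂ refl = ⊥-elim (p d∣b)

divisor-coprime-3 : ∀ b n β → ¬ (3 ∣ b) → b ∣ 3 ^ β ℕ.* n → b ∣ n
divisor-coprime-3 b n zero p d = subst (b ∣_) (ℕP.*-identityˡ n) d
divisor-coprime-3 b n (suc β) p d = divisor-coprime-3 b n β p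
  (coprime-divisor (coprime-3 b p) (subst (b ∣_) (ℕP.*-assoc 3 (3 ^ β) n) d))

∑₁-δ-divides : ∀ M b → 1 ℕ.≤ M → ∑₁ M (λ a → δ (a ℕ.* b) M) ≡ indicator (b ∣? M)
∑₁-δ-divides M b 1≤M with b ∣? M
... | no p = ∑₁-zero M λ a → δ-≢ (λ q → p (divides (suc a) (sym q)))
... | yes (divides zero q) = ⊥-elim (ℕP.<⇒≢ 1≤M (sym q))
... | yes (divides (suc c) q) = ∑₁-cong M (λ a → same (suc a)) ∙ ∑₁-δ M c (λ _ → + 1) c≤M
  where
    b>0 : ∀ b → M ≡ suc c ℕ.* b → ℕ.NonZero b
    b>0 zero r = ⊥-elim (ℕP.<⇒≢ 1≤M (sym (r ∙ ℕP.*-zeroʳ (suc c))))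
    b>0 (suc b) r = _
    c≤M : suc c ℕ.≤ M
    c≤M = ℕP.≤-trans (ℕP.m≤m*n (suc c) b {{b>0 b q}}) (ℕP.≤-reflexive (sym q))
    same : ∀ a → δ (a ℕ.* b) M ≡ δ (suc c) a * + 1
    same a with a ℕP.≟ suc c
    ... | yes refl = cong (δ (suc c ℕ.* b)) q ∙ δ-refl (suc c ℕ.* b) ∙ sym (ℤP.*-identityʳ (δ (suc c) (suc c)) ∙ δ-refl (suc c))
    ... | no r = δ-≢ (λ s → r (ℕP.*-cancelʳ-≡ a (suc c) b {{b>0 b q}} (s ∙ q))) ∙ sym (ℤP.*-identityʳ (δ (suc c) a) ∙ δ-≢ (λ s → r (sym s)))

sum-filter : ∀ {p} {P : ℕ → Set p} (P? : ∀ x → Dec (P x)) xs → + sum (filter P? xs) ≡ ∑ˡ xs (λ x → indicator (P? x) * + x)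
sum-filter P? [] = refl
sum-filter P? (x ∷ xs) with P? x
... | yes _ = cong₂ _+_ (sym (ℤP.*-identityˡ (+ x))) (sum-filter P? xs)
... | no _ = sum-filter P? xs ∙ sym (ℤP.+-identityˡ _)

σ-∑₁ : ∀ n → + σ n ≡ ∑₁ n (λ d → indicator (d ∣? n) * + d)
σ-∑₁ n = sum-filter (_∣? n) (map suc (upTo n)) ∙ ∑ˡ-map suc (upTo n) (λ x → indicator (x ∣? n) * + x)
  ∙ ∑ˡ-applyUpTo (λ i → i) n (λ i → indicator (suc i ∣? n) * + suc i) ∙ sym (∑₁≡∑ n (λ d → indicator (d ∣? n) * + d))

-- A divisor of 3^β n₁ prime to 3 already divides n₁, and no divisor of n₁ is a multiple of 3; so
-- the same divisors are summed on both sides.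
∑∣-tripled : ∀ M β n₁ → 1 ℕ.≤ n₁ → M ≡ 3 ^ β ℕ.* n₁ → ¬ (3 ∣ n₁) → ∑∣ M M tripled ≡ + σ n₁
∑∣-tripled M β n₁ 1≤n₁ eq 3∤n₁ =
    ∑∣-transpose M M tripled
  ∙ (∑₁-cong M λ b → (∑₁-cong M λ a → ℤP.*-comm (δ (suc b ℕ.* suc a) M) (tripled (suc a) (suc b)) ∙ cong (λ t → tripled 0 (suc b) * δ t M) (ℕP.*-comm (suc b) (suc a)))
      ∙ ∑₁-*ˡ M (tripled 0 (suc b)) (λ a → δ (a ℕ.* suc b) M)
      ∙ cong (tripled 0 (suc b) *_) (∑₁-δ-divides M (suc b) 1≤M)
      ∙ select (suc b))
  ∙ cong (λ t → ∑₁ t (λ b → indicator (b ∣? n₁) * + b)) (sym (ℕP.m∸n+n≡m n₁≤M))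
  ∙ ∑₁-extend n₁ (M ℕ.∸ n₁) (λ b → indicator (b ∣? n₁) * + b) (λ b p → cong (_* + b) (large b p))
  ∙ sym (σ-∑₁ n₁)
  where
    n₁≤M : n₁ ℕ.≤ M
    n₁≤M = ℕP.≤-trans (ℕP.m≤n*m n₁ (3 ^ β) {{ℕP.m^n≢0 3 β}}) (ℕP.≤-reflexive (sym eq))
    1≤M : 1 ℕ.≤ M
    1≤M = ℕP.≤-trans 1≤n₁ n₁≤M
    large : ∀ b → n₁ ℕ.< b → indicator (b ∣? n₁) ≡ + 0
    large b p with b ∣? n₁
    ... | yes d = ⊥-elim (ℕP.<⇒≱ p (∣.∣⇒≤ {{ℕ.>-nonZero 1≤n₁}} d))
    ... | no _ = refl
    select : ∀ b → tripled 0 b * indicator (b ∣? M) ≡ indicator (b ∣? n₁) * + b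
    select b with 3∣-correct b | b ∣? M | b ∣? n₁
    ... | inj₁ (p , q) | _ | yes d = ⊥-elim (3∤n₁ (∣.∣-trans p d))
    ... | inj₁ (p , q) | x | no _ = cong (λ t → (+ 1 - t) * + b * indicator x) q
    ... | inj₂ (p , q) | yes d | yes _ = cong (λ t → (+ 1 - t) * + b * + 1) q ∙ lem (+ b)
      where lem : ∀ b → (+ 1 - + 0) * b * + 1 ≡ + 1 * b
            lem = ℤR.solve-∀
    ... | inj₂ (p , q) | no d | no _ = ℤP.*-zeroʳ (tripled 0 b)
    ... | inj₂ (p , q) | yes d | no ¬d = ⊥-elim (¬d (divisor-coprime-3 b n₁ β p (subst (b ∣_) eq d)))
    ... | inj₂ (p , q) | no ¬d | yes d = ⊥-elim (¬d (subst (b ∣_) (sym eq) (∣.∣n⇒∣m*n (3 ^ β) d)))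

-- Comparison of coefficients at 2n + 5

module Coefficients (n : ℕ) where
  -- N is the exponent 2n + 5, and K = N - 1 is the same place in `Γ 1`, where the leading q of G
  -- has been removed.
  K N : ℕ
  K = 4 ℕ.+ 2 ℕ.* n
  N = suc K

  open Logs N K ℕP.≤-refl
  open Theta N K ℕP.≤-refl
  open Product N K ℕP.≤-refl

  N-odd : odd (res N) ≡ + 1
  N-odd = cong (λ r → odd (next (next (next (next (next r)))))) (res-* 2 n) ∙ shift (res n)
    where shift : ∀ r → odd (next (next (next (next (next (# 2 ⊠ r)))))) ≡ + 1
          shift = by-cases

  A : ℕ → ℤ
  A = δ 0 ⊕ₛ (- + 6 · Ψ N 1 χ-even)

  Γ★A : (Γ 1 ★ A) K ≡ ∑∣ N N tripled
  Γ★A = sym (Γ-★ 1 K A)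
    ∙ ★-distribˡ N (Ψ N 1 χ-odd) (δ 0) (- + 6 · Ψ N 1 χ-even)
    ∙ cong₂ _+_ (★-comm N (Ψ N 1 χ-odd) (δ 0) ∙ δ-★-0 N (Ψ N 1 χ-odd) ∙ cong (Ψ N 1 χ-odd) (sym (ℕP.*-identityˡ N)) ∙ Ψ-multiple N 0 N χ-odd)
        (★-scaleʳ N (- + 6) (Ψ N 1 χ-odd) (Ψ N 1 χ-even)
          ∙ cong (- + 6 *_) (★-comm N (Ψ N 1 χ-odd) (Ψ N 1 χ-even) ∙ cong (Ψ N 1 χ-even ★ Ψ N 1 χ-odd) (sym (ℕP.*-identityˡ N)) ∙ Ψ-★-multiple N 0 N χ-even χ-odd))
    ∙ lem (∑∣ N N χ-odd) (∑∣ N N tripled) (conv N N χ-even χ-odd) (convolution N N ℕP.≤-refl N-odd)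
    where lem : ∀ x y c → + 6 * c ≡ x - y → x + - + 6 * c ≡ y
          lem x y c h = l₁ x c ∙ cong (λ t → x - t) h ∙ l₂ x y
            where l₁ : ∀ x c → x + - + 6 * c ≡ x - + 6 * c
                  l₁ = ℤR.solve-∀
                  l₂ : ∀ x y → x - (x - y) ≡ y
                  l₂ = ℤR.solve-∀

  -- The series of G(q⁴) starts at q⁴; taking this monomial out lowers the degree from 2n + 4 to 2n,
  -- where the theta product is read off.
  Γ★A-split : (Γ 1 ★ A) K ≡ (Γ 1 ★ Φ 4) K + + 8 * (Γ 1 ★ Γ 4) (2 ℕ.* n)
  Γ★A-split = ★-cong≤ K {Γ 1} (λ _ _ → refl) (λ i r → χ-even-Φ i (ℕP.m≤n⇒m≤1+n r))
    ∙ ★-distribˡ K (Γ 1) (Φ 4) (+ 8 · Ψ N 4 χ-odd)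
    ∙ cong (_+_ ((Γ 1 ★ Φ 4) K)) (★-scaleʳ K (+ 8) (Γ 1) (Ψ N 4 χ-odd)
        ∙ cong (+ 8 *_) (★-comm K (Γ 1) (Ψ N 4 χ-odd) ∙ Γ-★ 4 (2 ℕ.* n) (Γ 1) ∙ ★-comm (2 ℕ.* n) (Γ 4) (Γ 1)))

  sg-sgn : ∀ n → sg (2 ℕ.* n) ≡ sgn n
  sg-sgn zero = refl
  sg-sgn (suc n) = cong sg (ℕP.*-suc 2 n) ∙ cong -_ (sg-sgn n)

  -- The definition of `a` at 2n + 5 truncates the product at exactly N factors and reads degree K,
  -- so `Γ★Φ-product` applies directly. The twist contributes sg(4 + 2n) = (-1)^n.
  cusp : (Γ 1 ★ Φ 4) K ≡ sgn n * a (2 ℕ.* n ℕ.+ 5)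
  cusp = sym (Γ★Φ-product K ℕP.≤-refl) ∙ cong₂ _*_ (ℤP.neg-involutive (sg (2 ℕ.* n)) ∙ sg-sgn n) (cong a (ℕP.+-comm 5 (2 ℕ.* n)))

  ψ′ : ℕ → ℕ → ℤ
  ψ′ s k = ∑ (N ℕ.* 2) (λ i → δ (s ℕ.* (i ℕ.* suc i)) k)

  theta : + t 1 3 4 12 n ≡ + 16 * (Γ 1 ★ Γ 4) (2 ℕ.* n)
  theta = t-theta n (N ℕ.* 2) n<m
    ∙ cong (+ 16 *_) (sym (theta-product n (N ℕ.* 2) n<m ψ′ (λ _ _ → refl))
        ∙ sym (★-cong≤ (2 ℕ.* n) (λ i r → Γ-ψ 0 i (ℕP.≤-trans r (ℕP.m≤n+m (2 ℕ.* n) 4))) (λ i r → Γ-ψ 3 i (ℕP.≤-trans r (ℕP.m≤n+m (2 ℕ.* n) 4)))))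
    where n<m : n ℕ.< N ℕ.* 2
          n<m = ℕP.≤-trans (ℕ.s≤s (ℕP.≤-trans (ℕP.m≤n*m n 2) (ℕP.m≤n+m (2 ℕ.* n) 4))) (ℕP.m≤m*n N 2)

theorem3p4 : (n : ℕ) → 1 ℕ.≤ n → (β n₁ : ℕ) → 1 ℕ.≤ n₁ → 2 ℕ.* n ℕ.+ 5 ≡ 3 ^ β ℕ.* n₁ → ¬ (3 ∣ n₁) →
    + (t 1 3 4 12 n) ≡ + 2 ℤ.* (+ (σ n₁) ℤ.- sgn n ℤ.* a (2 ℕ.* n ℕ.+ 5))
theorem3p4 n 1≤n β n₁ 1≤n₁ eq 3∤n₁ =
    theta
  -- Adding and subtracting the cusp term completes 8 times the theta product to G times the series
  -- `A`, whose coefficient is the divisor sum.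
  ∙ lem ((Γ 1 ★ Γ 4) (2 ℕ.* n)) ((Γ 1 ★ Φ 4) K)
  ∙ cong₂ (λ x y → + 2 * (x - y)) (sym Γ★A-split ∙ Γ★A ∙ ∑∣-tripled N β n₁ 1≤n₁ (ℕP.+-comm 5 (2 ℕ.* n) ∙ eq) 3∤n₁) cusp
  where
    open Coefficients n
    open Theta N K ℕP.≤-refl
    lem : ∀ g c → + 16 * g ≡ + 2 * (c + + 8 * g - c)
    lem = ℤR.solve-∀
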